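{- The model of $\mathrm{SCI}_{\mathtt{mk}}$ in $\mathbf{MonRel}$ is fully abstract: for every context $\Gamma$, every type $A$ and all terms $\Gamma\vdash M:A$ and $\Gamma\vdash N:A$ of $\mathrm{SCI}_{\mathtt{mk}}$, $[\![M]\!]=[\![N]\!]$ if and only if $M\cong_{\mathtt{mk}}N$, where $\cong_{\mathtt{mk}}$ is contextual equivalence of $\mathrm{SCI}_{\mathtt{mk}}$.
   Context: **The language SCI.** Types: $A::=\mathtt{nat}\mid\mathtt{comm}\mid\mathtt{var}\mid A\multimap A$ (the first three are the base types). Terms: $M::=n\mid M\odot M\mid\mathtt{skip}\mid M;M\mid M:=M\mid\,!M\mid\mathtt{while}\ M\ \mathtt{do}\ M\mid\mathtt{ifzero}\ M\ \mathtt{then}\ M\ \mathtt{else}\ M\mid x\mid\lambda x^A.M\mid MM\mid\mathtt{new}\ x\ \mathtt{in}\ M$, where $n\in\mathbb N$, $x$ is an identifier, and $\odot$ ranges over a fixed collection of arithmetic operations on $\mathbb N$ including $+$ and (truncated) $-$. Terms are taken up to $\alpha$-equivalence ($\lambda x$ and $\mathtt{new}\ x$ bind $x$). A context $\Gamma$ is a list $x_1:A_1,\dots,x_n:A_n$ with distinct identifiers. **Typing** (all judgments must be well-formed, so $\Gamma,\Delta$ have disjoint identifiers in the application rule): $x:A\vdash x:A$; if $\Gamma,x:A\vdash M:B$ then $\Gamma\vdash\lambda x^A.M:A\multimap B$; if $\Gamma\vdash M:A\multimap B$ and $\Delta\vdash N:A$ then $\Gamma,\Delta\vdash MN:B$;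 weakening (from $\Gamma\vdash M:B$ infer $\Gamma,x:A\vdash M:B$); exchange (permuting $\Gamma$); $\vdash n:\mathtt{nat}$; $\vdash\mathtt{skip}:\mathtt{comm}$; and, with the same $\Gamma$ in all premises and conclusion: $M\odot N:\mathtt{nat}$ if $M,N:\mathtt{nat}$; $M;N:B$ if $M:\mathtt{comm}$, $N:B$, $B$ a base type; $M:=N:\mathtt{comm}$ if $M:\mathtt{var}$, $N:\mathtt{nat}$; $!M:\mathtt{nat}$ if $M:\mathtt{var}$; $\mathtt{while}\ M\ \mathtt{do}\ N:\mathtt{comm}$ if $M:\mathtt{nat}$, $N:\mathtt{comm}$; $\mathtt{ifzero}\ M\ \mathtt{then}\ N_1\ \mathtt{else}\ N_2:B$ if $M:\mathtt{nat}$, $N_1,N_2:B$, $B$ a base type; and $\Gamma\vdash\mathtt{new}\ x\ \mathtt{in}\ M:B$ if $\Gamma,x:\mathtt{var}\vdash M:B$ with $B\in\{\mathtt{comm},\mathtt{nat}\}$. **Operational semantics.** Judgments $\sigma,M\Downarrow\sigma',V$, where $M,V$ are typed in a context $\Gamma$ of $\mathtt{var}$-typed identifiers, $\sigma,\sigma'$ are stores (functions from the identifiers of $\Gamma$ to $\mathbb N$), and $V$ is a value: a numeral, $\mathtt{skip}$, an identifier, or a $\lambda$-abstraction. $(\sigma\mid x\mapsto n)$ is $\sigma$ updated/extended to send $x$ to $n$. Rules: $\sigma,V\Downarrow\sigma,V$; if $\sigma,M\Downarrow\sigma',\lambda x^A.M'$ and $\sigma',M'[N/x]\Downarrow\sigma'',V$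 then $\sigma,MN\Downarrow\sigma'',V$; if $\sigma,M_1\Downarrow\sigma',n_1$ and $\sigma',M_2\Downarrow\sigma'',n_2$ then $\sigma,M_1\odot M_2\Downarrow\sigma'',n_1\odot n_2$; if $\sigma,N\Downarrow\sigma',n$ and $\sigma',M\Downarrow\sigma'',x$ then $\sigma,M:=N\Downarrow(\sigma''\mid x\mapsto n),\mathtt{skip}$; if $\sigma,M\Downarrow\sigma',x$ then $\sigma,!M\Downarrow\sigma',\sigma'(x)$; if $\sigma,M\Downarrow\sigma',\mathtt{skip}$ and $\sigma',N\Downarrow\sigma'',V$ then $\sigma,M;N\Downarrow\sigma'',V$; if $\sigma,M\Downarrow\sigma',n$ with $n\neq0$ then $\sigma,\mathtt{while}\ M\ \mathtt{do}\ N\Downarrow\sigma',\mathtt{skip}$; if $\sigma,M\Downarrow\sigma',0$, $\sigma',N\Downarrow\sigma'',\mathtt{skip}$ and $\sigma'',\mathtt{while}\ M\ \mathtt{do}\ N\Downarrow\sigma''',\mathtt{skip}$ then $\sigma,\mathtt{while}\ M\ \mathtt{do}\ N\Downarrow\sigma''',\mathtt{skip}$; $\mathtt{ifzero}$ evaluates its guard and then the first branch (guard value $0$) or the second (guard value $\neq0$), threading the store; if $(\sigma\mid x\mapsto0),M\Downarrow(\sigma'\mid x\mapsto n),V$ then $\sigma,\mathtt{new}\ x\ \mathtt{in}\ M\Downarrow\sigma',V$ (with $x$ not in the domain of $\sigma,\sigma'$). For closed terms the empty store is omitted. **Extension.** $\mathrm{SCI}_{\mathtt{mk}}$ is SCI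 plus: $\Gamma\vdash\mathtt{mkvar}\ M\ N:\mathtt{var}$ if $\Gamma\vdash M:\mathtt{nat}\multimap\mathtt{comm}$ and $\Gamma\vdash N:\mathtt{nat}$; $\mathtt{mkvar}\ M\ N$ is a value (evaluates to itself), and: if $\sigma,N\Downarrow\sigma',n$, $\sigma',M\Downarrow\sigma'',\mathtt{mkvar}\ M_1\ M_2$ and $\sigma'',M_1n\Downarrow\sigma''',V$ then $\sigma,M:=N\Downarrow\sigma''',V$; if $\sigma,M\Downarrow\sigma',\mathtt{mkvar}\ M_1\ M_2$ and $\sigma',M_2\Downarrow\sigma'',V$ then $\sigma,!M\Downarrow\sigma'',V$. **Contextual equivalence.** For $\Gamma\vdash M,N:A$ in $\mathrm{SCI}_{\mathtt{mk}}$, $M\cong_{\mathtt{mk}}N$ iff for every context (term with a hole, possibly capturing) $C[-]$ of $\mathrm{SCI}_{\mathtt{mk}}$ with $\vdash C[M],C[N]:B$, $B\in\{\mathtt{comm},\mathtt{nat}\}$, and every value $\vdash V:B$: $C[M]\Downarrow V\iff C[N]\Downarrow V$. **Denotational semantics.** Put $\alpha\mathtt{nat}=\mathbb N$, $\alpha\mathtt{comm}=\{*\}$, $\alpha\mathtt{var}=\{\mathsf{read}(n),\mathsf{write}(n)\mid n\in\mathbb N\}$, $\alpha(A\multimap B)=(\alpha A)^*\times\alpha B$; $X^*$ is the free monoid of finite sequences, $\varepsilon$ the empty sequence. For $\Gamma=x_1:A_1,\dots,x_n:A_n$, $[\![\Gamma\vdash M:B]\!]\subseteq(\alpha A_1)^*\times\cdots\times(\alpha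 A_n)^*\times\alpha B$; elements are written $(\vec s,b)$, and $\vec s\,\vec s'$ is componentwise concatenation. Clauses: $[\![x:A\vdash x:A]\!]=\{(a,a)\mid a\in\alpha A\}$; $[\![\lambda x^A.M]\!]=\{(\vec s,(s,b))\mid(\vec s,s,b)\in[\![M]\!]\}$; $[\![MN]\!]=\{(\vec s,\vec t^{\,1}\cdots\vec t^{\,k},b)\mid\exists a_1,\dots,a_k.\ (\vec s,(a_1\cdots a_k,b))\in[\![M]\!],\ (\vec t^{\,i},a_i)\in[\![N]\!]\ (1\le i\le k)\}$; weakening inserts $\varepsilon$ for the new identifier; exchange permutes components; $[\![n]\!]=\{n\}$; $[\![\mathtt{skip}]\!]=\{*\}$; $[\![M_1\odot M_2]\!]=\{(\vec s\,\vec s',m_1\odot m_2)\mid(\vec s,m_1)\in[\![M_1]\!],(\vec s',m_2)\in[\![M_2]\!]\}$; $[\![M;N]\!]=\{(\vec s\,\vec s',b)\mid(\vec s,*)\in[\![M]\!],(\vec s',b)\in[\![N]\!]\}$; $[\![M:=N]\!]=\{(\vec s\,\vec s',*)\mid\exists n.\,(\vec s,n)\in[\![N]\!],(\vec s',\mathsf{write}(n))\in[\![M]\!]\}$; $[\![!M]\!]=\{(\vec s,n)\mid(\vec s,\mathsf{read}(n))\in[\![M]\!]\}$; $[\![\mathtt{while}\ M\ \mathtt{do}\ N]\!]=\{(\vec s^{\,1}\vec t^{\,1}\cdots\vec s^{\,j}\vec t^{\,j}\vec s,*)\mid j\ge0,\ \forall i.\,(\vec s^{\,i},0)\in[\![M]\!]\wedge(\vec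 t^{\,i},*)\in[\![N]\!],\ \exists m\ne0.\,(\vec s,m)\in[\![M]\!]\}$; $[\![\mathtt{ifzero}\ M\ \mathtt{then}\ N_1\ \mathtt{else}\ N_2]\!]=\{(\vec s\,\vec t,b)\mid(\vec s,0)\in[\![M]\!],(\vec t,b)\in[\![N_1]\!]\}\cup\{(\vec s\,\vec t,b)\mid\exists m\ne0.\,(\vec s,m)\in[\![M]\!],(\vec t,b)\in[\![N_2]\!]\}$; $[\![\mathtt{new}\ x\ \mathtt{in}\ M]\!]=\{(\vec s,b)\mid\exists s.\,(\vec s,s,b)\in[\![M]\!],\ s\text{ a cell trace}\}$, where $s\in(\alpha\mathtt{var})^*$ is a cell trace iff every $\mathsf{read}(n)$ in $s$ carries the value of the most recent preceding $\mathsf{write}$, or $0$ if there is none; $[\![\mathtt{mkvar}\ M\ N]\!]=\{(\vec s,\mathsf{write}(n))\mid(\vec s,*)\in[\![Mn]\!]\}\cup\{(\vec s,\mathsf{read}(n))\mid(\vec s,n)\in[\![N]\!]\}$. **MonRel.** Objects are monoids; morphisms $P\to Q$ are relations $R\subseteq P\times Q$ with $e_P\,R\,e_Q$; $a_iRb_i$ ($i=1,2$) implies $a_1a_2\,R\,b_1b_2$; $a\,R\,e_Q$ implies $a=e_P$; $a\,R\,b_1b_2$ implies $a=a_1a_2$ for some $a_i$ with $a_iRb_i$. Composition is relational. A morphism into a free monoid $X^*$ is determined by its restriction to $P\times X$, which may be arbitrary, so $[\![\Gamma\vdash M:B]\!]$ is the same thing as a $\mathbf{MonRel}$-morphism $(\alpha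 A_1)^*\times\cdots\times(\alpha A_n)^*\to(\alpha B)^*$ (product monoid as source).
   Formalization: In contextual equivalence, contexts must capture every identifier of Γ at its declared type; with captures at other types allowed, as the definition literally reads, equal denotations would not imply equivalence. -}

module Defs where

open import Level using (0ℓ)
open import Algebra.Bundles using (Monoid)
open import Data.Fin.Base using (Fin; zero; suc; lift; _↑ˡ_; _↑ʳ_)
open import Data.Fin.Permutation using (Permutation′; _⟨$⟩ʳ_)
open import Data.List.Base using (List; []; _∷_; _++_)
open import Data.List.Properties using (++-assoc; ++-identityʳ; ++-monoid)
open import Data.List.Relation.Unary.All using (All)
open import Data.Nat.Base using (ℕ; zero; suc; _+_; _∸_)
open import Data.Product.Base using (_×_; _,_; ∃; ∃₂)
open import Data.Sum.Base using (_⊎_)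
open import Data.Unit.Base using (⊤; tt)
open import Data.Vec.Base using (Vec; []; _∷_; lookup; _[_]≔_)
open import Data.Vec.Functional using (Vector) renaming ([] to ∅; _∷_ to _◂_)
open import Function.Base using (_∘_)
open import Function.Bundles using (_⇔_; _↣_; Injection)
open import Relation.Binary.PropositionalEquality
  using (_≡_; refl; sym; trans; cong₂)

infixr 20 _⊸_

data Ty : Set where
  nat comm var : Ty
  _⊸_          : Ty → Ty → Ty

data Base : Ty → Set where
  nat  : Base nat
  comm : Base comm
  var  : Base var

data Observable : Ty → Set where
  nat  : Observable nat
  comm : Observable comm

-- Identifiers are de Bruijn indices: index 0 is the last identifier of the
-- context, so that the extension  Γ , x : A  is  A ◂ Γ.

Ctx : ℕ → Set
Ctx = Vector Ty

-- The fixed but arbitrary collection of arithmetic operations.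

record Arithmetic : Set₁ where
  field
    Op           : Set
    eval         : Op → ℕ → ℕ → ℕ
    plus minus   : Op
    plus-is-+    : ∀ m n → eval plus m n ≡ m + n
    minus-is-∸   : ∀ m n → eval minus m n ≡ m ∸ n

------------------------------------------------------------------------
-- MonRel

record MonRel (P Q : Monoid 0ℓ 0ℓ) : Set₁ where
  private
    module P = Monoid P
    module Q = Monoid Q
  field
    Rel    : P.Carrier → Q.Carrier → Set
    -- Monoids carry a setoid equality, which relations must respect.
    resp   : ∀ {a a′ b b′} → a P.≈ a′ → b Q.≈ b′ → Rel a b → Rel a′ b′
    unit   : Rel P.ε Q.ε
    mult   : ∀ {a₁ a₂ b₁ b₂} → Rel a₁ b₁ → Rel a₂ b₂ →
             Rel (a₁ P.∙ a₂) (b₁ Q.∙ b₂)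
    unit⁻¹ : ∀ {a} → Rel a Q.ε → a P.≈ P.ε
    mult⁻¹ : ∀ {a b₁ b₂} → Rel a (b₁ Q.∙ b₂) →
             ∃₂ λ a₁ a₂ → a P.≈ a₁ P.∙ a₂ × Rel a₁ b₁ × Rel a₂ b₂

infix 4 _≈ᴿ_

_≈ᴿ_ : ∀ {P Q} → MonRel P Q → MonRel P Q → Set
R ≈ᴿ S = ∀ a b → MonRel.Rel R a b ⇔ MonRel.Rel S a b

-- Ext P R p (x₁ ⋯ xₖ)  iff  p = p₁ ⋯ pₖ  for some pᵢ with R pᵢ xᵢ.

data Ext {X : Set} (P : Monoid 0ℓ 0ℓ) (R : Monoid.Carrier P → X → Set) :
         Monoid.Carrier P → List X → Set where
  []  : ∀ {p} → Monoid._≈_ P p (Monoid.ε P) → Ext P R p []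
  add : ∀ {p q r x xs} → R p x → Ext P R q xs →
        Monoid._≈_ P r (Monoid._∙_ P p q) → Ext P R r (x ∷ xs)

-- The morphism into a free monoid with a given restriction to generators.

extend : ∀ {X : Set} (P : Monoid 0ℓ 0ℓ) →
         (Monoid.Carrier P → X → Set) → MonRel P (++-monoid X)
extend {X} P R = record
  { Rel    = Ext P R
  ; resp   = λ { p≈ refl r → resp p≈ r }
  ; unit   = [] M.refl
  ; mult   = mult
  ; unit⁻¹ = λ { ([] p≈ε) → p≈ε }
  ; mult⁻¹ = λ {_} {xs} → split xs
  }
  where
  module M = Monoid P
  open M using (_≈_; _∙_)

  resp : ∀ {p q xs} → p ≈ q → Ext P R p xs → Ext P R q xs
  resp p≈q ([] e)      = [] (M.trans (M.sym p≈q) e)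
  resp p≈q (add r s e) = add r s (M.trans (M.sym p≈q) e)

  mult : ∀ {p q xs ys} → Ext P R p xs → Ext P R q ys →
         Ext P R (p ∙ q) (xs ++ ys)
  mult ([] e) t =
    resp (M.sym (M.trans (M.∙-congʳ e) (M.identityˡ _))) t
  mult (add r s e) t =
    add r (mult s t) (M.trans (M.∙-congʳ e) (M.assoc _ _ _))

  split : ∀ {p} xs {ys} → Ext P R p (xs ++ ys) →
          ∃₂ λ p₁ p₂ → p ≈ p₁ ∙ p₂ × Ext P R p₁ xs × Ext P R p₂ ys
  split []       t           = _ , _ , M.sym (M.identityˡ _) , [] M.refl , t
  split (x ∷ xs) (add r s e) with split xs s
  ... | _ , _ , q≈ , s₁ , s₂ =
    _ , _ , M.trans e (M.trans (M.∙-congˡ q≈) (M.sym (M.assoc _ _ _))) ,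
    add r s₁ M.refl , s₂

------------------------------------------------------------------------
-- Alphabets and traces

data VarAct : Set where
  read write : ℕ → VarAct

α : Ty → Set
α nat     = ℕ
α comm    = ⊤
α var     = VarAct
α (A ⊸ B) = List (α A) × α B

Trace : ∀ {n} → Ctx n → Set
Trace Γ = ∀ i → List (α (Γ i))

infix  4 _≋_
infixr 7 _∙_
infixr 5 _◂ᵗ_

_≋_ : ∀ {n} {X : Fin n → Set} (s t : ∀ i → List (X i)) → Set
s ≋ t = ∀ i → s i ≡ t i

_∙_ : ∀ {n} {X : Fin n → Set} (s t : ∀ i → List (X i)) → ∀ i → List (X i)
(s ∙ t) i = s i ++ t i

_◂ᵗ_ : ∀ {n} {X : Fin (suc n) → Set} →
       List (X zero) → (∀ i → List (X (suc i))) → ∀ i → List (X i)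
(s ◂ᵗ u) zero    = s
(s ◂ᵗ u) (suc i) = u i

-- The product monoid (α A₁)* × ⋯ × (α Aₙ)*.

Traces : ∀ {n} → Ctx n → Monoid 0ℓ 0ℓ
Traces Γ = record
  { Carrier  = Trace Γ
  ; _≈_      = _≋_
  ; _∙_      = _∙_
  ; ε        = λ _ → []
  ; isMonoid = record
    { isSemigroup = record
      { isMagma = record
        { isEquivalence = record
          { refl  = λ _ → refl
          ; sym   = λ e i → sym (e i)
          ; trans = λ e f i → trans (e i) (f i)
          }
        ; ∙-cong = λ e f i → cong₂ _++_ (e i) (f i)
        }
      ; assoc = λ s t u i → ++-assoc (s i) (t i) (u i)
      }
    ; identity = (λ _ _ → refl) , (λ s i → ++-identityʳ (s i))
    }
  }

-- CellTrace k s : s is a possible history of a cell with current contents k.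

data CellTrace : ℕ → List VarAct → Set where
  []    : ∀ {k} → CellTrace k []
  read  : ∀ {k s} → CellTrace k s → CellTrace k (read k ∷ s)
  write : ∀ {k s} j → CellTrace j s → CellTrace k (write j ∷ s)

-- Traces s¹ t¹ ⋯ sʲ tʲ s of a loop with guard relation G and body relation C.

data Loop {n} {Γ : Ctx n} (G : Trace Γ → ℕ → Set) (C : Trace Γ → ⊤ → Set) :
          Trace Γ → Set where
  stop : ∀ {u m} → G u (suc m) → Loop G C u
  step : ∀ {u v} (s t : Trace Γ) → G s 0 → C t tt → Loop G C v →
         u ≋ s ∙ t ∙ v → Loop G C u

------------------------------------------------------------------------
-- The language SCI with mkvar

module SCImk (𝓐 : Arithmetic) where

  open Arithmetic 𝓐

  -- Well-scoped terms; ƛ and new bind index 0 of their last argument.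

  data Tm (n : ℕ) : Set where
    num    : ℕ → Tm n
    binop  : Op → Tm n → Tm n → Tm n
    skip   : Tm n
    seq    : Tm n → Tm n → Tm n
    assign : Tm n → Tm n → Tm n
    deref  : Tm n → Tm n
    while  : Tm n → Tm n → Tm n
    ifzero : Tm n → Tm n → Tm n → Tm n
    `_     : Fin n → Tm n
    ƛ      : Ty → Tm (suc n) → Tm n
    _·_    : Tm n → Tm n → Tm n
    new    : Tm (suc n) → Tm n
    mkvar  : Tm n → Tm n → Tm n

  rename : ∀ {m n} → (Fin m → Fin n) → Tm m → Tm n
  rename ρ (num k)        = num k
  rename ρ (binop o M N)  = binop o (rename ρ M) (rename ρ N)
  rename ρ skip           = skip
  rename ρ (seq M N)      = seq (rename ρ M) (rename ρ N)
  rename ρ (assign M N)   = assign (rename ρ M) (rename ρ N)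
  rename ρ (deref M)      = deref (rename ρ M)
  rename ρ (while M N)    = while (rename ρ M) (rename ρ N)
  rename ρ (ifzero M N P) = ifzero (rename ρ M) (rename ρ N) (rename ρ P)
  rename ρ (` i)          = ` ρ i
  rename ρ (ƛ A M)        = ƛ A (rename (lift 1 ρ) M)
  rename ρ (M · N)        = rename ρ M · rename ρ N
  rename ρ (new M)        = new (rename (lift 1 ρ) M)
  rename ρ (mkvar M N)    = mkvar (rename ρ M) (rename ρ N)

  subst : ∀ {m n} → (Fin m → Tm n) → Tm m → Tm n
  subst θ (num k)        = num k
  subst θ (binop o M N)  = binop o (subst θ M) (subst θ N)
  subst θ skip           = skip
  subst θ (seq M N)      = seq (subst θ M) (subst θ N)
  subst θ (assign M N)   = assign (subst θ M) (subst θ N)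
  subst θ (deref M)      = deref (subst θ M)
  subst θ (while M N)    = while (subst θ M) (subst θ N)
  subst θ (ifzero M N P) = ifzero (subst θ M) (subst θ N) (subst θ P)
  subst θ (` i)          = θ i
  subst θ (ƛ A M)        = ƛ A (subst ((` zero) ◂ (rename suc ∘ θ)) M)
  subst θ (M · N)        = subst θ M · subst θ N
  subst θ (new M)        = new (subst ((` zero) ◂ (rename suc ∘ θ)) M)
  subst θ (mkvar M N)    = mkvar (subst θ M) (subst θ N)

  infix 30 _[_/0]

  _[_/0] : ∀ {n} → Tm (suc n) → Tm n → Tm n
  M [ N /0] = subst (N ◂ `_) M

  ----------------------------------------------------------------------
  -- Typing

  infix 4 _⊢_∶_

  -- Contexts are functions, so the rules restrict the conclusion's context
  -- to obtain those of the premises; this avoids any appeal to function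
  -- extensionality.  In app the context Γ consists of two disjoint blocks,
  -- the first for the function and the second for its argument.

  data _⊢_∶_ : ∀ {n} → Ctx n → Tm n → Ty → Set where
    id     : {Γ : Ctx 1} → Γ ⊢ ` zero ∶ Γ zero
    lam    : ∀ {n} {Γ : Ctx n} {A B M} →
             A ◂ Γ ⊢ M ∶ B → Γ ⊢ ƛ A M ∶ A ⊸ B
    app    : ∀ {m n} {Γ : Ctx (m + n)} {A B M N} →
             Γ ∘ (_↑ˡ n) ⊢ M ∶ A ⊸ B → Γ ∘ (m ↑ʳ_) ⊢ N ∶ A →
             Γ ⊢ rename (_↑ˡ n) M · rename (m ↑ʳ_) N ∶ B
    weak   : ∀ {n} {Γ : Ctx (suc n)} {B M} →
             Γ ∘ suc ⊢ M ∶ B → Γ ⊢ rename suc M ∶ B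
    exch   : ∀ {n} {Γ : Ctx n} {B M} (π : Permutation′ n) →
             Γ ∘ (π ⟨$⟩ʳ_) ⊢ M ∶ B → Γ ⊢ rename (π ⟨$⟩ʳ_) M ∶ B
    num    : {Γ : Ctx 0} (k : ℕ) → Γ ⊢ num k ∶ nat
    skip   : {Γ : Ctx 0} → Γ ⊢ skip ∶ comm
    binop  : ∀ {n} {Γ : Ctx n} {M N} (o : Op) →
             Γ ⊢ M ∶ nat → Γ ⊢ N ∶ nat → Γ ⊢ binop o M N ∶ nat
    seq    : ∀ {n} {Γ : Ctx n} {B M N} → Base B →
             Γ ⊢ M ∶ comm → Γ ⊢ N ∶ B → Γ ⊢ seq M N ∶ B
    assign : ∀ {n} {Γ : Ctx n} {M N} →
             Γ ⊢ M ∶ var → Γ ⊢ N ∶ nat → Γ ⊢ assign M N ∶ comm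
    deref  : ∀ {n} {Γ : Ctx n} {M} →
             Γ ⊢ M ∶ var → Γ ⊢ deref M ∶ nat
    while  : ∀ {n} {Γ : Ctx n} {M N} →
             Γ ⊢ M ∶ nat → Γ ⊢ N ∶ comm → Γ ⊢ while M N ∶ comm
    ifzero : ∀ {n} {Γ : Ctx n} {B M N₁ N₂} → Base B →
             Γ ⊢ M ∶ nat → Γ ⊢ N₁ ∶ B → Γ ⊢ N₂ ∶ B →
             Γ ⊢ ifzero M N₁ N₂ ∶ B
    new    : ∀ {n} {Γ : Ctx n} {B M} → Observable B →
             var ◂ Γ ⊢ M ∶ B → Γ ⊢ new M ∶ B
    mkvar  : ∀ {n} {Γ : Ctx n} {M N} →
             Γ ⊢ M ∶ nat ⊸ comm → Γ ⊢ N ∶ nat → Γ ⊢ mkvar M N ∶ var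

  ----------------------------------------------------------------------
  -- Operational semantics

  data Value {n} : Tm n → Set where
    num   : ∀ k → Value (num k)
    skip  : Value skip
    `_    : ∀ i → Value (` i)
    ƛ     : ∀ A M → Value (ƛ A M)
    mkvar : ∀ M N → Value (mkvar M N)

  Store : ℕ → Set
  Store = Vec ℕ

  infix 4 ⟨_∥_⟩⇓⟨_∥_⟩

  -- The result of new is weakened because it may not mention the new cell.

  data ⟨_∥_⟩⇓⟨_∥_⟩ {n} : Store n → Tm n → Store n → Tm n → Set where
    val      : ∀ {σ V} → Value V → ⟨ σ ∥ V ⟩⇓⟨ σ ∥ V ⟩
    app      : ∀ {σ σ′ σ″ A M M′ N V} →
               ⟨ σ ∥ M ⟩⇓⟨ σ′ ∥ ƛ A M′ ⟩ →
               ⟨ σ′ ∥ M′ [ N /0] ⟩⇓⟨ σ″ ∥ V ⟩ →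
               ⟨ σ ∥ M · N ⟩⇓⟨ σ″ ∥ V ⟩
    binop    : ∀ {σ σ′ σ″ o M₁ M₂ k₁ k₂} →
               ⟨ σ ∥ M₁ ⟩⇓⟨ σ′ ∥ num k₁ ⟩ →
               ⟨ σ′ ∥ M₂ ⟩⇓⟨ σ″ ∥ num k₂ ⟩ →
               ⟨ σ ∥ binop o M₁ M₂ ⟩⇓⟨ σ″ ∥ num (eval o k₁ k₂) ⟩
    assign   : ∀ {σ σ′ σ″ M N k x} →
               ⟨ σ ∥ N ⟩⇓⟨ σ′ ∥ num k ⟩ →
               ⟨ σ′ ∥ M ⟩⇓⟨ σ″ ∥ ` x ⟩ →
               ⟨ σ ∥ assign M N ⟩⇓⟨ σ″ [ x ]≔ k ∥ skip ⟩
    deref    : ∀ {σ σ′ M x} →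
               ⟨ σ ∥ M ⟩⇓⟨ σ′ ∥ ` x ⟩ →
               ⟨ σ ∥ deref M ⟩⇓⟨ σ′ ∥ num (lookup σ′ x) ⟩
    seq      : ∀ {σ σ′ σ″ M N V} →
               ⟨ σ ∥ M ⟩⇓⟨ σ′ ∥ skip ⟩ →
               ⟨ σ′ ∥ N ⟩⇓⟨ σ″ ∥ V ⟩ →
               ⟨ σ ∥ seq M N ⟩⇓⟨ σ″ ∥ V ⟩
    while≢0  : ∀ {σ σ′ M N k} →
               ⟨ σ ∥ M ⟩⇓⟨ σ′ ∥ num (suc k) ⟩ →
               ⟨ σ ∥ while M N ⟩⇓⟨ σ′ ∥ skip ⟩
    while≡0  : ∀ {σ σ′ σ″ σ‴ M N} →
               ⟨ σ ∥ M ⟩⇓⟨ σ′ ∥ num 0 ⟩ →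
               ⟨ σ′ ∥ N ⟩⇓⟨ σ″ ∥ skip ⟩ →
               ⟨ σ″ ∥ while M N ⟩⇓⟨ σ‴ ∥ skip ⟩ →
               ⟨ σ ∥ while M N ⟩⇓⟨ σ‴ ∥ skip ⟩
    ifzero≡0 : ∀ {σ σ′ σ″ M N₁ N₂ V} →
               ⟨ σ ∥ M ⟩⇓⟨ σ′ ∥ num 0 ⟩ →
               ⟨ σ′ ∥ N₁ ⟩⇓⟨ σ″ ∥ V ⟩ →
               ⟨ σ ∥ ifzero M N₁ N₂ ⟩⇓⟨ σ″ ∥ V ⟩
    ifzero≢0 : ∀ {σ σ′ σ″ M N₁ N₂ k V} →
               ⟨ σ ∥ M ⟩⇓⟨ σ′ ∥ num (suc k) ⟩ →
               ⟨ σ′ ∥ N₂ ⟩⇓⟨ σ″ ∥ V ⟩ →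
               ⟨ σ ∥ ifzero M N₁ N₂ ⟩⇓⟨ σ″ ∥ V ⟩
    new      : ∀ {σ σ′ k M V} →
               ⟨ 0 ∷ σ ∥ M ⟩⇓⟨ k ∷ σ′ ∥ rename suc V ⟩ →
               ⟨ σ ∥ new M ⟩⇓⟨ σ′ ∥ V ⟩
    assignᵐᵏ : ∀ {σ σ′ σ″ σ‴ M N M₁ M₂ k V} →
               ⟨ σ ∥ N ⟩⇓⟨ σ′ ∥ num k ⟩ →
               ⟨ σ′ ∥ M ⟩⇓⟨ σ″ ∥ mkvar M₁ M₂ ⟩ →
               ⟨ σ″ ∥ M₁ · num k ⟩⇓⟨ σ‴ ∥ V ⟩ →
               ⟨ σ ∥ assign M N ⟩⇓⟨ σ‴ ∥ V ⟩
    derefᵐᵏ  : ∀ {σ σ′ σ″ M M₁ M₂ V} →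
               ⟨ σ ∥ M ⟩⇓⟨ σ′ ∥ mkvar M₁ M₂ ⟩ →
               ⟨ σ′ ∥ M₂ ⟩⇓⟨ σ″ ∥ V ⟩ →
               ⟨ σ ∥ deref M ⟩⇓⟨ σ″ ∥ V ⟩

  infix 4 _⇓_

  _⇓_ : Tm 0 → Tm 0 → Set
  M ⇓ V = ⟨ [] ∥ M ⟩⇓⟨ [] ∥ V ⟩

  ----------------------------------------------------------------------
  -- Contextual equivalence

  -- Cxt Γ Δ: terms in scope Δ with one hole for terms in context Γ.  At the
  -- hole, ρ names the binder that captures each identifier of Γ.  A binder
  -- must capture an identifier at its declared type: with other captures
  -- allowed, the equivalence of Γ ⊢ M and Γ ⊢ N would not be about M and N
  -- as terms in Γ, and denotational equality would not imply it.

  data Cxt {n} (Γ : Ctx n) : ∀ {m} → Ctx m → Set where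
    hole    : ∀ {m} {Δ : Ctx m} (ρ : Fin n ↣ Fin m) →
              (∀ i → Δ (Injection.to ρ i) ≡ Γ i) → Cxt Γ Δ
    binop₁  : ∀ {m} {Δ : Ctx m} → Op → Cxt Γ Δ → Tm m → Cxt Γ Δ
    binop₂  : ∀ {m} {Δ : Ctx m} → Op → Tm m → Cxt Γ Δ → Cxt Γ Δ
    seq₁    : ∀ {m} {Δ : Ctx m} → Cxt Γ Δ → Tm m → Cxt Γ Δ
    seq₂    : ∀ {m} {Δ : Ctx m} → Tm m → Cxt Γ Δ → Cxt Γ Δ
    assign₁ : ∀ {m} {Δ : Ctx m} → Cxt Γ Δ → Tm m → Cxt Γ Δ
    assign₂ : ∀ {m} {Δ : Ctx m} → Tm m → Cxt Γ Δ → Cxt Γ Δ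
    deref   : ∀ {m} {Δ : Ctx m} → Cxt Γ Δ → Cxt Γ Δ
    while₁  : ∀ {m} {Δ : Ctx m} → Cxt Γ Δ → Tm m → Cxt Γ Δ
    while₂  : ∀ {m} {Δ : Ctx m} → Tm m → Cxt Γ Δ → Cxt Γ Δ
    ifzero₁ : ∀ {m} {Δ : Ctx m} → Cxt Γ Δ → Tm m → Tm m → Cxt Γ Δ
    ifzero₂ : ∀ {m} {Δ : Ctx m} → Tm m → Cxt Γ Δ → Tm m → Cxt Γ Δ
    ifzero₃ : ∀ {m} {Δ : Ctx m} → Tm m → Tm m → Cxt Γ Δ → Cxt Γ Δ
    ƛ       : ∀ {m} {Δ : Ctx m} A → Cxt Γ (A ◂ Δ) → Cxt Γ Δ
    app₁    : ∀ {m} {Δ : Ctx m} → Cxt Γ Δ → Tm m → Cxt Γ Δ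
    app₂    : ∀ {m} {Δ : Ctx m} → Tm m → Cxt Γ Δ → Cxt Γ Δ
    new     : ∀ {m} {Δ : Ctx m} → Cxt Γ (var ◂ Δ) → Cxt Γ Δ
    mkvar₁  : ∀ {m} {Δ : Ctx m} → Cxt Γ Δ → Tm m → Cxt Γ Δ
    mkvar₂  : ∀ {m} {Δ : Ctx m} → Tm m → Cxt Γ Δ → Cxt Γ Δ

  infix 30 _⟪_⟫

  _⟪_⟫ : ∀ {m n} {Γ : Ctx n} {Δ : Ctx m} → Cxt Γ Δ → Tm n → Tm m
  hole ρ _      ⟪ M ⟫ = rename (Injection.to ρ) M
  binop₁ o C N  ⟪ M ⟫ = binop o (C ⟪ M ⟫) N
  binop₂ o N C  ⟪ M ⟫ = binop o N (C ⟪ M ⟫)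
  seq₁ C N      ⟪ M ⟫ = seq (C ⟪ M ⟫) N
  seq₂ N C      ⟪ M ⟫ = seq N (C ⟪ M ⟫)
  assign₁ C N   ⟪ M ⟫ = assign (C ⟪ M ⟫) N
  assign₂ N C   ⟪ M ⟫ = assign N (C ⟪ M ⟫)
  deref C       ⟪ M ⟫ = deref (C ⟪ M ⟫)
  while₁ C N    ⟪ M ⟫ = while (C ⟪ M ⟫) N
  while₂ N C    ⟪ M ⟫ = while N (C ⟪ M ⟫)
  ifzero₁ C N P ⟪ M ⟫ = ifzero (C ⟪ M ⟫) N P
  ifzero₂ N C P ⟪ M ⟫ = ifzero N (C ⟪ M ⟫) P
  ifzero₃ N P C ⟪ M ⟫ = ifzero N P (C ⟪ M ⟫)
  ƛ A C         ⟪ M ⟫ = ƛ A (C ⟪ M ⟫)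
  app₁ C N      ⟪ M ⟫ = (C ⟪ M ⟫) · N
  app₂ N C      ⟪ M ⟫ = N · (C ⟪ M ⟫)
  new C         ⟪ M ⟫ = new (C ⟪ M ⟫)
  mkvar₁ C N    ⟪ M ⟫ = mkvar (C ⟪ M ⟫) N
  mkvar₂ N C    ⟪ M ⟫ = mkvar N (C ⟪ M ⟫)

  infix 4 _⊢_≅_

  _⊢_≅_ : ∀ {n} → Ctx n → Tm n → Tm n → Set
  Γ ⊢ M ≅ N =
    (C : Cxt Γ ∅) {B : Ty} → Observable B →
    ∅ ⊢ C ⟪ M ⟫ ∶ B → ∅ ⊢ C ⟪ N ⟫ ∶ B →
    (V : Tm 0) → Value V → ∅ ⊢ V ∶ B →
    C ⟪ M ⟫ ⇓ V ⇔ C ⟪ N ⟫ ⇓ V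

  ----------------------------------------------------------------------
  -- Denotational semantics

  -- By recursion on typing derivations.  That ⟦ d ⟧ depends only on the
  -- judgement derived is a property of the definition, not part of it.

  ⟦_⟧₁ : ∀ {n} {Γ : Ctx n} {M B} → Γ ⊢ M ∶ B → Trace Γ → α B → Set
  ⟦ id ⟧₁              u a         = u zero ≡ a ∷ []
  ⟦ lam d ⟧₁           u (s , b)   = ⟦ d ⟧₁ (s ◂ᵗ u) b
  ⟦ app {m} {n} {Γ} d e ⟧₁ u b     =
    ∃ λ as → ⟦ d ⟧₁ (u ∘ (_↑ˡ n)) (as , b) ×
             Ext (Traces (Γ ∘ (m ↑ʳ_))) ⟦ e ⟧₁ (u ∘ (m ↑ʳ_)) as
  ⟦ weak d ⟧₁          u b         = u zero ≡ [] × ⟦ d ⟧₁ (u ∘ suc) b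
  ⟦ exch π d ⟧₁        u b         = ⟦ d ⟧₁ (u ∘ (π ⟨$⟩ʳ_)) b
  ⟦ num k ⟧₁           u b         = b ≡ k
  ⟦ skip ⟧₁            u b         = ⊤
  ⟦ binop {Γ = Γ} o d e ⟧₁ u b     =
    ∃₂ λ (s t : Trace Γ) → u ≋ s ∙ t × ∃₂ λ k l →
      b ≡ eval o k l × ⟦ d ⟧₁ s k × ⟦ e ⟧₁ t l
  ⟦ seq {Γ = Γ} _ d e ⟧₁ u b       =
    ∃₂ λ (s t : Trace Γ) → u ≋ s ∙ t × ⟦ d ⟧₁ s tt × ⟦ e ⟧₁ t b
  ⟦ assign {Γ = Γ} d e ⟧₁ u b      =
    ∃₂ λ (s t : Trace Γ) → u ≋ s ∙ t × ∃ λ k →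
      ⟦ e ⟧₁ s k × ⟦ d ⟧₁ t (write k)
  ⟦ deref d ⟧₁         u b         = ⟦ d ⟧₁ u (read b)
  ⟦ while d e ⟧₁       u b         = Loop ⟦ d ⟧₁ ⟦ e ⟧₁ u
  ⟦ ifzero {Γ = Γ} _ d e f ⟧₁ u b  =
    ∃₂ λ (s t : Trace Γ) → u ≋ s ∙ t ×
      (⟦ d ⟧₁ s 0 × ⟦ e ⟧₁ t b ⊎ (∃ λ k → ⟦ d ⟧₁ s (suc k)) × ⟦ f ⟧₁ t b)
  ⟦ new _ d ⟧₁         u b         = ∃ λ s → CellTrace 0 s × ⟦ d ⟧₁ (s ◂ᵗ u) b
  -- The first case is the clause for M applied to the numeral k, which has
  -- the single element k in the empty context.
  ⟦ mkvar d e ⟧₁       u (write k) = ∃ λ ks → All (_≡ k) ks × ⟦ d ⟧₁ u (ks , tt)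
  ⟦ mkvar d e ⟧₁       u (read k)  = ⟦ e ⟧₁ u k

  ⟦_⟧ : ∀ {n} {Γ : Ctx n} {M B} → Γ ⊢ M ∶ B → MonRel (Traces Γ) (++-monoid (α B))
  ⟦_⟧ {Γ = Γ} d = extend (Traces Γ) ⟦ d ⟧₁

{-# OPTIONS --safe #-}
module Submission where

-- Forgetting types, an element (u , b) of a denotation becomes a derivation
-- u ⊩ M ∶ p in a non-idempotent intersection type system whose types p are the
-- elements of the alphabets.  Affine typing makes the identifiers of a redex
-- disjoint, so the traces of a function and of its argument commute and ⊩ is
-- invariant under β.  Evaluation therefore preserves points, and conversely a
-- point of a program forces its evaluation, because each step shrinks the
-- derivation.  Since ⊩ is compositional, equal denotations imply contextual
-- equivalence.  For the converse, every element a of α A has a closed test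
-- term A ⊸ comm that converges exactly on the terms having a: it applies its
-- argument to generators that count their uses in a local cell, and finally
-- checks the counts.

open import Defs
open import Algebra.Properties.CommutativeSemigroup using (interchange)
open import Data.Bool.Base using (if_then_else_)
open import Data.Fin.Base using (Fin; zero; suc; lift; _↑ˡ_; _↑ʳ_; splitAt)
open import Data.Fin.Permutation as Perm using (_⟨$⟩ʳ_; _⟨$⟩ˡ_; inverseˡ; inverseʳ)
open import Data.Fin.Properties
  using (suc-injective; _≟_; any?; ↑ˡ-injective; ↑ʳ-injective; splitAt⁻¹-↑ˡ; splitAt⁻¹-↑ʳ)
open import Data.List.Base using (List; []; _∷_; _++_; map; length)
open import Data.List.Properties
  using (++-assoc; ++-identityʳ; ++-conicalˡ; ++-conicalʳ; map-++; map-injective; ∷-injective)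
open import Data.List.Relation.Unary.All as All using (All; []; _∷_)
import Data.List.Relation.Unary.All.Properties as All
open import Data.Nat.Base using (ℕ; zero; suc; _+_; _∸_; _≤_; z≤n; s≤s)
open import Data.Nat.Properties
  using ( +-assoc; +-identityʳ; +-suc; +-monoˡ-≤; +-mono-≤; m≢1+n+m
        ; +-0-commutativeMonoid; +-commutativeSemigroup
        ; m≤m+n; m≤n+m; ≤-refl; ≤-reflexive; ≤-trans; ≤-antisym; n≤1+n; m≤n⇒m≤1+n
        ; <-irrefl; <⇒≤; <⇒≱; m∸n≡0⇒m≤n; m∸n≢0⇒n<m; n∸n≡0)
open import Algebra.Properties.CommutativeMonoid.Sum +-0-commutativeMonoid
  using (sum; ∑-distrib-+; sum-cong-≗; sum-replicate-zero)
open import Data.Product.Base using (_×_; _,_; ∃; ∃₂; proj₁; proj₂)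
open import Data.Sum.Base as Sum using (_⊎_; inj₁; inj₂)
open import Data.Unit.Base using (⊤; tt)
open import Data.Vec.Base using ([]; _∷_; lookup; _[_]≔_)
open import Data.Vec.Properties using (lookup∘update; lookup∘update′)
open import Data.Vec.Functional using () renaming ([] to ∅; _∷_ to _◂_)
open import Function.Base using (_∘_)
open import Function.Bundles using (_⇔_; mk⇔; Injection; module Equivalence)
open import Function.Construct.Identity using (↣-id)
open import Relation.Binary.PropositionalEquality
  using (_≡_; _≢_; refl; sym; trans; cong; cong₂) renaming (subst to transport)
open import Relation.Nullary using (¬_; contradiction; yes; no; does)
open import Relation.Nullary.Decidable using (dec-true; dec-false)

-- A term has many typing derivations, and the structural rules rename their subject, so induction
-- on `⊢` does not fit evaluation. Attaching points to bare terms avoids this; types are recovered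
-- through `⊢ᵃ` where they matter. As an argument is derived once per use, adequacy is an induction
-- on size and needs no computability predicates.
--
-- For the tests, the obstacle is that an element of `A ⊸ B` prescribes a sequence of points drawn
-- from the argument, so the argument that is supplied must answer differently at successive uses.
-- State achieves this, and affine typing permits it: in the call the cell occurs in the argument
-- alone, and the check of the count follows in a `seq`, whose parts may share identifiers. At type
-- `var`, `mkvar` provides variables that allow a single action and diverge on every other. A
-- supplied argument that is itself a function has to check what it is applied to, so tests and
-- generators are defined by mutual recursion on types.

module FullAbstraction (𝓐 : Arithmetic) where

  open Arithmetic 𝓐
  open SCImk 𝓐

  -- Points and their derivations

  -- The elements of all alphabets α A, without their types.

  infixr 6 _⇒_

  data Pt : Set where
    num   : ℕ → Pt
    done  : Pt
    rd wr : ℕ → Pt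
    _⇒_   : List Pt → Pt → Pt

  infix 4 _∶ᵖ_

  data _∶ᵖ_ : Pt → Ty → Set where
    num  : ∀ {k} → num k ∶ᵖ nat
    done : done ∶ᵖ comm
    rd   : ∀ {k} → rd k ∶ᵖ var
    wr   : ∀ {k} → wr k ∶ᵖ var
    _⇒_  : ∀ {ps p A B} → All (_∶ᵖ A) ps → p ∶ᵖ B → ps ⇒ p ∶ᵖ A ⊸ B

  Env : ℕ → Set
  Env n = Fin n → List Pt

  Nil : ∀ {n} → Env n → Set
  Nil u = ∀ i → u i ≡ []

  ε : ∀ {n} → Env n
  ε _ = []

  -- Environments are compared pointwise only, so an axiom states a property of its environment
  -- instead of naming it; `single` provides the witness.
  Only : ∀ {n} → Fin n → List Pt → Env n → Set
  Only i ps u = u i ≡ ps × (∀ j → j ≢ i → u j ≡ [])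

  single : ∀ {n} → Fin n → List Pt → Env n
  single i ps j = if does (j ≟ i) then ps else []

  single-only : ∀ {n} (i : Fin n) ps → Only i ps (single i ps)
  single-only i ps = hit , off
    where
    hit : single i ps i ≡ ps
    hit rewrite dec-true (i ≟ i) refl = refl
    off : ∀ j → j ≢ i → single i ps j ≡ []
    off j ne rewrite dec-false (j ≟ i) ne = refl

  -- `CellTrace` forgets the contents with which a history ends. Here they are kept, so that the
  -- histories of successive phases of an evaluation compose.
  data Run : ℕ → List Pt → ℕ → Set where
    []  : ∀ {k} → Run k [] k
    rd∷ : ∀ {k m s} → Run k s m → Run k (rd k ∷ s) m
    wr∷ : ∀ {k m s} j → Run j s m → Run k (wr j ∷ s) m

  -- The rules without binders, by number of premises: Bin M p N q K r is the
  -- rule that derives s ∙ t ⊩ K ∶ r from s ⊩ M ∶ p and t ⊩ N ∶ q.  It covers the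
  -- three premises of a loop iteration because the last two are joined by seq.

  data Const {n} : Tm n → Pt → Set where
    num  : ∀ {k} → Const (num k) (num k)
    skip : Const skip done

  data Un {n} : Tm n → Pt → Tm n → Pt → Set where
    deref : ∀ {M k} → Un M (rd k) (deref M) (num k)
    while : ∀ {M N k} → Un M (num (suc k)) (while M N) done
    write : ∀ {M N k ps} → All (_≡ num k) ps → Un M (ps ⇒ done) (mkvar M N) (wr k)
    read  : ∀ {M N k} → Un N (num k) (mkvar M N) (rd k)

  data Bin {n} : Tm n → Pt → Tm n → Pt → Tm n → Pt → Set where
    binop   : ∀ {o M N k l} → Bin M (num k) N (num l) (binop o M N) (num (eval o k l))
    seq     : ∀ {M N p} → Bin M done N p (seq M N) p
    assign  : ∀ {M N k} → Bin N (num k) M (wr k) (assign M N) done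
    while   : ∀ {M N} → Bin M (num 0) (seq N (while M N)) done (while M N) done
    ifzero₀ : ∀ {M N P p} → Bin M (num 0) N p (ifzero M N P) p
    ifzero₊ : ∀ {M N P k p} → Bin M (num (suc k)) P p (ifzero M N P) p

  -- The index is the number of rules other than axioms.  The typing condition in
  -- lam keeps the traces that reach the hole of a context well typed.

  infix 4 _⊩[_]_∶_ _⊩*[_]_∶_

  data _⊩[_]_∶_ {n} (u : Env n) : ℕ → Tm n → Pt → Set
  data _⊩*[_]_∶_ {n} (u : Env n) : ℕ → Tm n → List Pt → Set

  data _⊩[_]_∶_ {n} u where
    const : ∀ {M p} → Const M p → Nil u → u ⊩[ 0 ] M ∶ p
    var   : ∀ {i p} → Only i (p ∷ []) u → u ⊩[ 0 ] ` i ∶ p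
    lam   : ∀ {k A M ps p} → All (_∶ᵖ A) ps → ps ◂ u ⊩[ k ] M ∶ p →
            u ⊩[ suc k ] ƛ A M ∶ ps ⇒ p
    app   : ∀ {k l M N ps p} {s t : Env n} → u ≋ s ∙ t → s ⊩[ k ] M ∶ ps ⇒ p →
            t ⊩*[ l ] N ∶ ps → u ⊩[ suc (k + l) ] M · N ∶ p
    new   : ∀ {k M c m p} → Run 0 c m → c ◂ u ⊩[ k ] M ∶ p → u ⊩[ suc k ] new M ∶ p
    un    : ∀ {k M p K r} → Un M p K r → u ⊩[ k ] M ∶ p → u ⊩[ suc k ] K ∶ r
    bin   : ∀ {k l M p N q K r} {s t : Env n} → Bin M p N q K r → u ≋ s ∙ t →
            s ⊩[ k ] M ∶ p → t ⊩[ l ] N ∶ q → u ⊩[ suc (k + l) ] K ∶ r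

  data _⊩*[_]_∶_ {n} u where
    []  : ∀ {M} → Nil u → u ⊩*[ 0 ] M ∶ []
    _⟨_⟩∷_ : ∀ {k l M p ps} {s t : Env n} → s ⊩[ k ] M ∶ p → u ≋ s ∙ t → t ⊩*[ l ] M ∶ ps →
             u ⊩*[ k + l ] M ∶ p ∷ ps

  ≋-sym : ∀ {n} {u v : Env n} → u ≋ v → v ≋ u
  ≋-sym e i = sym (e i)

  ≋-trans : ∀ {n} {u v w : Env n} → u ≋ v → v ≋ w → u ≋ w
  ≋-trans e f i = trans (e i) (f i)

  ◂-cong : ∀ {n} {a b : List Pt} {u v : Env n} → a ≡ b → u ≋ v → a ◂ u ≋ b ◂ v
  ◂-cong e f zero    = e
  ◂-cong e f (suc i) = f i

  ◂-η : ∀ {n} (u : Env (suc n)) → u ≋ u zero ◂ (u ∘ suc)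
  ◂-η u zero    = refl
  ◂-η u (suc i) = refl

  resp : ∀ {n k} {u v : Env n} {M p} → u ≋ v → u ⊩[ k ] M ∶ p → v ⊩[ k ] M ∶ p
  resp e (const c z)           = const c (λ i → trans (sym (e i)) (z i))
  resp e (var {i} (h , z))     =
    var (trans (sym (e i)) h , λ j j≢i → trans (sym (e j)) (z j j≢i))
  resp e (lam τ d)             = lam τ (resp (◂-cong refl e) d)
  resp e (app u≋ d ds)         = app (≋-trans (≋-sym e) u≋) d ds
  resp e (new r d)             = new r (resp (◂-cong refl e) d)
  resp e (un f d)              = un f (resp e d)
  resp e (bin f u≋ d₁ d₂)      = bin f (≋-trans (≋-sym e) u≋) d₁ d₂

  resp* : ∀ {n k} {u v : Env n} {M ps} → u ≋ v → u ⊩*[ k ] M ∶ ps → v ⊩*[ k ] M ∶ ps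
  resp* e ([] z)         = [] (λ i → trans (sym (e i)) (z i))
  resp* e (d ⟨ u≋ ⟩∷ ds) = d ⟨ ≋-trans (≋-sym e) u≋ ⟩∷ ds

  -- Renaming

  Inj : ∀ {m n} → (Fin m → Fin n) → Set
  Inj ρ = ∀ {i j} → ρ i ≡ ρ j → i ≡ j

  -- The image of `u` along `ρ`, empty off the range. As a relation it can be split and lifted index
  -- by index without deciding membership in the range.
  Push : ∀ {m n} → (Fin m → Fin n) → Env n → Env m → Set
  Push ρ v u = ∀ j → (∃ λ i → ρ i ≡ j × v j ≡ u i) ⊎ ((∀ i → ρ i ≢ j) × v j ≡ [])

  lift-inj : ∀ {m n} {ρ : Fin m → Fin n} → Inj ρ → Inj (lift 1 ρ)
  lift-inj inj {zero}  {zero}  e = refl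
  lift-inj inj {suc i} {suc j} e = cong suc (inj (suc-injective e))

  push-lift : ∀ {m n} {ρ : Fin m → Fin n} {v u a} → Push ρ v u → Push (lift 1 ρ) (a ◂ v) (a ◂ u)
  push-lift P zero = inj₁ (zero , refl , refl)
  push-lift P (suc j) with P j
  ... | inj₁ (i , e , f) = inj₁ (suc i , cong suc e , f)
  ... | inj₂ (h , f)     = inj₂ ((λ { zero () ; (suc i) e → h i (suc-injective e) }) , f)

  push-at : ∀ {m n} {ρ : Fin m → Fin n} {v u} → Inj ρ → Push ρ v u → ∀ i → v (ρ i) ≡ u i
  push-at inj P i with P _
  ... | inj₂ (h , _) = contradiction refl (h i)
  ... | inj₁ (i′ , e , f) with refl ← inj e = f

  push-∙ : ∀ {m n} {ρ : Fin m → Fin n} {v u s t} → Push ρ v u → u ≋ s ∙ t →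
           ∃₂ λ v₁ v₂ → v ≋ v₁ ∙ v₂ × Push ρ v₁ s × Push ρ v₂ t
  push-∙ {ρ = ρ} {v} {u} {s} {t} P u≋ =
    (proj₁ ∘ f) , (proj₁ ∘ proj₂ ∘ f) , (λ j → proj₁ (proj₂ (proj₂ (f j)))) ,
    (λ j → proj₁ (proj₂ (proj₂ (proj₂ (f j))))) , (λ j → proj₂ (proj₂ (proj₂ (proj₂ (f j)))))
    where
    At : Fin _ → List Pt → Env _ → Set
    At j a u = (∃ λ i → ρ i ≡ j × a ≡ u i) ⊎ ((∀ i → ρ i ≢ j) × a ≡ [])
    f : ∀ j → ∃₂ λ a b → v j ≡ a ++ b × At j a s × At j b t
    f j with P j
    ... | inj₁ (i , e , g) = s i , t i , trans g (u≋ i) , inj₁ (i , e , refl) , inj₁ (i , e , refl)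
    ... | inj₂ (h , g)     = [] , [] , g , inj₂ (h , refl) , inj₂ (h , refl)

  push-nil : ∀ {m n} {ρ : Fin m → Fin n} {v u} → Push ρ v u → Nil u → Nil v
  push-nil P z j with P j
  ... | inj₁ (i , _ , f) = trans f (z i)
  ... | inj₂ (_ , f)     = f

  un-rename : ∀ {m n} {ρ : Fin m → Fin n} {M p K r} → Un M p K r → Un (rename ρ M) p (rename ρ K) r
  un-rename deref     = deref
  un-rename while     = while
  un-rename (write a) = write a
  un-rename read      = read

  bin-rename : ∀ {m n} {ρ : Fin m → Fin n} {M p N q K r} → Bin M p N q K r →
               Bin (rename ρ M) p (rename ρ N) q (rename ρ K) r
  bin-rename binop   = binop
  bin-rename seq     = seq
  bin-rename assign  = assign
  bin-rename while   = while
  bin-rename ifzero₀ = ifzero₀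
  bin-rename ifzero₊ = ifzero₊

  const-rename : ∀ {m n} {ρ : Fin m → Fin n} {M p} → Const M p → Const (rename ρ M) p
  const-rename num  = num
  const-rename skip = skip

  -- The size is kept exactly: below a binder `real-lift` renames the derivations of the
  -- substitutes, and the bound in `subst⁺` must not grow there.
  rename⁺ : ∀ {m n k} {ρ : Fin m → Fin n} {v u M p} → Inj ρ → Push ρ v u →
            u ⊩[ k ] M ∶ p → v ⊩[ k ] rename ρ M ∶ p
  rename⁺* : ∀ {m n k} {ρ : Fin m → Fin n} {v u M ps} → Inj ρ → Push ρ v u →
             u ⊩*[ k ] M ∶ ps → v ⊩*[ k ] rename ρ M ∶ ps
  rename⁺ inj P (const c z) = const (const-rename c) (push-nil P z)
  rename⁺ {v = v} {u} inj P (var {i} (h , z)) = var (trans (push-at inj P i) h , off)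
    where
    off : ∀ j → j ≢ _ → v j ≡ []
    off j j≢ with P j
    ... | inj₂ (_ , f)         = f
    ... | inj₁ (i′ , refl , f) = trans f (z i′ λ { refl → j≢ refl })
  rename⁺ inj P (lam τ d)   = lam τ (rename⁺ (lift-inj inj) (push-lift P) d)
  rename⁺ inj P (app u≋ d ds) with push-∙ P u≋
  ... | _ , _ , v≋ , P₁ , P₂ = app v≋ (rename⁺ inj P₁ d) (rename⁺* inj P₂ ds)
  rename⁺ inj P (new r d)   = new r (rename⁺ (lift-inj inj) (push-lift P) d)
  rename⁺ inj P (un f d)    = un (un-rename f) (rename⁺ inj P d)
  rename⁺ inj P (bin f u≋ d₁ d₂) with push-∙ P u≋
  ... | _ , _ , v≋ , P₁ , P₂ = bin (bin-rename f) v≋ (rename⁺ inj P₁ d₁) (rename⁺ inj P₂ d₂)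
  rename⁺* inj P ([] z) = [] (push-nil P z)
  rename⁺* inj P (d ⟨ u≋ ⟩∷ ds) with push-∙ P u≋
  ... | _ , _ , v≋ , P₁ , P₂ = rename⁺ inj P₁ d ⟨ v≋ ⟩∷ rename⁺* inj P₂ ds

  lift-∘ : ∀ {m n} (ρ : Fin m → Fin n) (a : List Pt) v → (a ◂ v) ∘ lift 1 ρ ≋ a ◂ (v ∘ ρ)
  lift-∘ ρ a v zero    = refl
  lift-∘ ρ a v (suc i) = refl

  -- The induction is on the derivation, since the unfolding of a loop is not a subterm. The term is
  -- matched as well because `rename ρ M` computes only then.
  rename⁻ : ∀ {m n k} {ρ : Fin m → Fin n} {v p} → Inj ρ → ∀ M →
            v ⊩[ k ] rename ρ M ∶ p → v ∘ ρ ⊩[ k ] M ∶ p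
  rename⁻* : ∀ {m n k} {ρ : Fin m → Fin n} {v ps} → Inj ρ → ∀ M →
             v ⊩*[ k ] rename ρ M ∶ ps → v ∘ ρ ⊩*[ k ] M ∶ ps
  rename⁻ {ρ = ρ} inj (num k)    (const num z)  = const num (z ∘ ρ)
  rename⁻ {ρ = ρ} inj skip       (const skip z) = const skip (z ∘ ρ)
  rename⁻ {ρ = ρ} inj (` i) (var (h , z)) = var (h , λ j j≢i → z (ρ j) (j≢i ∘ inj))
  rename⁻ {ρ = ρ} inj (ƛ A M) (lam τ d) =
    lam τ (resp (lift-∘ ρ _ _) (rename⁻ (lift-inj inj) M d))
  rename⁻ {ρ = ρ} inj (M · N) (app u≋ d ds) = app (u≋ ∘ ρ) (rename⁻ inj M d) (rename⁻* inj N ds)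
  rename⁻ {ρ = ρ} inj (new M) (new r d) = new r (resp (lift-∘ ρ _ _) (rename⁻ (lift-inj inj) M d))
  rename⁻ inj (deref M) (un deref d) = un deref (rename⁻ inj M d)
  rename⁻ inj (while M N) (un while d) = un while (rename⁻ inj M d)
  rename⁻ inj (mkvar M N) (un (write a) d) = un (write a) (rename⁻ inj M d)
  rename⁻ inj (mkvar M N) (un read d) = un read (rename⁻ inj N d)
  rename⁻ {ρ = ρ} inj (binop o M N) (bin binop u≋ d e) =
    bin binop (u≋ ∘ ρ) (rename⁻ inj M d) (rename⁻ inj N e)
  rename⁻ {ρ = ρ} inj (seq M N) (bin seq u≋ d e) = bin seq (u≋ ∘ ρ) (rename⁻ inj M d) (rename⁻ inj N e)
  rename⁻ {ρ = ρ} inj (assign M N) (bin assign u≋ d e) =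
    bin assign (u≋ ∘ ρ) (rename⁻ inj N d) (rename⁻ inj M e)
  rename⁻ {ρ = ρ} inj (while M N) (bin while u≋ d e) =
    bin while (u≋ ∘ ρ) (rename⁻ inj M d) (rename⁻ inj (seq N (while M N)) e)
  rename⁻ {ρ = ρ} inj (ifzero M N P) (bin ifzero₀ u≋ d e) =
    bin ifzero₀ (u≋ ∘ ρ) (rename⁻ inj M d) (rename⁻ inj N e)
  rename⁻ {ρ = ρ} inj (ifzero M N P) (bin ifzero₊ u≋ d e) =
    bin ifzero₊ (u≋ ∘ ρ) (rename⁻ inj M d) (rename⁻ inj P e)
  rename⁻* {ρ = ρ} inj M ([] z)         = [] (z ∘ ρ)
  rename⁻* {ρ = ρ} inj M (d ⟨ u≋ ⟩∷ ds) = rename⁻ inj M d ⟨ u≋ ∘ ρ ⟩∷ rename⁻* inj M ds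

  -- Free identifiers

  infix 4 _∉_

  _∉_ : ∀ {n} → Fin n → Tm n → Set
  i ∉ num k        = ⊤
  i ∉ binop o M N  = i ∉ M × i ∉ N
  i ∉ skip         = ⊤
  i ∉ seq M N      = i ∉ M × i ∉ N
  i ∉ assign M N   = i ∉ M × i ∉ N
  i ∉ deref M      = i ∉ M
  i ∉ while M N    = i ∉ M × i ∉ N
  i ∉ ifzero M N P = i ∉ M × i ∉ N × i ∉ P
  i ∉ (` j)        = i ≢ j
  i ∉ ƛ A M        = suc i ∉ M
  i ∉ M · N        = i ∉ M × i ∉ N
  i ∉ new M        = suc i ∉ M
  i ∉ mkvar M N    = i ∉ M × i ∉ N

  un-∉ : ∀ {n} {i : Fin n} {M p K r} → Un M p K r → i ∉ K → i ∉ M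
  un-∉ deref     h       = h
  un-∉ while     (h , _) = h
  un-∉ (write _) (h , _) = h
  un-∉ read      (_ , h) = h

  bin-∉ : ∀ {n} {i : Fin n} {M p N q K r} → Bin M p N q K r → i ∉ K → i ∉ M × i ∉ N
  bin-∉ binop   h           = h
  bin-∉ seq     h           = h
  bin-∉ assign  (g , h)     = h , g
  bin-∉ while   (g , h)     = g , h , g , h
  bin-∉ ifzero₀ (g , h , _) = g , h
  bin-∉ ifzero₊ (g , _ , h) = g , h

  ++-nil : ∀ {a s t : List Pt} → a ≡ s ++ t → s ≡ [] → t ≡ [] → a ≡ []
  ++-nil e refl refl = e

  -- This carries affine typing over to traces: an identifier absent from one half of a redex adds
  -- nothing to the trace of that half.
  support : ∀ {n k} {u : Env n} {M p i} → u ⊩[ k ] M ∶ p → i ∉ M → u i ≡ []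
  support* : ∀ {n k} {u : Env n} {M ps i} → u ⊩*[ k ] M ∶ ps → i ∉ M → u i ≡ []
  support {i = i} (const c z)        h       = z i
  support {i = i} (var (_ , z))      h       = z i h
  support {i = i} (lam τ d)          h       = support d h
  support {i = i} (app u≋ d ds)      (g , h) = ++-nil (u≋ i) (support d g) (support* ds h)
  support {i = i} (new r d)          h       = support d h
  support {i = i} (un f d)           h       = support d (un-∉ f h)
  support {i = i} (bin f u≋ d₁ d₂)   h       =
    ++-nil (u≋ i) (support d₁ (proj₁ (bin-∉ f h))) (support d₂ (proj₂ (bin-∉ f h)))
  support* {i = i} ([] z)            h       = z i
  support* {i = i} (d ⟨ u≋ ⟩∷ ds)    h       = ++-nil (u≋ i) (support d h) (support* ds h)

  -- Says that all identifiers occurring in `M` satisfy `Q`; a disjunction, because only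
  -- non-occurrence is defined.
  Hits : ∀ {n} → (Fin n → Set) → Tm n → Set
  Hits Q M = ∀ i → i ∉ M ⊎ Q i

  ∉-rename⁺ : ∀ {m n} {ρ : Fin m → Fin n} {j} M → Hits (λ i → j ≢ ρ i) M → j ∉ rename ρ M
  ∉-rename⁺-lift : ∀ {m n} {ρ : Fin m → Fin n} {j} M →
                   (∀ i → suc i ∉ M ⊎ j ≢ ρ i) → suc j ∉ rename (lift 1 ρ) M
  ∉-rename⁺ (num k) h = tt
  ∉-rename⁺ (binop o M N) h = ∉-rename⁺ M (Sum.map₁ proj₁ ∘ h) , ∉-rename⁺ N (Sum.map₁ proj₂ ∘ h)
  ∉-rename⁺ skip h = tt
  ∉-rename⁺ (seq M N) h = ∉-rename⁺ M (Sum.map₁ proj₁ ∘ h) , ∉-rename⁺ N (Sum.map₁ proj₂ ∘ h)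
  ∉-rename⁺ (assign M N) h = ∉-rename⁺ M (Sum.map₁ proj₁ ∘ h) , ∉-rename⁺ N (Sum.map₁ proj₂ ∘ h)
  ∉-rename⁺ (deref M) h = ∉-rename⁺ M h
  ∉-rename⁺ (while M N) h = ∉-rename⁺ M (Sum.map₁ proj₁ ∘ h) , ∉-rename⁺ N (Sum.map₁ proj₂ ∘ h)
  ∉-rename⁺ (ifzero M N P) h =
    ∉-rename⁺ M (Sum.map₁ proj₁ ∘ h) , ∉-rename⁺ N (Sum.map₁ (proj₁ ∘ proj₂) ∘ h) ,
    ∉-rename⁺ P (Sum.map₁ (proj₂ ∘ proj₂) ∘ h)
  ∉-rename⁺ (` i) h with h i
  ... | inj₁ i≢i = contradiction refl i≢i
  ... | inj₂ j≢  = j≢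
  ∉-rename⁺ (ƛ A M) h = ∉-rename⁺-lift M h
  ∉-rename⁺ (M · N) h = ∉-rename⁺ M (Sum.map₁ proj₁ ∘ h) , ∉-rename⁺ N (Sum.map₁ proj₂ ∘ h)
  ∉-rename⁺ (new M) h = ∉-rename⁺-lift M h
  ∉-rename⁺ (mkvar M N) h = ∉-rename⁺ M (Sum.map₁ proj₁ ∘ h) , ∉-rename⁺ N (Sum.map₁ proj₂ ∘ h)
  ∉-rename⁺-lift M h = ∉-rename⁺ M λ
    { zero    → inj₂ λ ()
    ; (suc i) → Sum.map₂ (_∘ suc-injective) (h i) }

  ∉-weaken : ∀ {n} {j : Fin n} M → j ∉ M → suc j ∉ rename suc M
  ∉-weaken {j = j} M h = ∉-rename⁺ M λ i → hit i (j ≟ i)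
    where
    hit : ∀ i → _ → i ∉ M ⊎ suc j ≢ suc i
    hit i (yes refl) = inj₁ h
    hit i (no j≢i)   = inj₂ (j≢i ∘ suc-injective)

  0∉-weaken : ∀ {n} (M : Tm n) → zero ∉ rename suc M
  0∉-weaken M = ∉-rename⁺ M λ _ → inj₂ λ ()

  ∉-rename⁻ : ∀ {m n} {ρ : Fin m → Fin n} {i} M → ρ i ∉ rename ρ M → i ∉ M
  ∉-rename⁻ (num k) h = tt
  ∉-rename⁻ (binop o M N) (g , h) = ∉-rename⁻ M g , ∉-rename⁻ N h
  ∉-rename⁻ skip h = tt
  ∉-rename⁻ (seq M N) (g , h) = ∉-rename⁻ M g , ∉-rename⁻ N h
  ∉-rename⁻ (assign M N) (g , h) = ∉-rename⁻ M g , ∉-rename⁻ N h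
  ∉-rename⁻ (deref M) h = ∉-rename⁻ M h
  ∉-rename⁻ (while M N) (g , h) = ∉-rename⁻ M g , ∉-rename⁻ N h
  ∉-rename⁻ (ifzero M N P) (f , g , h) = ∉-rename⁻ M f , ∉-rename⁻ N g , ∉-rename⁻ P h
  ∉-rename⁻ {ρ = ρ} (` j) h = h ∘ cong ρ
  ∉-rename⁻ (ƛ A M) h = ∉-rename⁻ M h
  ∉-rename⁻ (M · N) (g , h) = ∉-rename⁻ M g , ∉-rename⁻ N h
  ∉-rename⁻ (new M) h = ∉-rename⁻ M h
  ∉-rename⁻ (mkvar M N) (g , h) = ∉-rename⁻ M g , ∉-rename⁻ N h

  lifts : ∀ {m n} → (Fin m → Tm n) → Fin (suc m) → Tm (suc n)
  lifts θ = (` zero) ◂ (rename suc ∘ θ)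

  ∉-subst : ∀ {m n} {θ : Fin m → Tm n} {j} M → Hits (λ i → j ∉ θ i) M → j ∉ subst θ M
  ∉-subst-lift : ∀ {m n} {θ : Fin m → Tm n} {j} M →
                 (∀ i → suc i ∉ M ⊎ j ∉ θ i) → suc j ∉ subst (lifts θ) M
  ∉-subst (num k) h = tt
  ∉-subst (binop o M N) h = ∉-subst M (Sum.map₁ proj₁ ∘ h) , ∉-subst N (Sum.map₁ proj₂ ∘ h)
  ∉-subst skip h = tt
  ∉-subst (seq M N) h = ∉-subst M (Sum.map₁ proj₁ ∘ h) , ∉-subst N (Sum.map₁ proj₂ ∘ h)
  ∉-subst (assign M N) h = ∉-subst M (Sum.map₁ proj₁ ∘ h) , ∉-subst N (Sum.map₁ proj₂ ∘ h)
  ∉-subst (deref M) h = ∉-subst M h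
  ∉-subst (while M N) h = ∉-subst M (Sum.map₁ proj₁ ∘ h) , ∉-subst N (Sum.map₁ proj₂ ∘ h)
  ∉-subst (ifzero M N P) h =
    ∉-subst M (Sum.map₁ proj₁ ∘ h) , ∉-subst N (Sum.map₁ (proj₁ ∘ proj₂) ∘ h) ,
    ∉-subst P (Sum.map₁ (proj₂ ∘ proj₂) ∘ h)
  ∉-subst (` i) h with h i
  ... | inj₁ i≢i = contradiction refl i≢i
  ... | inj₂ j∉  = j∉
  ∉-subst (ƛ A M) h = ∉-subst-lift M h
  ∉-subst (M · N) h = ∉-subst M (Sum.map₁ proj₁ ∘ h) , ∉-subst N (Sum.map₁ proj₂ ∘ h)
  ∉-subst (new M) h = ∉-subst-lift M h
  ∉-subst (mkvar M N) h = ∉-subst M (Sum.map₁ proj₁ ∘ h) , ∉-subst N (Sum.map₁ proj₂ ∘ h)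
  ∉-subst-lift {θ = θ} M h = ∉-subst M λ
    { zero    → inj₂ λ ()
    ; (suc i) → Sum.map₂ (∉-weaken (θ i)) (h i) }

  -- Syntax-directed affine typing

  -- The disjunction is also data: for each identifier it selects a term that lacks it, and
  -- `Beta.owner` is computed from this choice.
  Disjoint : ∀ {n} → Tm n → Tm n → Set
  Disjoint M N = ∀ j → j ∉ M ⊎ j ∉ N

  infix 4 _⊢ᵃ_∶_

  -- The rules `weak`, `exch` and `app` of `⊢` rename their terms, which defeats inversion by the
  -- shape of the term. Here the variable rule and the condition `Disjoint` absorb them.
  data _⊢ᵃ_∶_ : ∀ {n} → Ctx n → Tm n → Ty → Set where
    var    : ∀ {n} {Γ : Ctx n} {i A} → Γ i ≡ A → Γ ⊢ᵃ ` i ∶ A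
    lam    : ∀ {n} {Γ : Ctx n} {A B M} → A ◂ Γ ⊢ᵃ M ∶ B → Γ ⊢ᵃ ƛ A M ∶ A ⊸ B
    app    : ∀ {n} {Γ : Ctx n} {A B M N} → Disjoint M N →
             Γ ⊢ᵃ M ∶ A ⊸ B → Γ ⊢ᵃ N ∶ A → Γ ⊢ᵃ M · N ∶ B
    num    : ∀ {n} {Γ : Ctx n} {k} → Γ ⊢ᵃ num k ∶ nat
    skip   : ∀ {n} {Γ : Ctx n} → Γ ⊢ᵃ skip ∶ comm
    binop  : ∀ {n} {Γ : Ctx n} {o M N} →
             Γ ⊢ᵃ M ∶ nat → Γ ⊢ᵃ N ∶ nat → Γ ⊢ᵃ binop o M N ∶ nat
    seq    : ∀ {n} {Γ : Ctx n} {B M N} →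
             Γ ⊢ᵃ M ∶ comm → Γ ⊢ᵃ N ∶ B → Γ ⊢ᵃ seq M N ∶ B
    assign : ∀ {n} {Γ : Ctx n} {M N} →
             Γ ⊢ᵃ M ∶ var → Γ ⊢ᵃ N ∶ nat → Γ ⊢ᵃ assign M N ∶ comm
    deref  : ∀ {n} {Γ : Ctx n} {M} → Γ ⊢ᵃ M ∶ var → Γ ⊢ᵃ deref M ∶ nat
    while  : ∀ {n} {Γ : Ctx n} {M N} →
             Γ ⊢ᵃ M ∶ nat → Γ ⊢ᵃ N ∶ comm → Γ ⊢ᵃ while M N ∶ comm
    ifzero : ∀ {n} {Γ : Ctx n} {B M N P} →
             Γ ⊢ᵃ M ∶ nat → Γ ⊢ᵃ N ∶ B → Γ ⊢ᵃ P ∶ B → Γ ⊢ᵃ ifzero M N P ∶ B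
    new    : ∀ {n} {Γ : Ctx n} {B M} → Observable B → var ◂ Γ ⊢ᵃ M ∶ B → Γ ⊢ᵃ new M ∶ B
    mkvar  : ∀ {n} {Γ : Ctx n} {M N} →
             Γ ⊢ᵃ M ∶ nat ⊸ comm → Γ ⊢ᵃ N ∶ nat → Γ ⊢ᵃ mkvar M N ∶ var

  lift-ctx : ∀ {m n} {ρ : Fin m → Fin n} {Γ : Ctx m} {Δ : Ctx n} {A} →
             (∀ i → Δ (ρ i) ≡ Γ i) → ∀ i → (A ◂ Δ) (lift 1 ρ i) ≡ (A ◂ Γ) i
  lift-ctx e zero    = refl
  lift-ctx e (suc i) = e i

  disjoint-rename : ∀ {m n} {ρ : Fin m → Fin n} → Inj ρ → ∀ M N →
                    Disjoint M N → Disjoint (rename ρ M) (rename ρ N)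
  disjoint-rename {ρ = ρ} inj M N D j with any? (λ i → j ≟ ρ i)
  ... | no ∄ = inj₁ (∉-rename⁺ M λ i → inj₂ λ e → ∄ (i , e))
  ... | yes (i , refl) = Sum.map (∉-image M) (∉-image N) (D i)
    where
    ∉-image : ∀ K → i ∉ K → ρ i ∉ rename ρ K
    ∉-image K h = ∉-rename⁺ K λ i′ → hit i′ (i ≟ i′)
      where
      hit : ∀ i′ → _ → i′ ∉ K ⊎ ρ i ≢ ρ i′
      hit i′ (yes refl) = inj₁ h
      hit i′ (no i≢i′)  = inj₂ (i≢i′ ∘ inj)

  ⊢ᵃ-rename⁺ : ∀ {m n} {ρ : Fin m → Fin n} {Γ : Ctx m} {Δ : Ctx n} {M A} → Inj ρ →
               (∀ i → Δ (ρ i) ≡ Γ i) → Γ ⊢ᵃ M ∶ A → Δ ⊢ᵃ rename ρ M ∶ A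
  ⊢ᵃ-rename⁺ inj e (var refl) = var (e _)
  ⊢ᵃ-rename⁺ inj e (lam d) = lam (⊢ᵃ-rename⁺ (lift-inj inj) (lift-ctx e) d)
  ⊢ᵃ-rename⁺ inj e (app {M = M} {N} D d d′) =
    app (disjoint-rename inj M N D) (⊢ᵃ-rename⁺ inj e d) (⊢ᵃ-rename⁺ inj e d′)
  ⊢ᵃ-rename⁺ inj e num = num
  ⊢ᵃ-rename⁺ inj e skip = skip
  ⊢ᵃ-rename⁺ inj e (binop d d′) = binop (⊢ᵃ-rename⁺ inj e d) (⊢ᵃ-rename⁺ inj e d′)
  ⊢ᵃ-rename⁺ inj e (seq d d′) = seq (⊢ᵃ-rename⁺ inj e d) (⊢ᵃ-rename⁺ inj e d′)
  ⊢ᵃ-rename⁺ inj e (assign d d′) = assign (⊢ᵃ-rename⁺ inj e d) (⊢ᵃ-rename⁺ inj e d′)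
  ⊢ᵃ-rename⁺ inj e (deref d) = deref (⊢ᵃ-rename⁺ inj e d)
  ⊢ᵃ-rename⁺ inj e (while d d′) = while (⊢ᵃ-rename⁺ inj e d) (⊢ᵃ-rename⁺ inj e d′)
  ⊢ᵃ-rename⁺ inj e (ifzero d d′ d″) =
    ifzero (⊢ᵃ-rename⁺ inj e d) (⊢ᵃ-rename⁺ inj e d′) (⊢ᵃ-rename⁺ inj e d″)
  ⊢ᵃ-rename⁺ inj e (new o d) = new o (⊢ᵃ-rename⁺ (lift-inj inj) (lift-ctx e) d)
  ⊢ᵃ-rename⁺ inj e (mkvar d d′) = mkvar (⊢ᵃ-rename⁺ inj e d) (⊢ᵃ-rename⁺ inj e d′)

  ⊢ᵃ-rename⁻ : ∀ {m n} {ρ : Fin m → Fin n} {Γ : Ctx m} {Δ : Ctx n} {A} →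
               (∀ i → Δ (ρ i) ≡ Γ i) → ∀ M → Δ ⊢ᵃ rename ρ M ∶ A → Γ ⊢ᵃ M ∶ A
  ⊢ᵃ-rename⁻ e (num k) num = num
  ⊢ᵃ-rename⁻ e (binop o M N) (binop d d′) = binop (⊢ᵃ-rename⁻ e M d) (⊢ᵃ-rename⁻ e N d′)
  ⊢ᵃ-rename⁻ e skip skip = skip
  ⊢ᵃ-rename⁻ e (seq M N) (seq d d′) = seq (⊢ᵃ-rename⁻ e M d) (⊢ᵃ-rename⁻ e N d′)
  ⊢ᵃ-rename⁻ e (assign M N) (assign d d′) = assign (⊢ᵃ-rename⁻ e M d) (⊢ᵃ-rename⁻ e N d′)
  ⊢ᵃ-rename⁻ e (deref M) (deref d) = deref (⊢ᵃ-rename⁻ e M d)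
  ⊢ᵃ-rename⁻ e (while M N) (while d d′) = while (⊢ᵃ-rename⁻ e M d) (⊢ᵃ-rename⁻ e N d′)
  ⊢ᵃ-rename⁻ e (ifzero M N P) (ifzero d d′ d″) =
    ifzero (⊢ᵃ-rename⁻ e M d) (⊢ᵃ-rename⁻ e N d′) (⊢ᵃ-rename⁻ e P d″)
  ⊢ᵃ-rename⁻ e (` i) (var refl) = var (sym (e i))
  ⊢ᵃ-rename⁻ e (ƛ A M) (lam d) = lam (⊢ᵃ-rename⁻ (lift-ctx e) M d)
  ⊢ᵃ-rename⁻ {ρ = ρ} e (M · N) (app D d d′) =
    app (λ j → Sum.map (∉-rename⁻ M) (∉-rename⁻ N) (D (ρ j)))
        (⊢ᵃ-rename⁻ e M d) (⊢ᵃ-rename⁻ e N d′)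
  ⊢ᵃ-rename⁻ e (new M) (new o d) = new o (⊢ᵃ-rename⁻ (lift-ctx e) M d)
  ⊢ᵃ-rename⁻ e (mkvar M N) (mkvar d d′) = mkvar (⊢ᵃ-rename⁻ e M d) (⊢ᵃ-rename⁻ e N d′)

  ↑ˡ≢↑ʳ : ∀ {m n} (i : Fin m) (j : Fin n) → i ↑ˡ n ≢ m ↑ʳ j
  ↑ˡ≢↑ʳ (suc i) j e = ↑ˡ≢↑ʳ i j (suc-injective e)

  data Block m n : Fin (m + n) → Set where
    left  : ∀ i → Block m n (i ↑ˡ n)
    right : ∀ j → Block m n (m ↑ʳ j)

  block : ∀ m {n} i → Block m n i
  block m {n} i with splitAt m i in eq
  ... | inj₁ j with refl ← splitAt⁻¹-↑ˡ eq = left j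
  ... | inj₂ j with refl ← splitAt⁻¹-↑ʳ {m} eq = right j

  disjoint-blocks : ∀ m {n} (M : Tm m) (N : Tm n) →
                    Disjoint (rename (_↑ˡ n) M) (rename (m ↑ʳ_) N)
  disjoint-blocks m M N j with block m j
  ... | left i  = inj₂ (∉-rename⁺ N λ i′ → inj₂ (↑ˡ≢↑ʳ i i′))
  ... | right i = inj₁ (∉-rename⁺ M λ i′ → inj₂ (↑ˡ≢↑ʳ i′ i ∘ sym))

  perm-inj : ∀ {n} (π : Perm.Permutation′ n) → Inj (π ⟨$⟩ʳ_)
  perm-inj π e = trans (sym (inverseˡ π)) (trans (cong (π ⟨$⟩ˡ_) e) (inverseˡ π))

  ⊢⇒⊢ᵃ : ∀ {n} {Γ : Ctx n} {M A} → Γ ⊢ M ∶ A → Γ ⊢ᵃ M ∶ A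
  ⊢⇒⊢ᵃ id = var refl
  ⊢⇒⊢ᵃ (lam d) = lam (⊢⇒⊢ᵃ d)
  ⊢⇒⊢ᵃ (app {m} {n} {M = M} {N} d e) =
    app (disjoint-blocks m M N)
        (⊢ᵃ-rename⁺ (↑ˡ-injective n _ _) (λ _ → refl) (⊢⇒⊢ᵃ d))
        (⊢ᵃ-rename⁺ (↑ʳ-injective m _ _) (λ _ → refl) (⊢⇒⊢ᵃ e))
  ⊢⇒⊢ᵃ (weak d) = ⊢ᵃ-rename⁺ suc-injective (λ _ → refl) (⊢⇒⊢ᵃ d)
  ⊢⇒⊢ᵃ (exch π d) = ⊢ᵃ-rename⁺ (perm-inj π) (λ _ → refl) (⊢⇒⊢ᵃ d)
  ⊢⇒⊢ᵃ (num k) = num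
  ⊢⇒⊢ᵃ skip = skip
  ⊢⇒⊢ᵃ (binop o d e) = binop (⊢⇒⊢ᵃ d) (⊢⇒⊢ᵃ e)
  ⊢⇒⊢ᵃ (seq _ d e) = seq (⊢⇒⊢ᵃ d) (⊢⇒⊢ᵃ e)
  ⊢⇒⊢ᵃ (assign d e) = assign (⊢⇒⊢ᵃ d) (⊢⇒⊢ᵃ e)
  ⊢⇒⊢ᵃ (deref d) = deref (⊢⇒⊢ᵃ d)
  ⊢⇒⊢ᵃ (while d e) = while (⊢⇒⊢ᵃ d) (⊢⇒⊢ᵃ e)
  ⊢⇒⊢ᵃ (ifzero _ d e f) = ifzero (⊢⇒⊢ᵃ d) (⊢⇒⊢ᵃ e) (⊢⇒⊢ᵃ f)
  ⊢⇒⊢ᵃ (new o d) = new o (⊢⇒⊢ᵃ d)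
  ⊢⇒⊢ᵃ (mkvar d e) = mkvar (⊢⇒⊢ᵃ d) (⊢⇒⊢ᵃ e)

  -- Typed points

  Typed : ∀ {n} → Ctx n → Env n → Set
  Typed Γ u = ∀ i → All (_∶ᵖ Γ i) (u i)

  typed-◂ : ∀ {n} {Γ : Ctx n} {A ps u} → All (_∶ᵖ A) ps → Typed Γ u → Typed (A ◂ Γ) (ps ◂ u)
  typed-◂ a τ zero    = a
  typed-◂ a τ (suc i) = τ i

  typed-ˡ : ∀ {n} {Γ : Ctx n} {u s t} → u ≋ s ∙ t → Typed Γ u → Typed Γ s
  typed-ˡ {s = s} u≋ τ i = All.++⁻ˡ (s i) (transport (All _) (u≋ i) (τ i))

  typed-ʳ : ∀ {n} {Γ : Ctx n} {u s t} → u ≋ s ∙ t → Typed Γ u → Typed Γ t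
  typed-ʳ {s = s} u≋ τ i = All.++⁻ʳ (s i) (transport (All _) (u≋ i) (τ i))

  run-typed : ∀ {k s m} → Run k s m → All (_∶ᵖ var) s
  run-typed []        = []
  run-typed (rd∷ r)   = rd ∷ run-typed r
  run-typed (wr∷ _ r) = wr ∷ run-typed r

  -- Points carry no types, but `lam` accepts only argument points of the declared type; this
  -- supplies that premise when a λ is rebuilt around a body.
  point-typed : ∀ {n k} {Γ : Ctx n} {u M A p} → Γ ⊢ᵃ M ∶ A → Typed Γ u →
                u ⊩[ k ] M ∶ p → p ∶ᵖ A
  point-typed (var {i = i} refl) τ (var (h , _)) with transport (All _) h (τ i)
  ... | t ∷ [] = t
  point-typed (lam T) τ (lam a d) = a ⇒ point-typed T (typed-◂ a τ) d
  point-typed (app _ T T′) τ (app u≋ d ds) with point-typed T (typed-ˡ u≋ τ) d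
  ... | _ ⇒ t = t
  point-typed num τ (const num _) = num
  point-typed skip τ (const skip _) = done
  point-typed (binop T T′) τ (bin binop u≋ d e) = num
  point-typed (seq T T′) τ (bin seq u≋ d e) = point-typed T′ (typed-ʳ u≋ τ) e
  point-typed (assign T T′) τ (bin assign u≋ d e) = done
  point-typed (deref T) τ (un deref d) = num
  point-typed (while T T′) τ (un while d) = done
  point-typed (while T T′) τ (bin while u≋ d e) = done
  point-typed (ifzero T T′ T″) τ (bin ifzero₀ u≋ d e) = point-typed T′ (typed-ʳ u≋ τ) e
  point-typed (ifzero T T′ T″) τ (bin ifzero₊ u≋ d e) = point-typed T″ (typed-ʳ u≋ τ) e
  point-typed (new o T) τ (new r d) = point-typed T (typed-◂ (run-typed r) τ) d
  point-typed (mkvar T T′) τ (un (write _) d) = wr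
  point-typed (mkvar T T′) τ (un read d) = rd

  points-typed : ∀ {n k} {Γ : Ctx n} {u M A ps} → Γ ⊢ᵃ M ∶ A → Typed Γ u →
                 u ⊩*[ k ] M ∶ ps → All (_∶ᵖ A) ps
  points-typed T τ ([] z) = []
  points-typed T τ (d ⟨ u≋ ⟩∷ ds) =
    point-typed T (typed-ˡ u≋ τ) d ∷ points-typed T (typed-ʳ u≋ τ) ds

  -- Simultaneous substitution

  -- An owner function o assigns to each identifier j of the target the only
  -- identifier o j of the source whose substitute may use j.

  restrict : ∀ {m n} → (Fin n → Fin m) → Env n → Fin m → Env n
  restrict o v i j = if does (o j ≟ i) then v j else []

  owned : ∀ {m n} {o : Fin n → Fin m} {i j} (v : Env n) → o j ≡ i → restrict o v i j ≡ v j
  owned {o = o} {i} {j} v e rewrite dec-true (o j ≟ i) e = refl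

  *-split : ∀ {n k} {w : Env n} {N} ps {qs} → w ⊩*[ k ] N ∶ ps ++ qs →
            ∃₂ λ a b → ∃₂ λ k₁ k₂ → w ≋ a ∙ b × a ⊩*[ k₁ ] N ∶ ps × b ⊩*[ k₂ ] N ∶ qs × k ≡ k₁ + k₂
  *-split []       ds = _ , _ , _ , _ , (λ _ → refl) , [] {u = ε} (λ _ → refl) , ds , refl
  *-split (p ∷ ps) (_⟨_⟩∷_ {k} {s = s} d w≋ ds) with *-split ps ds
  ... | a , b , k₁ , k₂ , e , ds₁ , ds₂ , refl =
    s ∙ a , b , k + k₁ , k₂ ,
    (λ i → trans (w≋ i) (trans (cong (s i ++_) (e i)) (sym (++-assoc (s i) _ _)))) ,
    d ⟨ (λ _ → refl) ⟩∷ ds₁ , ds₂ , sym (+-assoc k k₁ k₂)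

  *-++ : ∀ {n k l} {a b : Env n} {N ps qs} → a ⊩*[ k ] N ∶ ps → b ⊩*[ l ] N ∶ qs →
         ∃ λ m → a ∙ b ⊩*[ m ] N ∶ ps ++ qs
  *-++ {a = a} {b} ([] z) es = _ , resp* (λ i → cong (_++ b i) (sym (z i))) es
  *-++ {b = b} (_⟨_⟩∷_ {s = s} {t} d e ds) es = _ , 
    d ⟨ (λ i → trans (cong (_++ b i) (e i)) (++-assoc (s i) _ _)) ⟩∷ proj₂ (*-++ ds es)

  -- Axioms have size 0, so replacing a variable by a variable costs nothing, whatever the number of
  -- points.
  vars⁺ : ∀ {n} {i : Fin n} ps {u} → Only i ps u → u ⊩*[ 0 ] ` i ∶ ps
  vars⁺ {i = i} [] {u} (h , z) = [] λ j → nil j (j ≟ i)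
    where
    nil : ∀ j → _ → u j ≡ []
    nil j (yes refl) = h
    nil j (no j≢i)   = z j j≢i
  vars⁺ {i = i} (p ∷ ps) {u} (h , z) = var (single-only i (p ∷ [])) ⟨ e ⟩∷ vars⁺ ps (single-only i ps)
    where
    e : u ≋ single i (p ∷ []) ∙ single i ps
    e j with j ≟ i
    ... | yes refl = h
    ... | no j≢i   = z j j≢i

  vars⁻ : ∀ {n k} {i : Fin n} {ps u} → u ⊩*[ k ] ` i ∶ ps → Only i ps u
  vars⁻ {i = i} ([] z) = z i , λ j _ → z j
  vars⁻ {i = i} (var (h , z) ⟨ e ⟩∷ ds) with vars⁻ ds
  ... | h′ , z′ = trans (e i) (cong₂ _++_ h h′) , λ j j≢i → trans (e j) (cong₂ _++_ (z j j≢i) (z′ j j≢i))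

  -- As a relation between v and u this is a MonRel morphism from Env n to Env m,
  -- which reduces the substitution lemmas to plain inductions.

  record Real {m n} (θ : Fin m → Tm n) (o : Fin n → Fin m) (v : Env n) (u : Env m)
              (l : Fin m → ℕ) : Set where
    constructor real
    field at : ∀ i → restrict o v i ⊩*[ l i ] θ i ∶ u i

  open Real

  *-nil : ∀ {n k} {w : Env n} {N ps} → w ⊩*[ k ] N ∶ ps → ps ≡ [] → Nil w
  *-nil ([] z) refl = z

  *-single : ∀ {n k} {w : Env n} {N ps p} → w ⊩*[ k ] N ∶ ps → ps ≡ p ∷ [] → w ⊩[ k ] N ∶ p
  *-single (_⟨_⟩∷_ {k} {s = s} d e ([] z)) refl =
    transport (_ ⊩[_] _ ∶ _) (sym (+-identityʳ k))
      (resp (λ i → sym (trans (e i) (trans (cong (s i ++_) (z i)) (++-identityʳ (s i))))) d)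

  real-nil : ∀ {m n} {θ : Fin m → Tm n} {o v u l} → Real θ o v u l → Nil u → Nil v
  real-nil {o = o} {v} R z j = trans (sym (owned {o = o} v refl)) (*-nil (at R _) (z _) j)

  ≤-sum : ∀ {m} (l : Fin m → ℕ) i → l i ≤ sum l
  ≤-sum l zero    = m≤m+n _ _
  ≤-sum l (suc i) = ≤-trans (≤-sum (l ∘ suc) i) (m≤n+m _ _)

  real-var : ∀ {m n} {θ : Fin m → Tm n} {o v u l i p} → Real θ o v u l → Only i (p ∷ []) u →
             v ⊩[ l i ] θ i ∶ p
  real-var {o = o} {v} {i = i} R (h , z) = resp e (*-single (at R i) h)
    where
    e : restrict o v i ≋ v
    e j with o j ≟ i
    ... | yes _ = refl
    ... | no ne = sym (trans (sym (owned {o = o} v refl)) (*-nil (at R (o j)) (z (o j) ne) j))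

  real-∙ : ∀ {m n} {θ : Fin m → Tm n} {o v u l s t} → Real θ o v u l → u ≋ s ∙ t →
           ∃₂ λ v₁ v₂ → ∃₂ λ l₁ l₂ → v ≋ v₁ ∙ v₂ × Real θ o v₁ s l₁ × Real θ o v₂ t l₂ ×
           sum l ≡ sum l₁ + sum l₂
  real-∙ {θ = θ} {o} {v} {u} {l} {s} {t} R u≋ =
    v₁ , v₂ , l₁ , l₂ , v≋ ,
    real (λ i → resp* (≋-sym (e₁ i)) (proj₁ (proj₂ (rest i)))) ,
    real (λ i → resp* (≋-sym (e₂ i)) (proj₁ (proj₂ (proj₂ (rest i))))) ,
    trans (sum-cong-≗ λ i → proj₂ (proj₂ (proj₂ (rest i)))) (∑-distrib-+ l₁ l₂)
    where
    f : ∀ i → ∃₂ λ a b → ∃₂ λ k₁ k₂ → restrict o v i ≋ a ∙ b × a ⊩*[ k₁ ] θ i ∶ s i ×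
        b ⊩*[ k₂ ] θ i ∶ t i × l i ≡ k₁ + k₂
    f i = *-split (s i) (transport (_ ⊩*[ _ ] _ ∶_) (u≋ i) (at R i))
    a = proj₁ ∘ f
    b = proj₁ ∘ proj₂ ∘ f
    l₁ = λ i → proj₁ (proj₂ (proj₂ (f i)))
    l₂ = λ i → proj₁ (proj₂ (proj₂ (proj₂ (f i))))
    rest = λ i → proj₂ (proj₂ (proj₂ (proj₂ (f i))))
    v₁ v₂ : Env _
    -- The derivation for the owner of `j` decides how the trace at `j` is split; all the others
    -- have an empty trace there.
    v₁ j = a (o j) j
    v₂ j = b (o j) j
    v≋ : v ≋ v₁ ∙ v₂
    v≋ j = trans (sym (owned {o = o} v refl)) (proj₁ (rest (o j)) j)
    e₁ : ∀ i → restrict o v₁ i ≋ a i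
    e₁ i j with o j ≟ i | proj₁ (rest i) j
    ... | yes refl | _ = refl
    ... | no ne | e = sym (++-conicalˡ _ _ (sym e))
    e₂ : ∀ i → restrict o v₂ i ≋ b i
    e₂ i j with o j ≟ i | proj₁ (rest i) j
    ... | yes refl | _ = refl
    ... | no ne | e = sym (++-conicalʳ _ _ (sym e))

  push-suc : ∀ {n} (v : Env n) → Push suc ([] ◂ v) v
  push-suc v zero    = inj₂ ((λ _ ()) , refl)
  push-suc v (suc j) = inj₁ (j , refl , refl)

  real-lift : ∀ {m n} {θ : Fin m → Tm n} {o v u l a} → Real θ o v u l →
              Real (lifts θ) (lift 1 o) (a ◂ v) (a ◂ u) (0 ◂ l)
  real-lift {a = a} R .at zero =
    vars⁺ a (refl , λ { zero 0≢0 → contradiction refl 0≢0 ; (suc j) _ → refl })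
  real-lift R .at (suc i) =
    resp* (λ { zero → refl ; (suc j) → refl }) (rename⁺* suc-injective (push-suc _) (at R i))

  un-subst : ∀ {m n} {θ : Fin m → Tm n} {M p K r} → Un M p K r → Un (subst θ M) p (subst θ K) r
  un-subst deref     = deref
  un-subst while     = while
  un-subst (write a) = write a
  un-subst read      = read

  bin-subst : ∀ {m n} {θ : Fin m → Tm n} {M p N q K r} → Bin M p N q K r →
              Bin (subst θ M) p (subst θ N) q (subst θ K) r
  bin-subst binop   = binop
  bin-subst seq     = seq
  bin-subst assign  = assign
  bin-subst while   = while
  bin-subst ifzero₀ = ifzero₀
  bin-subst ifzero₊ = ifzero₊

  const-subst : ∀ {m n} {θ : Fin m → Tm n} {M p} → Const M p → Const (subst θ M) p
  const-subst num  = num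
  const-subst skip = skip

  join-≤ : ∀ k l a b {k′ l′ c} → k′ ≤ k + a → l′ ≤ l + b → c ≡ a + b →
           k′ + l′ ≤ (k + l) + c
  join-≤ k l a b p q refl = ≤-trans (+-mono-≤ p q) (≤-reflexive (interchange +-commutativeSemigroup k a l b))

  -- A list `u i` comes with one derivation of `θ i` per point, and each of them replaces one axiom
  -- for `i`. Sizes therefore add and never multiply.
  subst⁺ : ∀ {m n k} {θ : Fin m → Tm n} {o v u l M p} → Real θ o v u l → u ⊩[ k ] M ∶ p →
           ∃ λ k′ → k′ ≤ k + sum l × v ⊩[ k′ ] subst θ M ∶ p
  subst⁺* : ∀ {m n k} {θ : Fin m → Tm n} {o v u l M ps} → Real θ o v u l → u ⊩*[ k ] M ∶ ps →
            ∃ λ k′ → k′ ≤ k + sum l × v ⊩*[ k′ ] subst θ M ∶ ps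
  subst⁺ R (const c z) = _ , z≤n , const (const-subst c) (real-nil R z)
  subst⁺ {l = l} R (var {i} h) = _ , ≤-sum l i , real-var R h
  subst⁺ R (lam a d) with subst⁺ (real-lift R) d
  ... | _ , le , d′ = _ , s≤s le , lam a d′
  subst⁺ R (app {k} {l} u≋ d ds) with real-∙ R u≋
  ... | _ , _ , l₁ , l₂ , v≋ , R₁ , R₂ , e with subst⁺ R₁ d | subst⁺* R₂ ds
  ... | _ , le , d′ | _ , le′ , ds′ = _ , s≤s (join-≤ k l (sum l₁) (sum l₂) le le′ e) , app v≋ d′ ds′
  subst⁺ R (new r d) with subst⁺ (real-lift R) d
  ... | _ , le , d′ = _ , s≤s le , new r d′
  subst⁺ R (un f d) with subst⁺ R d
  ... | _ , le , d′ = _ , s≤s le , un (un-subst f) d′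
  subst⁺ R (bin {k} {l = l} f u≋ d₁ d₂) with real-∙ R u≋
  ... | _ , _ , l₁ , l₂ , v≋ , R₁ , R₂ , e with subst⁺ R₁ d₁ | subst⁺ R₂ d₂
  ... | _ , le , d′ | _ , le′ , d″ =
    _ , s≤s (join-≤ k l (sum l₁) (sum l₂) le le′ e) , bin (bin-subst f) v≋ d′ d″
  subst⁺* R ([] z) = _ , z≤n , [] (real-nil R z)
  subst⁺* R (_⟨_⟩∷_ {k} {l} d u≋ ds) with real-∙ R u≋
  ... | _ , _ , l₁ , l₂ , v≋ , R₁ , R₂ , e with subst⁺ R₁ d | subst⁺* R₂ ds
  ... | _ , le , d′ | _ , le′ , ds′ = _ , join-≤ k l (sum l₁) (sum l₂) le le′ e , d′ ⟨ v≋ ⟩∷ ds′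

  Realises : ∀ {m n} → (Fin m → Tm n) → (Fin n → Fin m) → Env n → Env m → Set
  Realises θ o v u = ∃ (Real θ o v u)

  -- Only the `i` that occur in `M` count: in a β-substitution an identifier `j` of the argument
  -- belongs to the bound variable although `suc j` is mapped to `j` as well.
  record Own {m n} (θ : Fin m → Tm n) (o : Fin n → Fin m) (M : Tm m) : Set where
    constructor owning
    field owns : ∀ j → Hits (λ i → o j ≡ i ⊎ j ∉ θ i) M

  open Own

  Own′ : ∀ {m n} → (Fin m → Tm n) → (Fin n → Fin m) → Tm (suc m) → Set
  Own′ θ o M = ∀ j i → suc i ∉ M ⊎ (o j ≡ i ⊎ j ∉ θ i)

  own-lift : ∀ {m n} {θ : Fin m → Tm n} {o} M → Own′ θ o M → Own (lifts θ) (lift 1 o) M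
  own-lift {θ = θ} {o} M h = owning go
    where
    go : ∀ j → Hits (λ i → lift 1 o j ≡ i ⊎ j ∉ lifts θ i) M
    go zero    zero    = inj₂ (inj₁ refl)
    go zero    (suc i) = inj₂ (inj₂ (0∉-weaken (θ i)))
    go (suc j) zero    = inj₂ (inj₂ λ ())
    go (suc j) (suc i) with h j i
    ... | inj₁ i∉        = inj₁ i∉
    ... | inj₂ (inj₁ e)  = inj₂ (inj₁ (cong suc e))
    ... | inj₂ (inj₂ j∉) = inj₂ (inj₂ (∉-weaken (θ i) j∉))

  realises-nil : ∀ {m n} {θ : Fin m → Tm n} {o v} → Nil v → Realises θ o v ε
  realises-nil {o = o} {v} z = _ , real λ i → [] λ j → nil i j
    where
    nil : ∀ i j → restrict o v i j ≡ []
    nil i j with o j ≟ i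
    ... | yes _ = z j
    ... | no _  = refl

  realises-∙ : ∀ {m n} {θ : Fin m → Tm n} {o v v₁ v₂ u₁ u₂} → v ≋ v₁ ∙ v₂ →
               Realises θ o v₁ u₁ → Realises θ o v₂ u₂ → Realises θ o v (u₁ ∙ u₂)
  realises-∙ {o = o} {v} {v₁} {v₂} v≋ (_ , R₁) (_ , R₂) =
    _ , real λ i → resp* (e i) (proj₂ (*-++ (at R₁ i) (at R₂ i)))
    where
    e : ∀ i → restrict o v₁ i ∙ restrict o v₂ i ≋ restrict o v i
    e i j with o j ≟ i
    ... | yes _ = sym (v≋ j)
    ... | no _  = refl

  realises-lift : ∀ {m n} {θ : Fin m → Tm n} {o v u a} → Realises (lifts θ) (lift 1 o) (a ◂ v) u →
                  u ≋ a ◂ (u ∘ suc) × Realises θ o v (u ∘ suc)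
  realises-lift {θ = θ} {u = u} (l , R) =
    (λ { zero → sym (proj₁ (vars⁻ (at R zero))) ; (suc i) → refl }) ,
    (l ∘ suc) , real λ i → rename⁻* suc-injective (θ i) (at R (suc i))

  realises-var : ∀ {m n k} {θ : Fin m → Tm n} {o v p} i → Own θ o (` i) → v ⊩[ k ] θ i ∶ p →
                 ∃ λ u → Realises θ o v u × u ⊩[ 0 ] ` i ∶ p
  realises-var {k = k} {θ} {o} {v} {p} i h d =
    u , (_ , real λ i′ → proj₂ (R i′)) , var (single-only i (p ∷ []))
    where
    u = single i (p ∷ [])
    elsewhere : ∀ j → o j ≢ i → v j ≡ []
    elsewhere j ne with owns h j i
    ... | inj₁ i≢i       = contradiction refl i≢i
    ... | inj₂ (inj₁ e)  = contradiction e ne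
    ... | inj₂ (inj₂ j∉) = support d j∉
    e : v ≋ restrict o v i ∙ ε
    e j with o j ≟ i
    ... | yes _ = sym (++-identityʳ (v j))
    ... | no ne = elsewhere j ne
    R : ∀ i′ → ∃ λ k → restrict o v i′ ⊩*[ k ] θ i′ ∶ u i′
    R i′ with i′ ≟ i
    ... | yes refl = _ ,
      resp (λ j → trans (e j) (++-identityʳ _)) d
        ⟨ (λ j → sym (++-identityʳ _)) ⟩∷ [] {u = ε} (λ _ → refl)
    ... | no ne = _ , [] z
      where
      z : Nil (restrict o v i′)
      z j with o j ≟ i′
      ... | yes refl = elsewhere j ne
      ... | no _     = refl

  own-⊆ : ∀ {m n} {θ : Fin m → Tm n} {o M N} → (∀ i → i ∉ M → i ∉ N) → Own θ o M → Own θ o N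
  own-⊆ f h = owning λ j i → Sum.map₁ (f i) (owns h j i)

  Subst⁻ : ∀ {m n} → (Fin m → Tm n) → (Fin n → Fin m) → Env n → Tm m → Pt → Set
  Subst⁻ θ o v M p = ∃₂ λ u k → Realises θ o v u × u ⊩[ k ] M ∶ p

  -- If two substitutes in use shared an identifier, their actions would interleave in its trace and
  -- could not be regrouped by source identifier. Ownership excludes this, so the parts found for
  -- the premises can be concatenated.
  subst⁻ : ∀ {m n k} {θ : Fin m → Tm n} {o v p} M → Own θ o M → v ⊩[ k ] subst θ M ∶ p →
           Subst⁻ θ o v M p
  subst⁻* : ∀ {m n k} {θ : Fin m → Tm n} {o v ps} M → Own θ o M → v ⊩*[ k ] subst θ M ∶ ps →
            ∃₂ λ u k → Realises θ o v u × u ⊩*[ k ] M ∶ ps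
  subst⁻-lift : ∀ {m n k} {θ : Fin m → Tm n} {o v p a} M →
                Own′ θ o M → a ◂ v ⊩[ k ] subst (lifts θ) M ∶ p →
                ∃₂ λ u k → Realises θ o v u × a ◂ u ⊩[ k ] M ∶ p
  subst⁻-un : ∀ {m n k} {θ : Fin m → Tm n} {o v M p K r} → Un M p K r → Own θ o K →
              v ⊩[ k ] subst θ M ∶ p → Subst⁻ θ o v K r
  subst⁻-bin : ∀ {m n k l} {θ : Fin m → Tm n} {o v s t M p N q K r} → Bin M p N q K r →
               Own θ o K → v ≋ s ∙ t → s ⊩[ k ] subst θ M ∶ p → t ⊩[ l ] subst θ N ∶ q →
               Subst⁻ θ o v K r
  subst⁻ (num k) h (const num z) = _ , _ , realises-nil z , const num λ _ → refl
  subst⁻ skip h (const skip z) = _ , _ , realises-nil z , const skip λ _ → refl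
  subst⁻ (` i) h d with realises-var i h d
  ... | _ , R , d′ = _ , _ , R , d′
  subst⁻ (ƛ A M) h (lam a d) with subst⁻-lift M (owns h) d
  ... | _ , _ , R , d′ = _ , _ , R , lam a d′
  subst⁻ (M · N) h (app v≋ d ds)
    with subst⁻ M (own-⊆ (λ _ → proj₁) h) d | subst⁻* N (own-⊆ (λ _ → proj₂) h) ds
  ... | _ , _ , R₁ , d′ | _ , _ , R₂ , ds′ = _ , _ , realises-∙ v≋ R₁ R₂ , app (λ _ → refl) d′ ds′
  subst⁻ (new M) h (new r d) with subst⁻-lift M (owns h) d
  ... | _ , _ , R , d′ = _ , _ , R , new r d′
  subst⁻ (deref M) h (un deref d) = subst⁻-un (deref {M = M}) h d
  subst⁻ (while M N) h (un while d) = subst⁻-un (while {M = M} {N}) h d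
  subst⁻ (mkvar M N) h (un (write a) d) = subst⁻-un (write {M = M} {N} a) h d
  subst⁻ (mkvar M N) h (un read d) = subst⁻-un (read {M = M} {N}) h d
  subst⁻ (binop o M N) h (bin binop e d d′) = subst⁻-bin (binop {M = M} {N}) h e d d′
  subst⁻ (seq M N) h (bin seq e d d′) = subst⁻-bin (seq {M = M} {N}) h e d d′
  subst⁻ (assign M N) h (bin assign e d d′) = subst⁻-bin (assign {M = M} {N}) h e d d′
  subst⁻ (while M N) h (bin while e d d′) = subst⁻-bin (while {M = M} {N}) h e d d′
  subst⁻ (ifzero M N P) h (bin ifzero₀ e d d′) = subst⁻-bin (ifzero₀ {M = M} {N} {P}) h e d d′
  subst⁻ (ifzero M N P) h (bin ifzero₊ e d d′) = subst⁻-bin (ifzero₊ {M = M} {N} {P}) h e d d′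
  subst⁻* M h ([] z) = _ , _ , realises-nil z , [] λ _ → refl
  subst⁻* M h (d ⟨ v≋ ⟩∷ ds) with subst⁻ M h d | subst⁻* M h ds
  ... | _ , _ , R₁ , d′ | _ , _ , R₂ , ds′ = _ , _ , realises-∙ v≋ R₁ R₂ , d′ ⟨ (λ _ → refl) ⟩∷ ds′
  subst⁻-lift M h d with subst⁻ M (own-lift M h) d
  ... | u , _ , R , d′ with realises-lift R
  ... | e , R′ = _ , _ , R′ , resp e d′
  subst⁻-un {M = M} f h d with subst⁻ M (own-⊆ (λ _ → un-∉ f) h) d
  ... | _ , _ , R , d′ = _ , _ , R , un f d′
  subst⁻-bin {M = M} {N = N} f h v≋ d d′
    with subst⁻ M (own-⊆ (λ _ → proj₁ ∘ bin-∉ f) h) d | subst⁻ N (own-⊆ (λ _ → proj₂ ∘ bin-∉ f) h) d′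
  ... | _ , _ , R₁ , e | _ , _ , R₂ , e′ = _ , _ , realises-∙ v≋ R₁ R₂ , bin f (λ _ → refl) e e′

  ⊢ᵃ-subst : ∀ {m n} {θ : Fin m → Tm n} {o} {Γ : Ctx m} {Δ : Ctx n} {M A} → Own θ o M →
             (∀ i → Δ ⊢ᵃ θ i ∶ Γ i) → Γ ⊢ᵃ M ∶ A → Δ ⊢ᵃ subst θ M ∶ A
  ⊢ᵃ-lifts : ∀ {m n} {θ : Fin m → Tm n} {Γ : Ctx m} {Δ : Ctx n} {A} →
             (∀ i → Δ ⊢ᵃ θ i ∶ Γ i) → ∀ i → A ◂ Δ ⊢ᵃ lifts θ i ∶ (A ◂ Γ) i
  ⊢ᵃ-lifts τ zero    = var refl
  ⊢ᵃ-lifts τ (suc i) = ⊢ᵃ-rename⁺ suc-injective (λ _ → refl) (τ i)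
  ⊢ᵃ-subst h τ (var {i = i} refl) = τ i
  ⊢ᵃ-subst h τ (lam {M = M} T) = lam (⊢ᵃ-subst (own-lift M (owns h)) (⊢ᵃ-lifts τ) T)
  ⊢ᵃ-subst {θ = θ} {o} h τ (app {M = M} {N} D T T′) =
    app D′ (⊢ᵃ-subst (own-⊆ (λ _ → proj₁) h) τ T)
           (⊢ᵃ-subst (own-⊆ (λ _ → proj₂) h) τ T′)
    where
    D′ : Disjoint (subst θ M) (subst θ N)
    -- Any occurrence of `j` in either half stems from the substitute of `o j`, so the side that
    -- lacks `o j` lacks `j` too.
    D′ j with D (o j)
    ... | inj₁ ∉M = inj₁ (∉-subst M hit)
      where
      hit : ∀ i → i ∉ M ⊎ j ∉ θ i
      hit i with owns h j i
      ... | inj₁ (i∉ , _)    = inj₁ i∉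
      ... | inj₂ (inj₁ refl) = inj₁ ∉M
      ... | inj₂ (inj₂ j∉)   = inj₂ j∉
    ... | inj₂ ∉N = inj₂ (∉-subst N hit)
      where
      hit : ∀ i → i ∉ N ⊎ j ∉ θ i
      hit i with owns h j i
      ... | inj₁ (_ , i∉)    = inj₁ i∉
      ... | inj₂ (inj₁ refl) = inj₁ ∉N
      ... | inj₂ (inj₂ j∉)   = inj₂ j∉
  ⊢ᵃ-subst h τ num = num
  ⊢ᵃ-subst h τ skip = skip
  ⊢ᵃ-subst h τ (binop {M = M} {N} T T′) =
    binop (⊢ᵃ-subst (own-⊆ (λ _ → proj₁) h) τ T) (⊢ᵃ-subst (own-⊆ (λ _ → proj₂) h) τ T′)
  ⊢ᵃ-subst h τ (seq {M = M} {N} T T′) =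
    seq (⊢ᵃ-subst (own-⊆ (λ _ → proj₁) h) τ T) (⊢ᵃ-subst (own-⊆ (λ _ → proj₂) h) τ T′)
  ⊢ᵃ-subst h τ (assign {M = M} {N} T T′) =
    assign (⊢ᵃ-subst (own-⊆ (λ _ → proj₁) h) τ T) (⊢ᵃ-subst (own-⊆ (λ _ → proj₂) h) τ T′)
  ⊢ᵃ-subst h τ (deref T) = deref (⊢ᵃ-subst (own-⊆ (λ _ i∉M → i∉M) h) τ T)
  ⊢ᵃ-subst h τ (while {M = M} {N} T T′) =
    while (⊢ᵃ-subst (own-⊆ (λ _ → proj₁) h) τ T) (⊢ᵃ-subst (own-⊆ (λ _ → proj₂) h) τ T′)
  ⊢ᵃ-subst h τ (ifzero {M = M} {N} {P} T T′ T″) =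
    ifzero (⊢ᵃ-subst (own-⊆ (λ _ → proj₁) h) τ T)
           (⊢ᵃ-subst (own-⊆ (λ _ → proj₁ ∘ proj₂) h) τ T′)
           (⊢ᵃ-subst (own-⊆ (λ _ → proj₂ ∘ proj₂) h) τ T″)
  ⊢ᵃ-subst h τ (new {M = M} b T) = new b (⊢ᵃ-subst (own-lift M (owns h)) (⊢ᵃ-lifts τ) T)
  ⊢ᵃ-subst h τ (mkvar {M = M} {N} T T′) =
    mkvar (⊢ᵃ-subst (own-⊆ (λ _ → proj₁) h) τ T) (⊢ᵃ-subst (own-⊆ (λ _ → proj₂) h) τ T′)

  -- Invariance under β

  module Beta {n} (M : Tm (suc n)) (N : Tm n) (D : ∀ j → suc j ∉ M ⊎ j ∉ N) where

    -- An identifier absent from the body can only enter through the argument, that is, through the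
    -- bound variable. Otherwise it is absent from the argument and stands for itself.
    owner : Fin n → Fin (suc n)
    owner j with D j
    ... | inj₁ _ = zero
    ... | inj₂ _ = suc j

    own : Own (N ◂ `_) owner M
    own = owning go
     where
     go : ∀ j → Hits (λ i → owner j ≡ i ⊎ j ∉ (N ◂ `_) i) M
     go j zero with D j
     ... | inj₁ _   = inj₂ (inj₁ refl)
     ... | inj₂ j∉N = inj₂ (inj₂ j∉N)
     go j (suc i) with j ≟ i
     ... | no j≢i = inj₂ (inj₂ j≢i)
     ... | yes refl with D j
     ... | inj₁ j∉M = inj₁ j∉M
     ... | inj₂ _   = inj₂ (inj₁ refl)

    β-typed : ∀ {Γ : Ctx n} {A B} → Γ ⊢ᵃ ƛ A M ∶ A ⊸ B → Γ ⊢ᵃ N ∶ A → Γ ⊢ᵃ M [ N /0] ∶ B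
    β-typed (lam T) T′ = ⊢ᵃ-subst own (λ { zero → T′ ; (suc i) → var refl }) T

    β-∉ : ∀ {j} → suc j ∉ M → j ∉ N → j ∉ M [ N /0]
    β-∉ {j} j∉M j∉N = ∉-subst M λ { zero → inj₂ j∉N ; (suc i) → hit i (j ≟ i) }
      where
      hit : ∀ i → _ → suc i ∉ M ⊎ j ≢ i
      hit i (yes refl) = inj₁ j∉M
      hit i (no j≢i)   = inj₂ j≢i

    -- At each identifier `s` or `t` is empty, so restriction to owners cuts `s ∙ t` exactly into
    -- the share of the argument and that of the body. How their actions interleave during execution
    -- leaves no mark on the traces.
    β⁺ : ∀ {k l s t ps p} → ps ◂ s ⊩[ k ] M ∶ p → t ⊩*[ l ] N ∶ ps →
         ∃ λ k′ → k′ ≤ k + l × s ∙ t ⊩[ k′ ] M [ N /0] ∶ p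
    β⁺ {k} {l} {s} {t} {ps} d ds with subst⁺ (real {o = owner} R) d
      where
      e : restrict owner (s ∙ t) zero ≋ t
      e j with D j
      ... | inj₁ j∉M = cong (_++ t j) (support d j∉M)
      ... | inj₂ j∉N = sym (support* ds j∉N)
      hit : ∀ i → restrict owner (s ∙ t) (suc i) i ≡ s i
      hit i with D i
      ... | inj₁ i∉M = sym (support d i∉M)
      ... | inj₂ i∉N with i ≟ i
      ... | yes _ = trans (cong (s i ++_) (support* ds i∉N)) (++-identityʳ (s i))
      ... | no ne = contradiction refl ne
      off : ∀ i j → j ≢ i → restrict owner (s ∙ t) (suc i) j ≡ []
      off i j ne with D j
      ... | inj₁ _ = refl
      ... | inj₂ _ with j ≟ i
      ... | yes e = contradiction e ne
      ... | no _ = refl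
      R : ∀ i → restrict owner (s ∙ t) i ⊩*[ (l ◂ λ _ → 0) i ] (N ◂ `_) i ∶ (ps ◂ s) i
      R zero    = resp* (≋-sym e) ds
      R (suc i) = vars⁺ (s i) (hit i , off i)
    ... | _ , le , d′ = _ ,
      ≤-trans le (≤-reflexive (cong (k +_)
        (trans (cong (l +_) (sum-replicate-zero n)) (+-identityʳ l)))) , d′

    β⁻ : ∀ {k v p} → v ⊩[ k ] M [ N /0] ∶ p →
         ∃₂ λ s t → ∃ λ ps → v ≋ s ∙ t × (∃ λ k → ps ◂ s ⊩[ k ] M ∶ p) × (∃ λ l → t ⊩*[ l ] N ∶ ps)
    β⁻ {v = v} d with subst⁻ M own d
    ... | u , _ , (_ , R) , d′ =
      u ∘ suc , restrict owner v zero , u zero , e , (_ , resp (◂-η u) d′) , (_ , at R zero)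
      where
      e : v ≋ (u ∘ suc) ∙ restrict owner v zero
      e j with D j | proj₁ (vars⁻ (at R (suc j)))
      ... | inj₁ _ | h = cong (_++ v j) h
      ... | inj₂ _ | h with j ≟ j
      ... | yes _ = trans h (sym (++-identityʳ _))
      ... | no ne = contradiction refl ne

  -- That evaluation introduces no identifiers is proved along with typing: a redex is formed from
  -- the value of its function, and its disjointness must be inherited from the unevaluated
  -- application.
  preserve : ∀ {n} {σ σ′ : Store n} {Γ : Ctx n} {M V A} → ⟨ σ ∥ M ⟩⇓⟨ σ′ ∥ V ⟩ → Γ ⊢ᵃ M ∶ A →
             Γ ⊢ᵃ V ∶ A × (∀ j → j ∉ M → j ∉ V)
  preserve (val _) T = T , λ _ h → h
  preserve (app {M′ = M′} {N} a b) (app D T T′) with preserve a T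
  ... | lam T₁ , f with preserve b (Beta.β-typed M′ N (λ j → Sum.map₁ (f j) (D j)) (lam T₁) T′)
  ... | T₂ , g = T₂ , λ j (h , h′) → g j (Beta.β-∉ M′ N (λ j → Sum.map₁ (f j) (D j)) (f j h) h′)
  preserve (binop a b) (binop T T′) = num , _
  preserve (assign a b) (assign T T′) = skip , _
  preserve (deref a) (deref T) = num , _
  preserve (seq a b) (seq T T′) with preserve b T′
  ... | T₁ , f = T₁ , λ j → f j ∘ proj₂
  preserve (while≢0 a) (while T T′) = skip , _
  preserve (while≡0 a b c) (while T T′) = skip , _
  preserve (ifzero≡0 a b) (ifzero T T′ T″) with preserve b T′
  ... | T₁ , f = T₁ , λ j → f j ∘ proj₁ ∘ proj₂
  preserve (ifzero≢0 a b) (ifzero T T′ T″) with preserve b T″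
  ... | T₁ , f = T₁ , λ j → f j ∘ proj₂ ∘ proj₂
  preserve (new {V = V} a) (new o T) with preserve a T
  ... | T₁ , f = ⊢ᵃ-rename⁻ (λ _ → refl) V T₁ , λ j → ∉-rename⁻ V ∘ f (suc j)
  preserve (assignᵐᵏ a b c) (assign T T′) with preserve b T
  ... | mkvar T₁ T₂ , f with preserve c (app (λ j → inj₂ tt) T₁ num)
  ... | T₃ , g = T₃ , λ j (h , _) → g j (proj₁ (f j h) , tt)
  preserve (derefᵐᵏ a b) (deref T) with preserve a T
  ... | mkvar T₁ T₂ , f with preserve b T₂
  ... | T₃ , g = T₃ , λ j h → g j (proj₂ (f j h))

  -- Traces as histories of a store

  Runs : ∀ {n} → (Fin n → ℕ) → Env n → (Fin n → ℕ) → Set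
  Runs σ u ω = ∀ i → Run (σ i) (u i) (ω i)

  VarCtx : ∀ {n} → Ctx n → Set
  VarCtx Γ = ∀ i → Γ i ≡ var

  var-◂ : ∀ {n} {Γ : Ctx n} → VarCtx Γ → VarCtx (var ◂ Γ)
  var-◂ v zero    = refl
  var-◂ v (suc i) = v i

  runs-typed : ∀ {n} {Γ : Ctx n} {σ u ω} → VarCtx Γ → Runs σ u ω → Typed Γ u
  runs-typed v r i = transport (λ A → All (_∶ᵖ A) _) (sym (v i)) (run-typed (r i))

  run-++ : ∀ {j k m s t} → Run k s j → Run j t m → Run k (s ++ t) m
  run-++ []        q = q
  run-++ (rd∷ r)   q = rd∷ (run-++ r q)
  run-++ (wr∷ j r) q = wr∷ j (run-++ r q)

  run-split : ∀ {k m} s {t} → Run k (s ++ t) m → ∃ λ j → Run k s j × Run j t m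
  run-split []      r         = _ , [] , r
  run-split (_ ∷ s) (rd∷ r)   with run-split s r
  ... | _ , r₁ , r₂ = _ , rd∷ r₁ , r₂
  run-split (_ ∷ s) (wr∷ j r) with run-split s r
  ... | _ , r₁ , r₂ = _ , wr∷ j r₁ , r₂

  runs-∙ : ∀ {n} {σ τ ω : Fin n → ℕ} {s t} → Runs σ s τ → Runs τ t ω → Runs σ (s ∙ t) ω
  runs-∙ r q i = run-++ (r i) (q i)

  runs-split : ∀ {n} {σ ω : Fin n → ℕ} {u s t} → u ≋ s ∙ t → Runs σ u ω →
               ∃ λ τ → Runs σ s τ × Runs τ t ω
  runs-split {s = s} u≋ r = proj₁ ∘ f , proj₁ ∘ proj₂ ∘ f , proj₂ ∘ proj₂ ∘ f
    where
    f : ∀ i → _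
    f i = run-split (s i) (transport (λ a → Run _ a _) (u≋ i) (r i))

  runs-ε : ∀ {n} {σ : Fin n → ℕ} → Runs σ ε σ
  runs-ε i = []

  run-nil : ∀ {k s m} → Run k s m → s ≡ [] → k ≡ m
  run-nil [] refl = refl

  -- A numeral or `skip` leaves an empty residual trace, so the next phase starts from the very
  -- store that evaluation has reached.
  absorb : ∀ {n} {σ τ ω : Fin n → ℕ} {s t} → Nil s → Runs σ s τ → Runs τ t ω → Runs σ t ω
  absorb z r q i = transport (λ k → Run k _ _) (sym (run-nil (r i) (z i))) (q i)

  runs-resp : ∀ {n} {σ ω : Fin n → ℕ} {u v} → u ≋ v → Runs σ u ω → Runs σ v ω
  runs-resp e r i = transport (λ a → Run _ a _) (e i) (r i)

  runs-◂ : ∀ {n} {σ : Store n} {ω u j s k} → Run j s k → Runs (lookup σ) u ω →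
           Runs (lookup (j ∷ σ)) (s ◂ u) (k ◂ ω)
  runs-◂ r q zero    = r
  runs-◂ r q (suc i) = q i

  runs-read : ∀ {n} (σ : Store n) x {s ω} → Nil s → Runs (lookup σ) s ω →
              Runs (lookup σ) (single x (rd (lookup σ x) ∷ [])) ω
  runs-read σ x z r i with i ≟ x
  ... | yes refl = rd∷ (transport (Run _ _) (run-nil (r i) (z i)) [])
  ... | no _     = transport (λ a → Run _ a _) (z i) (r i)

  runs-write : ∀ {n} (σ : Store n) x {k s ω} → Nil s → Runs (lookup (σ [ x ]≔ k)) s ω →
               Runs (lookup σ) (single x (wr k ∷ [])) ω
  runs-write σ x {k} z r i with i ≟ x
  ... | yes refl = wr∷ k (transport (Run k _) (trans (sym (lookup∘update x σ k)) (run-nil (r x) (z x))) [])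
  ... | no i≢x   = transport (Run _ _) (trans (sym (lookup∘update′ i≢x σ k)) (run-nil (r i) (z i))) []

  -- Expansion of points along evaluation

  Sound : ∀ {n} → Store n → Tm n → Pt → (Fin n → ℕ) → Set
  Sound σ M p ω = ∃₂ λ u k → u ⊩[ k ] M ∶ p × Runs (lookup σ) u ω

  nums⁻ : ∀ {n k j ps} {u : Env n} → u ⊩*[ j ] num k ∶ ps → Nil u × All (_≡ num k) ps
  nums⁻ ([] z) = z , []
  nums⁻ (const num z ⟨ e ⟩∷ ds) with nums⁻ ds
  ... | z′ , a = (λ i → ++-nil (e i) (z i) (z′ i)) , refl ∷ a

  nums⁺ : ∀ {n k ps} → All (_≡ num k) ps → ε {n} ⊩*[ 0 ] num k ∶ ps
  nums⁺ []         = [] λ _ → refl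
  nums⁺ (refl ∷ a) = _⟨_⟩∷_ {s = ε} {ε} (const num λ _ → refl) (λ _ → refl) (nums⁺ a)

  nil-∙ʳ : ∀ {n} {u s t : Env n} → u ≋ s ∙ t → Nil t → u ≋ s
  nil-∙ʳ {s = s} e z i = trans (e i) (trans (cong (s i ++_) (z i)) (++-identityʳ (s i)))

  nil-∙ˡ : ∀ {n} {u s t : Env n} → u ≋ s ∙ t → Nil s → u ≋ t
  nil-∙ˡ {t = t} e z i = trans (e i) (cong (_++ t i) (z i))

  -- The history splits at `σ′` into what evaluation does and what the value will do later. Leaving
  -- `ω` arbitrary beyond `σ′` lets the induction pass through identifiers, abstractions and
  -- `mkvar`, whose own effects are still to come.
  sound : ∀ {n k} {σ σ′ : Store n} {Γ : Ctx n} {M V A s p ω} → VarCtx Γ → Γ ⊢ᵃ M ∶ A →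
          ⟨ σ ∥ M ⟩⇓⟨ σ′ ∥ V ⟩ → s ⊩[ k ] V ∶ p → Runs (lookup σ′) s ω → Sound σ M p ω
  sound v T (val _) d r = _ , _ , d , r
  sound v (app D T T′) (app {M′ = M′} {N} a b) d r with preserve a T
  ... | lam T₁ , f with sound v (Beta.β-typed M′ N D′ (lam T₁) T′) b d r
    where D′ = λ j → Sum.map₁ (f j) (D j)
  -- Here the actions of the argument are moved behind those of the body. Traces are kept per
  -- identifier and no identifier is shared, so every single cell keeps its history.
  ... | u , _ , d₁ , r₁ with Beta.β⁻ M′ N (λ j → Sum.map₁ (f j) (D j)) d₁
  ... | s , t , ps , u≋ , (_ , d₂) , (_ , ds) with runs-split u≋ r₁
  ... | _ , r₂ , r₃
    with sound v T a (lam (points-typed T′ (typed-ʳ {s = s} u≋ (runs-typed v r₁)) ds) d₂) r₂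
  ... | _ , _ , d₃ , r₄ = _ , _ , app (λ _ → refl) d₃ ds , runs-∙ r₄ r₃
  sound v (binop T T′) (binop a b) (const num z) r
    with sound v T a (const num λ _ → refl) runs-ε | sound v T′ b (const num z) r
  ... | _ , _ , d₁ , r₁ | _ , _ , d₂ , r₂ = _ , _ , bin binop (λ _ → refl) d₁ d₂ , runs-∙ r₁ r₂
  sound v (assign T T′) (assign {σ″ = σ″} {k = k} {x} a b) (const skip z) r
    with sound v T′ a (const num λ _ → refl) runs-ε
       | sound v T b (var (single-only x (wr k ∷ []))) (runs-write σ″ x z r)
  ... | _ , _ , d₁ , r₁ | _ , _ , d₂ , r₂ = _ , _ , bin assign (λ _ → refl) d₁ d₂ , runs-∙ r₁ r₂
  sound v (deref T) (deref {σ′ = σ′} {x = x} a) (const num z) r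
    with sound v T a (var (single-only x (rd (lookup σ′ x) ∷ []))) (runs-read σ′ x z r)
  ... | _ , _ , d , r₁ = _ , _ , un deref d , r₁
  sound v (seq T T′) (seq a b) d r
    with sound v T a (const skip λ _ → refl) runs-ε | sound v T′ b d r
  ... | _ , _ , d₁ , r₁ | _ , _ , d₂ , r₂ = _ , _ , bin seq (λ _ → refl) d₁ d₂ , runs-∙ r₁ r₂
  sound v (while T T′) (while≢0 a) (const skip z) r with sound v T a (const num z) r
  ... | _ , _ , d , r₁ = _ , _ , un while d , r₁
  sound v (while T T′) (while≡0 a b c) d r
    with sound v T a (const num λ _ → refl) runs-ε | sound v T′ b (const skip λ _ → refl) runs-ε
       | sound v (while T T′) c d r
  ... | _ , _ , d₁ , r₁ | _ , _ , d₂ , r₂ | _ , _ , d₃ , r₃ with preserve c (while T T′) | d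
  ... | _ | const skip _ =
    _ , _ , bin while (λ _ → refl) d₁ (bin seq (λ _ → refl) d₂ d₃) , runs-∙ r₁ (runs-∙ r₂ r₃)
  sound v (ifzero T T′ T″) (ifzero≡0 a b) d r
    with sound v T a (const num λ _ → refl) runs-ε | sound v T′ b d r
  ... | _ , _ , d₁ , r₁ | _ , _ , d₂ , r₂ = _ , _ , bin ifzero₀ (λ _ → refl) d₁ d₂ , runs-∙ r₁ r₂
  sound v (ifzero T T′ T″) (ifzero≢0 a b) d r
    with sound v T a (const num λ _ → refl) runs-ε | sound v T″ b d r
  ... | _ , _ , d₁ , r₁ | _ , _ , d₂ , r₂ = _ , _ , bin ifzero₊ (λ _ → refl) d₁ d₂ , runs-∙ r₁ r₂
  sound {σ′ = σ′} v (new o T) (new {k = k} a) d r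
    with sound (var-◂ v) T a (rename⁺ suc-injective (push-suc _) d) (runs-◂ {σ = σ′} [] r)
  ... | u , _ , d₁ , r₁ = _ , _ , new (r₁ zero) (resp (◂-η u) d₁) , r₁ ∘ suc
  sound v (assign T T′) (assignᵐᵏ a b c) d r with preserve b T
  ... | mkvar T₁ T₂ , f with sound v (app (λ j → inj₂ tt) T₁ num) c d r
  ... | _ , _ , app {ps = ps} {s} {t} u≋ d₁ ds , r₁
    -- A numeral has an empty trace and no point but itself, so what remains of the application is
    -- the premise of `write`.
    with nums⁻ ds | point-typed T₁ (typed-ˡ u≋ (runs-typed v r₁)) d₁
  ... | z , all | _ ⇒ done with sound v T b (un (write all) d₁) (runs-resp (nil-∙ʳ u≋ z) r₁)
  ... | _ , _ , d₂ , r₂ with sound v T′ a (const num λ _ → refl) runs-ε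
  ... | _ , _ , d₃ , r₃ = _ , _ , bin assign (λ _ → refl) d₃ d₂ , runs-∙ r₃ r₂
  sound v (deref T) (derefᵐᵏ a b) d r with preserve a T
  ... | mkvar T₁ T₂ , f with sound v T₂ b d r
  ... | _ , _ , d₁ , r₁ with point-typed T₂ (runs-typed v r₁) d₁
  ... | num with sound v T a (un read d₁) r₁
  ... | _ , _ , d₂ , r₂ = _ , _ , un deref d₂ , r₂

  -- Points force evaluation

  canon-num : ∀ {n j} {V : Tm n} {s σ ω k} → Value V → s ⊩[ j ] V ∶ num k → Runs σ s ω →
              V ≡ num k × Nil s
  canon-num (num _) (const num z) r = refl , z
  canon-num skip (const () _) r
  canon-num (ƛ _ _) (const () _) r
  canon-num (mkvar _ _) (const () _) r
  -- The run excludes identifiers: a cell only reads and writes, so its history contains no numeral.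
  canon-num (` i) (var (h , _)) r with transport (λ a → Run _ a _) h (r i)
  ... | ()

  canon-done : ∀ {n j} {V : Tm n} {s σ ω} → Value V → s ⊩[ j ] V ∶ done → Runs σ s ω →
               V ≡ skip × Nil s
  canon-done skip (const skip z) r = refl , z
  canon-done (num _) (const () _) r
  canon-done (ƛ _ _) (const () _) r
  canon-done (mkvar _ _) (const () _) r
  canon-done (` i) (var (h , _)) r with transport (λ a → Run _ a _) h (r i)
  ... | ()

  data CanonFun {n} (s : Env n) (j : ℕ) ps p : Tm n → Set where
    ƛ : ∀ {A M j′} → suc j′ ≤ j → ps ◂ s ⊩[ j′ ] M ∶ p → CanonFun s j ps p (ƛ A M)

  canon-fun : ∀ {n j} {V : Tm n} {s σ ω ps p} → Value V → s ⊩[ j ] V ∶ ps ⇒ p → Runs σ s ω →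
              CanonFun s j ps p V
  canon-fun (ƛ A M) (lam _ d) r = ƛ ≤-refl d
  canon-fun (num _) (const () _) r
  canon-fun skip (const () _) r
  canon-fun (mkvar _ _) (const () _) r
  canon-fun (` i) (var (h , _)) r with transport (λ a → Run _ a _) h (r i)
  ... | ()

  data CanonWr {n} (s : Env n) (j k : ℕ) : Tm n → Set where
    `_    : ∀ x → Only x (wr k ∷ []) s → CanonWr s j k (` x)
    mkvar : ∀ {M N ps j′} → suc j′ ≤ j → All (_≡ num k) ps → s ⊩[ j′ ] M ∶ ps ⇒ done →
            CanonWr s j k (mkvar M N)

  canon-wr : ∀ {n j} {V : Tm n} {s k} → Value V → s ⊩[ j ] V ∶ wr k → CanonWr s j k V
  canon-wr (num _) (const () _)
  canon-wr skip (const () _)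
  canon-wr (ƛ _ _) (const () _)
  canon-wr (` x) (var h) = (` x) h
  canon-wr (mkvar M N) (un (write a) d) = mkvar ≤-refl a d

  data CanonRd {n} (s : Env n) (j k : ℕ) : Tm n → Set where
    `_    : ∀ x → Only x (rd k ∷ []) s → CanonRd s j k (` x)
    mkvar : ∀ {M N j′} → suc j′ ≤ j → s ⊩[ j′ ] N ∶ num k → CanonRd s j k (mkvar M N)

  canon-rd : ∀ {n j} {V : Tm n} {s k} → Value V → s ⊩[ j ] V ∶ rd k → CanonRd s j k V
  canon-rd (num _) (const () _)
  canon-rd skip (const () _)
  canon-rd (ƛ _ _) (const () _)
  canon-rd (` x) (var h) = (` x) h
  canon-rd (mkvar M N) (un read d) = mkvar ≤-refl d

  runs-read⁻ : ∀ {n} (σ : Store n) x {k s ω} → Only x (rd k ∷ []) s → Runs (lookup σ) s ω →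
               lookup σ x ≡ k × Runs (lookup σ) ε ω
  runs-read⁻ σ x {k} {ω = ω} (h , z) r = proj₁ (at-x (transport (λ a → Run _ a _) h (r x))) , end
    where
    at-x : ∀ {j m} → Run j (rd k ∷ []) m → j ≡ k × Run j [] m
    at-x (rd∷ []) = refl , []
    end : Runs (lookup σ) ε ω
    end i with i ≟ x
    ... | yes refl = proj₂ (at-x (transport (λ a → Run _ a _) h (r i)))
    ... | no i≢x   = transport (λ a → Run _ a _) (z i i≢x) (r i)

  runs-write⁻ : ∀ {n} (σ : Store n) x {k s ω} → Only x (wr k ∷ []) s → Runs (lookup σ) s ω →
                Runs (lookup (σ [ x ]≔ k)) ε ω
  runs-write⁻ σ x {k} (h , z) r i with i ≟ x
  ... | yes refl = transport (λ j → Run j [] _) (sym (lookup∘update x σ k))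
                     (at-x (transport (λ a → Run _ a _) h (r x)))
    where
    at-x : ∀ {j m} → Run j (wr k ∷ []) m → Run k [] m
    at-x (wr∷ _ []) = []
  ... | no i≢x   = transport (λ j → Run j [] _) (sym (lookup∘update′ i≢x σ k))
                     (transport (λ a → Run _ a _) (z i i≢x) (r i))

  -- The size of the derivation for the value belongs to the result, because an application goes on
  -- with that derivation, which need not be part of the original one.
  record Adequate {n} (σ : Store n) (M : Tm n) (p : Pt) (f : ℕ) (ω : Fin n → ℕ) : Set where
    constructor result
    field
      {σ′}  : Store n
      {V}   : Tm n
      {s}   : Env n
      {j}   : ℕ
      eval⇓ : ⟨ σ ∥ M ⟩⇓⟨ σ′ ∥ V ⟩
      value : Value V
      size≤ : j ≤ f
      point : s ⊩[ j ] V ∶ p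
      runs  : Runs (lookup σ′) s ω

  value-adequate : ∀ {n j f} {σ : Store n} {M s p ω} → Value M → j ≤ f → s ⊩[ j ] M ∶ p →
                   Runs (lookup σ) s ω → Adequate σ M p f ω
  value-adequate V le d r = result (val V) V le d r

  relax : ∀ {n} {σ : Store n} {M p f f′ ω} → f ≤ f′ → Adequate σ M p f ω → Adequate σ M p f′ ω
  relax le (result e V le′ d r) = result e V (≤-trans le′ le) d r

  ≤-step : ∀ {j f} → j ≤ f → j ≤ suc f
  ≤-step le = m≤n⇒m≤1+n le

  -- The bound `f` is the recursion argument: contracting a redex builds a derivation that is
  -- smaller without being a subderivation.
  adequate : ∀ f {n k} {σ : Store n} {Γ : Ctx n} {M A u p ω} → k ≤ f → VarCtx Γ → Γ ⊢ᵃ M ∶ A →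
             u ⊩[ k ] M ∶ p → Runs (lookup σ) u ω → Adequate σ M p k ω
  adequate f le v T (const num z) r = value-adequate (num _) z≤n (const num z) r
  adequate f le v T (const skip z) r = value-adequate skip z≤n (const skip z) r
  adequate f le v T (var h) r = value-adequate (` _) z≤n (var h) r
  adequate f le v T (lam a d) r = value-adequate (ƛ _ _) ≤-refl (lam a d) r
  adequate f le v T (un (write a) d) r = value-adequate (mkvar _ _) ≤-refl (un (write a) d) r
  adequate f le v T (un read d) r = value-adequate (mkvar _ _) ≤-refl (un read d) r
  adequate (suc f) (s≤s le) v (app {N = N} D T T′) (app {k} {l} u≋ d ds) r with runs-split u≋ r
  ... | _ , r₁ , r₂ with adequate f (≤-trans (m≤m+n k l) le) v T d r₁
  ... | result e V le₁ d₁ r₃ with canon-fun V d₁ r₃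
  ... | ƛ {M = M} lt d₂ with preserve e T
  ... | lam T₁ , g with Beta.β⁺ M N (λ j → Sum.map₁ (g j) (D j)) d₂ ds
  ... | _ , le₂ , d₃ =
    relax (≤-step le₃)
      (app⇓ (adequate f (≤-trans le₃ le) v
        (Beta.β-typed M N (λ j → Sum.map₁ (g j) (D j)) (lam T₁) T′)
        d₃ (runs-∙ r₃ r₂)))
    where
    -- The body is smaller than the abstraction, which has size at most `k`, and the argument adds
    -- `l`; so the contractum stays below the `suc (k + l)` of the redex.
    le₃ = ≤-trans le₂ (+-monoˡ-≤ l (≤-trans (≤-step ≤-refl) (≤-trans lt le₁)))
    app⇓ : Adequate _ (M [ N /0]) _ _ _ → Adequate _ _ _ _ _
    app⇓ (result e′ V′ le′ d′ r′) = result (app e e′) V′ le′ d′ r′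
  adequate (suc f) (s≤s le) v (binop T T′) (bin {k} {l = l} binop u≋ d₁ d₂) r with runs-split u≋ r
  ... | _ , r₁ , r₂ with adequate f (≤-trans (m≤m+n k l) le) v T d₁ r₁
  ... | result e V _ d r₃ with canon-num V d r₃
  ... | refl , z with adequate f (≤-trans (m≤n+m l k) le) v T′ d₂ (absorb z r₃ r₂)
  ... | result e′ V′ _ d′ r₄ with canon-num V′ d′ r₄
  ... | refl , z′ = result (binop e e′) (num _) z≤n (const num z′) r₄
  adequate (suc f) (s≤s le) v (seq T T′) (bin {k} {l = l} seq u≋ d₁ d₂) r with runs-split u≋ r
  ... | _ , r₁ , r₂ with adequate f (≤-trans (m≤m+n k l) le) v T d₁ r₁
  ... | result e V _ d r₃ with canon-done V d r₃
  ... | refl , z with adequate f (≤-trans (m≤n+m l k) le) v T′ d₂ (absorb z r₃ r₂)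
  ... | result e′ V′ le′ d′ r₄ = result (seq e e′) V′ (≤-step (≤-trans le′ (m≤n+m l k))) d′ r₄
  adequate (suc f) (s≤s le) v (ifzero T T′ T″) (bin {k} {l = l} ifzero₀ u≋ d₁ d₂) r with runs-split u≋ r
  ... | _ , r₁ , r₂ with adequate f (≤-trans (m≤m+n k l) le) v T d₁ r₁
  ... | result e V _ d r₃ with canon-num V d r₃
  ... | refl , z with adequate f (≤-trans (m≤n+m l k) le) v T′ d₂ (absorb z r₃ r₂)
  ... | result e′ V′ le′ d′ r₄ = result (ifzero≡0 e e′) V′ (≤-step (≤-trans le′ (m≤n+m l k))) d′ r₄
  adequate (suc f) (s≤s le) v (ifzero T T′ T″) (bin {k} {l = l} ifzero₊ u≋ d₁ d₂) r with runs-split u≋ r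
  ... | _ , r₁ , r₂ with adequate f (≤-trans (m≤m+n k l) le) v T d₁ r₁
  ... | result e V _ d r₃ with canon-num V d r₃
  ... | refl , z with adequate f (≤-trans (m≤n+m l k) le) v T″ d₂ (absorb z r₃ r₂)
  ... | result e′ V′ le′ d′ r₄ = result (ifzero≢0 e e′) V′ (≤-step (≤-trans le′ (m≤n+m l k))) d′ r₄
  adequate (suc f) (s≤s le) v (while T T′) (un while d₁) r with adequate f le v T d₁ r
  ... | result e V _ d r₃ with canon-num V d r₃
  ... | refl , z = result (while≢0 e) skip z≤n (const skip z) r₃
  adequate (suc f) (s≤s le) v (while T T′) (bin {k} {l = l} while u≋ d₁ d₂) r with runs-split u≋ r
  ... | _ , r₁ , r₂ with adequate f (≤-trans (m≤m+n k l) le) v T d₁ r₁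
  ... | result e V _ d r₃ with canon-num V d r₃
  ... | refl , z
    -- One iteration is treated as the `seq` of body and loop; inverting its evaluation yields the
    -- last two premises of `while≡0`.
    with adequate f (≤-trans (m≤n+m l k) le) v (seq T′ (while T T′)) d₂ (absorb z r₃ r₂)
  ... | result e′ V′ le′ d′ r₄ with canon-done V′ d′ r₄ | e′
  ... | refl , _ | seq e₁ e₂ =
    result (while≡0 e e₁ e₂) V′ (≤-step (≤-trans le′ (m≤n+m l k))) d′ r₄
  adequate (suc f) (s≤s le) v (assign T T′) (bin {k} {l = l} assign u≋ d₁ d₂) r with runs-split u≋ r
  ... | _ , r₁ , r₂ with adequate f (≤-trans (m≤m+n k l) le) v T′ d₁ r₁
  ... | result e V _ d r₃ with canon-num V d r₃
  ... | refl , z with adequate f (≤-trans (m≤n+m l k) le) v T d₂ (absorb z r₃ r₂)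
  ... | result {σ′} e′ V′ le′ d′ r₄ with canon-wr V′ d′
  ... | (` x) h = result (assign e e′) skip z≤n (const skip λ _ → refl) (runs-write⁻ σ′ x h r₄)
  ... | mkvar lt a d₃ with preserve e′ T
  ... | mkvar T₁ T₂ , _ = finish
      (adequate f (≤-trans le₁ (≤-trans (m≤n+m l k) le)) v (app (λ j → inj₂ tt) T₁ num)
        (app (λ i → sym (++-identityʳ _)) d₃ (nums⁺ a)) r₄)
    where
    -- The application takes the place of the `write` rule and the points of the numeral have size
    -- 0, so the size does not exceed that of the `mkvar` value.
    le₁ = ≤-trans (s≤s (≤-reflexive (+-identityʳ _))) (≤-trans lt le′)
    finish : Adequate _ (_ · num _) done _ _ → Adequate _ _ _ _ _
    finish (result e″ V″ le″ d″ r₅) =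
      result (assignᵐᵏ e e′ e″) V″ (≤-step (≤-trans le″ (≤-trans le₁ (m≤n+m l k)))) d″ r₅
  adequate (suc f) (s≤s le) v (deref T) (un deref d₁) r with adequate f le v T d₁ r
  ... | result {σ′} e V le′ d r₃ with canon-rd V d
  ... | (` x) h with runs-read⁻ σ′ x h r₃
  ... | refl , r₄ = result (deref e) (num _) z≤n (const num λ _ → refl) r₄
  adequate (suc f) (s≤s le) v (deref T) (un deref d₁) r
      | result e V le′ d r₃ | mkvar lt d₂ with preserve e T
  ... | mkvar T₁ T₂ , _ = finish (adequate f (≤-trans le₁ le) v T₂ d₂ r₃)
    where
    le₁ = ≤-trans (≤-step ≤-refl) (≤-trans lt le′)
    finish : Adequate _ _ _ _ _ → Adequate _ _ _ _ _
    finish (result e″ V″ le″ d″ r₅) =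
      result (derefᵐᵏ e e″) V″ (≤-step (≤-trans le″ le₁)) d″ r₅
  adequate (suc f) {σ = σ} (s≤s le) v (new o T) (new c d₁) r
    -- At an observable type the value is a numeral or `skip`. It cannot mention the cell, and so it
    -- is a weakened term, as the rule for `new` demands.
    with adequate f {σ = 0 ∷ σ} le (var-◂ v) T d₁ (runs-◂ c r)
       | o | point-typed T (typed-◂ (run-typed c) (runs-typed v r)) d₁
  ... | result {_ ∷ _} e V le′ d r₃ | nat | num with canon-num V d r₃
  ... | refl , z = result (new e) (num _) z≤n (const num (z ∘ suc)) (r₃ ∘ suc)
  adequate (suc f) {σ = σ} (s≤s le) v (new o T) (new c d₁) r
      | result {_ ∷ _} e V le′ d r₃ | comm | done with canon-done V d r₃
  ... | refl , z = result (new e) skip z≤n (const skip (z ∘ suc)) (r₃ ∘ suc)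

  -- Programs

  data Answer : Tm 0 → Pt → Set where
    num  : ∀ k → Answer (num k) (num k)
    skip : Answer skip done

  answer : ∀ {V B} → Observable B → Value V → ∅ ⊢ᵃ V ∶ B → ∃ λ p → Answer V p
  answer nat  (num k) num = _ , num k
  answer comm skip skip   = _ , skip
  answer _ (` ()) _

  ⊩_∶_ : Tm 0 → Pt → Set
  ⊩ M ∶ p = ∃₂ λ u k → u ⊩[ k ] M ∶ p

  ⇓⇒⊩ : ∀ {M V p B} → ∅ ⊢ᵃ M ∶ B → Answer V p → M ⇓ V → ⊩ M ∶ p
  ⇓⇒⊩ T a e with sound {s = ε} {ω = λ ()} (λ ()) T e (const (const-answer a) λ ()) (λ ())
    where
    const-answer : ∀ {V p} → Answer V p → Const V p
    const-answer (num k) = num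
    const-answer skip    = skip
  ... | _ , _ , d , _ = _ , _ , d

  ⊩⇒⇓ : ∀ {M V p B} → ∅ ⊢ᵃ M ∶ B → Answer V p → ⊩ M ∶ p → M ⇓ V
  ⊩⇒⇓ T a (u , k , d) with adequate k {σ = []} {ω = λ ()} ≤-refl (λ ()) T d (λ ())
  ⊩⇒⇓ T (num _) (u , k , d) | result {[]} e V _ d′ r with canon-num V d′ r
  ... | refl , _ = e
  ⊩⇒⇓ T skip (u , k , d) | result {[]} e V _ d′ r with canon-done V d′ r
  ... | refl , _ = e

  -- Congruence

  rename-push : ∀ {m n k} {ρ : Fin m → Fin n} {v p} M → v ⊩[ k ] rename ρ M ∶ p → Push ρ v (v ∘ ρ)
  rename-push {ρ = ρ} M d j with any? (λ i → ρ i ≟ j)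
  ... | yes (i , refl) = inj₁ (i , refl , refl)
  ... | no ∄ = inj₂ ((λ i e → ∄ (i , e)) , support d (∉-rename⁺ M λ i → inj₂ λ e → ∄ (i , sym e)))

  -- Confined to well-typed traces because only these encode elements of a denotation.
  Refines : ∀ {n} → Ctx n → Tm n → Tm n → Set
  Refines Γ M N = ∀ {u k p} → Typed Γ u → u ⊩[ k ] M ∶ p → ∃ λ l → u ⊩[ l ] N ∶ p

  module Congruence {n} {Γ : Ctx n} {M N : Tm n} (M⊑N : Refines Γ M N) where

    cong-⟪⟫ : ∀ {m} {Δ : Ctx m} (C : Cxt Γ Δ) → Refines Δ (C ⟪ M ⟫) (C ⟪ N ⟫)
    cong-⟪⟫* : ∀ {m} {Δ : Ctx m} (C : Cxt Γ Δ) {u k ps} → Typed Δ u → u ⊩*[ k ] C ⟪ M ⟫ ∶ ps →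
               ∃ λ l → u ⊩*[ l ] C ⟪ N ⟫ ∶ ps
    cong-⟪⟫ (hole ρ e) {u} τ d
      with M⊑N (λ i → transport (λ A → All (_∶ᵖ A) (u (Injection.to ρ i))) (e i) (τ (Injection.to ρ i)))
               (rename⁻ (Injection.injective ρ) M d)
    ... | _ , d′ = _ , rename⁺ (Injection.injective ρ) (rename-push M d) d′
    cong-⟪⟫ (binop₁ o C _) τ (bin binop e d d′) with cong-⟪⟫ C (typed-ˡ e τ) d
    ... | _ , d₁ = _ , bin binop e d₁ d′
    cong-⟪⟫ (binop₂ o _ C) τ (bin binop e d d′) with cong-⟪⟫ C (typed-ʳ e τ) d′
    ... | _ , d₁ = _ , bin binop e d d₁
    cong-⟪⟫ (seq₁ C _) τ (bin seq e d d′) with cong-⟪⟫ C (typed-ˡ e τ) d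
    ... | _ , d₁ = _ , bin seq e d₁ d′
    cong-⟪⟫ (seq₂ _ C) τ (bin seq e d d′) with cong-⟪⟫ C (typed-ʳ e τ) d′
    ... | _ , d₁ = _ , bin seq e d d₁
    cong-⟪⟫ (assign₁ C _) τ (bin assign e d d′) with cong-⟪⟫ C (typed-ʳ e τ) d′
    ... | _ , d₁ = _ , bin assign e d d₁
    cong-⟪⟫ (assign₂ _ C) τ (bin assign e d d′) with cong-⟪⟫ C (typed-ˡ e τ) d
    ... | _ , d₁ = _ , bin assign e d₁ d′
    cong-⟪⟫ (deref C) τ (un deref d) with cong-⟪⟫ C τ d
    ... | _ , d₁ = _ , un deref d₁
    cong-⟪⟫ (while₁ C _) τ (un while d) with cong-⟪⟫ C τ d
    ... | _ , d₁ = _ , un while d₁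
    -- The hole recurs in every unfolding of the loop, so here the context stays the same and the
    -- derivation shrinks.
    cong-⟪⟫ (while₁ C P) τ (bin while e d (bin seq e′ d′ d″))
      with cong-⟪⟫ C (typed-ˡ e τ) d | cong-⟪⟫ (while₁ C P) (typed-ʳ e′ (typed-ʳ e τ)) d″
    ... | _ , d₁ | _ , d₂ = _ , bin while e d₁ (bin seq e′ d′ d₂)
    cong-⟪⟫ (while₂ _ C) τ (un while d) = _ , un while d
    cong-⟪⟫ (while₂ P C) τ (bin while e d (bin seq e′ d′ d″))
      with cong-⟪⟫ C (typed-ˡ e′ (typed-ʳ e τ)) d′ | cong-⟪⟫ (while₂ P C) (typed-ʳ e′ (typed-ʳ e τ)) d″
    ... | _ , d₁ | _ , d₂ = _ , bin while e d (bin seq e′ d₁ d₂)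
    cong-⟪⟫ (ifzero₁ C _ _) τ (bin ifzero₀ e d d′) with cong-⟪⟫ C (typed-ˡ e τ) d
    ... | _ , d₁ = _ , bin ifzero₀ e d₁ d′
    cong-⟪⟫ (ifzero₁ C _ _) τ (bin ifzero₊ e d d′) with cong-⟪⟫ C (typed-ˡ e τ) d
    ... | _ , d₁ = _ , bin ifzero₊ e d₁ d′
    cong-⟪⟫ (ifzero₂ _ C _) τ (bin ifzero₀ e d d′) with cong-⟪⟫ C (typed-ʳ e τ) d′
    ... | _ , d₁ = _ , bin ifzero₀ e d d₁
    cong-⟪⟫ (ifzero₂ _ C _) τ (bin ifzero₊ e d d′) = _ , bin ifzero₊ e d d′
    cong-⟪⟫ (ifzero₃ _ _ C) τ (bin ifzero₀ e d d′) = _ , bin ifzero₀ e d d′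
    cong-⟪⟫ (ifzero₃ _ _ C) τ (bin ifzero₊ e d d′) with cong-⟪⟫ C (typed-ʳ e τ) d′
    ... | _ , d₁ = _ , bin ifzero₊ e d d₁
    cong-⟪⟫ (ƛ A C) τ (lam a d) with cong-⟪⟫ C (typed-◂ a τ) d
    ... | _ , d₁ = _ , lam a d₁
    cong-⟪⟫ (app₁ C _) τ (app e d ds) with cong-⟪⟫ C (typed-ˡ e τ) d
    ... | _ , d₁ = _ , app e d₁ ds
    cong-⟪⟫ (app₂ _ C) τ (app e d ds) with cong-⟪⟫* C (typed-ʳ e τ) ds
    ... | _ , ds₁ = _ , app e d ds₁
    cong-⟪⟫ (new C) τ (new r d) with cong-⟪⟫ C (typed-◂ (run-typed r) τ) d
    ... | _ , d₁ = _ , new r d₁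
    cong-⟪⟫ (mkvar₁ C _) τ (un (write a) d) with cong-⟪⟫ C τ d
    ... | _ , d₁ = _ , un (write a) d₁
    cong-⟪⟫ (mkvar₁ C _) τ (un read d) = _ , un read d
    cong-⟪⟫ (mkvar₂ _ C) τ (un (write a) d) = _ , un (write a) d
    cong-⟪⟫ (mkvar₂ _ C) τ (un read d) with cong-⟪⟫ C τ d
    ... | _ , d₁ = _ , un read d₁
    cong-⟪⟫* C τ ([] z) = _ , [] z
    cong-⟪⟫* C τ (d ⟨ e ⟩∷ ds) with cong-⟪⟫ C (typed-ˡ e τ) d | cong-⟪⟫* C (typed-ʳ e τ) ds
    ... | _ , d₁ | _ , ds₁ = _ , d₁ ⟨ e ⟩∷ ds₁

  -- Encoding of the typed semantics

  enc : ∀ A → α A → Pt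
  enc nat     k         = num k
  enc comm    _         = done
  enc var     (read k)  = rd k
  enc var     (write k) = wr k
  enc (A ⊸ B) (s , b)   = map (enc A) s ⇒ enc B b

  ⌜_⌝ : ∀ {n} {Γ : Ctx n} → Trace Γ → Env n
  ⌜_⌝ {Γ = Γ} u i = map (enc (Γ i)) (u i)

  enc-typed : ∀ A a → enc A a ∶ᵖ A
  encs-typed : ∀ A as → All (_∶ᵖ A) (map (enc A) as)
  enc-typed nat     k         = num
  enc-typed comm    _         = done
  enc-typed var     (read k)  = rd
  enc-typed var     (write k) = wr
  enc-typed (A ⊸ B) (s , b)   = encs-typed A s ⇒ enc-typed B b
  encs-typed A []       = []
  encs-typed A (a ∷ as) = enc-typed A a ∷ encs-typed A as

  ⌜⌝-typed : ∀ {n} {Γ : Ctx n} (u : Trace Γ) → Typed Γ ⌜ u ⌝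
  ⌜⌝-typed {Γ = Γ} u i = encs-typed (Γ i) (u i)

  decode : ∀ {A p} → p ∶ᵖ A → ∃ λ a → enc A a ≡ p
  decodes : ∀ {A ps} → All (_∶ᵖ A) ps → ∃ λ as → map (enc A) as ≡ ps
  decode num     = _ , refl
  decode done    = tt , refl
  decode rd      = read _ , refl
  decode wr      = write _ , refl
  decode (a ⇒ t) with decodes a | decode t
  ... | _ , refl | _ , refl = _ , refl
  decodes []      = [] , refl
  decodes (t ∷ a) with decode t | decodes a
  ... | _ , refl | _ , refl = _ ∷ _ , refl

  ⇒-injective : ∀ {ps qs : List Pt} {p q : Pt} → (ps Pt.⇒ p) ≡ (qs Pt.⇒ q) → ps ≡ qs × p ≡ q
  ⇒-injective refl = refl , refl

  enc-injective : ∀ A {a b} → enc A a ≡ enc A b → a ≡ b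
  encs-injective : ∀ A {as bs} → map (enc A) as ≡ map (enc A) bs → as ≡ bs
  enc-injective nat refl = refl
  enc-injective comm e = refl
  enc-injective var {read _} {read _} refl = refl
  enc-injective var {write _} {write _} refl = refl
  enc-injective (A ⊸ B) e =
    cong₂ _,_ (encs-injective A (proj₁ (⇒-injective e))) (enc-injective B (proj₂ (⇒-injective e)))
  encs-injective A = map-injective (enc-injective A)

  map-split : ∀ {X : Set} {f : X → Pt} {xs} s {t} → map f xs ≡ s ++ t →
              ∃₂ λ ys zs → xs ≡ ys ++ zs × map f ys ≡ s × map f zs ≡ t
  map-split {xs = xs} [] e = [] , xs , refl , refl , e
  map-split {xs = x ∷ xs} (a ∷ s) e with ∷-injective e
  ... | refl , e′ with map-split s e′
  ... | ys , zs , refl , refl , refl = x ∷ ys , zs , refl , refl , refl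

  ⌜⌝-split : ∀ {n} {Γ : Ctx n} {u : Trace Γ} {s t} → ⌜ u ⌝ ≋ s ∙ t →
             ∃₂ λ (s′ t′ : Trace Γ) → u ≋ s′ ∙ t′ × s ≋ ⌜ s′ ⌝ × t ≋ ⌜ t′ ⌝
  ⌜⌝-split {Γ = Γ} {u} {s} {t} e =
    (λ i → proj₁ (f i)) , (λ i → proj₁ (proj₂ (f i))) , (λ i → proj₁ (proj₂ (proj₂ (f i)))) ,
    (λ i → sym (proj₁ (proj₂ (proj₂ (proj₂ (f i)))))) ,
    (λ i → sym (proj₂ (proj₂ (proj₂ (proj₂ (f i))))))
    where
    f : ∀ i → ∃₂ λ ys zs → u i ≡ ys ++ zs × map (enc (Γ i)) ys ≡ s i × map (enc (Γ i)) zs ≡ t i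
    f i = map-split (s i) (e i)

  ⌜⌝-∙ : ∀ {n} {Γ : Ctx n} {u : Trace Γ} (s t : Trace Γ) → u ≋ s ∙ t → ⌜ u ⌝ ≋ ⌜ s ⌝ ∙ ⌜ t ⌝
  ⌜⌝-∙ {Γ = Γ} s t e i = trans (cong (map (enc (Γ i))) (e i)) (map-++ _ (s i) (t i))

  ⌜⌝-◂ : ∀ {n} {Γ : Ctx n} {A} (s : List (α A)) (u : Trace Γ) →
         ⌜_⌝ {Γ = A ◂ Γ} (s ◂ᵗ u) ≋ map (enc A) s ◂ ⌜ u ⌝
  ⌜⌝-◂ s u zero    = refl
  ⌜⌝-◂ s u (suc i) = refl

  -- In the denotation each premise of `app` sees its own block of the context, while `⊩` keeps one
  -- scope; padding with empty traces mediates.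
  leftPart rightPart : ∀ m {n} → Env (m + n) → Env (m + n)
  leftPart m v j with block m j
  ... | left _  = v j
  ... | right _ = []
  rightPart m v j with block m j
  ... | left _  = []
  ... | right _ = v j

  parts : ∀ m {n} (v : Env (m + n)) → v ≋ leftPart m v ∙ rightPart m v
  parts m v j with block m j
  ... | left _  = sym (++-identityʳ (v j))
  ... | right _ = refl

  push-left : ∀ m {n} (v : Env (m + n)) → Push (_↑ˡ n) (leftPart m v) (v ∘ (_↑ˡ n))
  push-left m v j with block m j
  ... | left i  = inj₁ (i , refl , refl)
  ... | right i = inj₂ ((λ i′ → ↑ˡ≢↑ʳ i′ i) , refl)

  push-right : ∀ m {n} (v : Env (m + n)) → Push (m ↑ʳ_) (rightPart m v) (v ∘ (m ↑ʳ_))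
  push-right m v j with block m j
  ... | left i  = inj₂ ((λ i′ → ↑ˡ≢↑ʳ i i′ ∘ sym) , refl)
  ... | right i = inj₁ (i , refl , refl)

  cell⇒run : ∀ {k s} → CellTrace k s → ∃ (Run k (map (enc var) s))
  cell⇒run []          = _ , []
  cell⇒run (read c)    = _ , rd∷ (proj₂ (cell⇒run c))
  cell⇒run (write j c) = _ , wr∷ j (proj₂ (cell⇒run c))

  run⇒cell : ∀ {k m} s → Run k (map (enc var) s) m → CellTrace k s
  run⇒cell []            []        = []
  run⇒cell (read _ ∷ s)  (rd∷ r)   = read (run⇒cell s r)
  run⇒cell (write _ ∷ s) (wr∷ j r) = write j (run⇒cell s r)

  Encodes : ∀ {n} (Γ : Ctx n) → Tm n → ∀ A → (Trace Γ → α A → Set) → Set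
  Encodes Γ M A R = ∀ {u b} → R u b → ∃ λ k → ⌜ u ⌝ ⊩[ k ] M ∶ enc A b

  ext-to : ∀ {n} {Γ : Ctx n} {M A R} → Encodes Γ M A R →
           ∀ {u as} → Ext (Traces Γ) R u as → ∃ λ k → ⌜ u ⌝ ⊩*[ k ] M ∶ map (enc A) as
  ext-to {Γ = Γ} f ([] z) = _ , [] λ i → cong (map (enc (Γ i))) (z i)
  ext-to f (add {p} {q} r rs e) = _ , proj₂ (f r) ⟨ ⌜⌝-∙ p q e ⟩∷ proj₂ (ext-to f rs)

  loop-to : ∀ {n} {Γ : Ctx n} {M N G C} → Encodes Γ M nat G → Encodes Γ N comm C →
            ∀ {u} → Loop G C u → ∃ λ k → ⌜ u ⌝ ⊩[ k ] while M N ∶ done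
  loop-to f g (stop r) = _ , un while (proj₂ (f r))
  loop-to f g (step {v = v} s t r r′ l e) =
    _ , bin while (⌜⌝-∙ s (t ∙ v) e) (proj₂ (f r))
          (bin seq (⌜⌝-∙ t v λ _ → refl) (proj₂ (g r′)) (proj₂ (loop-to f g l)))

  all-num : ∀ {k ks} → All (_≡ k) ks → All (_≡ num k) (map (enc nat) ks)
  all-num []         = []
  all-num (refl ∷ a) = refl ∷ all-num a

  num-all : ∀ {k ps} → All (_≡ num k) ps → ∃ λ ks → All (_≡ k) ks × ps ≡ map (enc nat) ks
  num-all []         = [] , [] , refl
  num-all (refl ∷ a) with num-all a
  ... | _ , a′ , refl = _ , refl ∷ a′ , refl

  ⟦⟧⇒⊩ : ∀ {n} {Γ : Ctx n} {M A} (d : Γ ⊢ M ∶ A) → Encodes Γ M A ⟦ d ⟧₁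
  ⟦⟧⇒⊩ id e = _ , var (cong (map _) e , λ { zero 0≢0 → contradiction refl 0≢0 })
  ⟦⟧⇒⊩ (lam {A = A} d) {u} {s , b} r = _ , lam (encs-typed A s) (resp (⌜⌝-◂ s u) (proj₂ (⟦⟧⇒⊩ d r)))
  ⟦⟧⇒⊩ (app {m} {n} d e) {u} (as , r , rs) = _ ,
    app (parts m ⌜ u ⌝)
        (rename⁺ (↑ˡ-injective n _ _) (push-left m ⌜ u ⌝) (proj₂ (⟦⟧⇒⊩ d r)))
        (rename⁺* (↑ʳ-injective m _ _) (push-right m ⌜ u ⌝) (proj₂ (ext-to (⟦⟧⇒⊩ e) rs)))
  ⟦⟧⇒⊩ (weak d) {u} (z , r) = _ , rename⁺ suc-injective push (proj₂ (⟦⟧⇒⊩ d r))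
    where
    push : Push suc ⌜ u ⌝ (⌜ u ⌝ ∘ suc)
    push zero    = inj₂ ((λ _ ()) , cong (map _) z)
    push (suc j) = inj₁ (j , refl , refl)
  ⟦⟧⇒⊩ {Γ = Γ} (exch π d) {u} r = _ ,
    rename⁺ (perm-inj π)
      (λ j → inj₁ (π ⟨$⟩ˡ j , inverseʳ π , cong (⌜_⌝ {Γ = Γ} u) (sym (inverseʳ π))))
      (proj₂ (⟦⟧⇒⊩ d r))
  ⟦⟧⇒⊩ (num k) refl = _ , const num λ ()
  ⟦⟧⇒⊩ skip _ = _ , const skip λ ()
  ⟦⟧⇒⊩ (binop o d e) (s , t , u≋ , _ , _ , refl , r , r′) =
    _ , bin binop (⌜⌝-∙ s t u≋) (proj₂ (⟦⟧⇒⊩ d r)) (proj₂ (⟦⟧⇒⊩ e r′))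
  ⟦⟧⇒⊩ (seq _ d e) (s , t , u≋ , r , r′) =
    _ , bin seq (⌜⌝-∙ s t u≋) (proj₂ (⟦⟧⇒⊩ d r)) (proj₂ (⟦⟧⇒⊩ e r′))
  ⟦⟧⇒⊩ (assign d e) (s , t , u≋ , _ , r , r′) =
    _ , bin assign (⌜⌝-∙ s t u≋) (proj₂ (⟦⟧⇒⊩ e r)) (proj₂ (⟦⟧⇒⊩ d r′))
  ⟦⟧⇒⊩ (deref d) r = _ , un deref (proj₂ (⟦⟧⇒⊩ d r))
  ⟦⟧⇒⊩ (while d e) r = loop-to (⟦⟧⇒⊩ d) (⟦⟧⇒⊩ e) r
  ⟦⟧⇒⊩ (ifzero _ d e f) (s , t , u≋ , inj₁ (r , r′)) =
    _ , bin ifzero₀ (⌜⌝-∙ s t u≋) (proj₂ (⟦⟧⇒⊩ d r)) (proj₂ (⟦⟧⇒⊩ e r′))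
  ⟦⟧⇒⊩ (ifzero _ d e f) (s , t , u≋ , inj₂ ((_ , r) , r′)) =
    _ , bin ifzero₊ (⌜⌝-∙ s t u≋) (proj₂ (⟦⟧⇒⊩ d r)) (proj₂ (⟦⟧⇒⊩ f r′))
  ⟦⟧⇒⊩ (new _ d) {u} (s , c , r) =
    _ , new (proj₂ (cell⇒run c)) (resp (⌜⌝-◂ s u) (proj₂ (⟦⟧⇒⊩ d r)))
  ⟦⟧⇒⊩ (mkvar d e) {b = write k} (ks , a , r) = _ , un (write (all-num a)) (proj₂ (⟦⟧⇒⊩ d r))
  ⟦⟧⇒⊩ (mkvar d e) {b = read k} r = _ , un read (proj₂ (⟦⟧⇒⊩ e r))

  Decodes : ∀ {n} (Γ : Ctx n) → Tm n → ∀ A → (Trace Γ → α A → Set) → Set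
  Decodes Γ M A R = ∀ {u k b} → ⌜ u ⌝ ⊩[ k ] M ∶ enc A b → R u b

  map-nil : ∀ {X : Set} {f : X → Pt} xs → map f xs ≡ [] → xs ≡ []
  map-nil [] refl = refl

  ext-from : ∀ {n} {Γ : Ctx n} {M A R} → Decodes Γ M A R →
             ∀ {v k} {u : Trace Γ} as → v ≋ ⌜ u ⌝ → v ⊩*[ k ] M ∶ map (enc A) as → Ext (Traces Γ) R u as
  ext-from f {u = u} [] e ([] z) = [] λ i → map-nil (u i) (trans (sym (e i)) (z i))
  ext-from f (a ∷ as) e (d ⟨ v≋ ⟩∷ ds) with ⌜⌝-split (≋-trans (≋-sym e) v≋)
  ... | _ , _ , u≋ , e₁ , e₂ = add (f (resp e₁ d)) (ext-from f as e₂ ds) u≋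

  loop-from : ∀ {n} {Γ : Ctx n} {M N G C} → Decodes Γ M nat G → Decodes Γ N comm C →
              ∀ {v k} {u : Trace Γ} → v ≋ ⌜ u ⌝ → v ⊩[ k ] while M N ∶ done → Loop G C u
  loop-from f g e (un while d) = stop (f (resp e d))
  loop-from f g e (bin while v≋ d (bin seq w≋ d′ l)) with ⌜⌝-split (≋-trans (≋-sym e) v≋)
  ... | _ , _ , u≋ , e₁ , e₂ with ⌜⌝-split (≋-trans (≋-sym e₂) w≋)
  ... | _ , _ , u′≋ , e₃ , e₄ =
    step _ _ (f (resp e₁ d)) (g (resp e₃ d′)) (loop-from f g e₄ l)
      λ i → trans (u≋ i) (cong (_ ++_) (u′≋ i))

  -- Together with `⟦⟧⇒⊩` this makes the denotation independent of the derivation `d`, since `⊩`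
  -- mentions the term alone.
  ⊩⇒⟦⟧ : ∀ {n} {Γ : Ctx n} {M A} (d : Γ ⊢ M ∶ A) → Decodes Γ M A ⟦ d ⟧₁
  ⊩⇒⟦⟧ id (var (h , _)) = encs-injective _ h
  ⊩⇒⟦⟧ (lam d) {u} {b = s , b} (lam _ r) = ⊩⇒⟦⟧ d (resp (≋-sym (⌜⌝-◂ s u)) r)
  ⊩⇒⟦⟧ (app {m} {n} {M = M} {N} d e) {u} (app {s = s} {t} u≋ r rs)
    with rename⁻ (↑ˡ-injective n _ _) M r | rename⁻* (↑ʳ-injective m _ _) N rs
  ... | r₁ | rs₁
    -- The intermediate points come untyped; typing of the argument makes them encodings of elements
    -- of its alphabet.
    with decodes (points-typed (⊢⇒⊢ᵃ e) (λ i → typed-ʳ {s = s} u≋ (⌜⌝-typed u) (m ↑ʳ i)) rs₁)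
  ... | as , refl = as , ⊩⇒⟦⟧ d (resp e₁ r₁) , ext-from (⊩⇒⟦⟧ e) as e₂ rs₁
    where
    e₁ : s ∘ (_↑ˡ n) ≋ ⌜ u ∘ (_↑ˡ n) ⌝
    e₁ i = sym (trans (u≋ (i ↑ˡ n)) (trans (cong (s (i ↑ˡ n) ++_)
      (support* rs (∉-rename⁺ N λ i′ → inj₂ (↑ˡ≢↑ʳ i i′)))) (++-identityʳ _)))
    e₂ : t ∘ (m ↑ʳ_) ≋ ⌜ u ∘ (m ↑ʳ_) ⌝
    e₂ i = sym (trans (u≋ (m ↑ʳ i)) (cong (_++ t (m ↑ʳ i))
      (support r (∉-rename⁺ M λ i′ → inj₂ (↑ˡ≢↑ʳ i′ i ∘ sym)))))
  ⊩⇒⟦⟧ (weak {M = M} d) {u} r =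
    map-nil (u zero) (support r (0∉-weaken M)) , ⊩⇒⟦⟧ d (rename⁻ suc-injective M r)
  ⊩⇒⟦⟧ (exch {M = M} π d) r = ⊩⇒⟦⟧ d (rename⁻ (perm-inj π) M r)
  ⊩⇒⟦⟧ (num k) (const num _) = refl
  ⊩⇒⟦⟧ skip r = tt
  ⊩⇒⟦⟧ (binop o d e) (bin binop u≋ r r′) with ⌜⌝-split u≋
  ... | _ , _ , u≋′ , e₁ , e₂ = _ , _ , u≋′ , _ , _ , refl , ⊩⇒⟦⟧ d (resp e₁ r) , ⊩⇒⟦⟧ e (resp e₂ r′)
  ⊩⇒⟦⟧ (seq _ d e) (bin seq u≋ r r′) with ⌜⌝-split u≋
  ... | _ , _ , u≋′ , e₁ , e₂ = _ , _ , u≋′ , ⊩⇒⟦⟧ d (resp e₁ r) , ⊩⇒⟦⟧ e (resp e₂ r′)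
  ⊩⇒⟦⟧ (assign d e) (bin assign u≋ r r′) with ⌜⌝-split u≋
  ... | _ , _ , u≋′ , e₁ , e₂ = _ , _ , u≋′ , _ , ⊩⇒⟦⟧ e (resp e₁ r) , ⊩⇒⟦⟧ d (resp e₂ r′)
  ⊩⇒⟦⟧ (deref d) (un deref r) = ⊩⇒⟦⟧ d r
  ⊩⇒⟦⟧ (while d e) r = loop-from (⊩⇒⟦⟧ d) (⊩⇒⟦⟧ e) (λ _ → refl) r
  ⊩⇒⟦⟧ (ifzero _ d e f) (bin ifzero₀ u≋ r r′) with ⌜⌝-split u≋
  ... | _ , _ , u≋′ , e₁ , e₂ = _ , _ , u≋′ , inj₁ (⊩⇒⟦⟧ d (resp e₁ r) , ⊩⇒⟦⟧ e (resp e₂ r′))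
  ⊩⇒⟦⟧ (ifzero _ d e f) (bin ifzero₊ u≋ r r′) with ⌜⌝-split u≋
  ... | _ , _ , u≋′ , e₁ , e₂ = _ , _ , u≋′ , inj₂ ((_ , ⊩⇒⟦⟧ d (resp e₁ r)) , ⊩⇒⟦⟧ f (resp e₂ r′))
  ⊩⇒⟦⟧ (new _ d) {u} (new c r) with decodes (run-typed c)
  ... | s , refl = s , run⇒cell s c , ⊩⇒⟦⟧ d (resp (≋-sym (⌜⌝-◂ s u)) r)
  ⊩⇒⟦⟧ (mkvar d e) {b = write k} (un (write a) r) with num-all a
  ... | ks , a′ , refl = ks , a′ , ⊩⇒⟦⟧ d r
  ⊩⇒⟦⟧ (mkvar d e) {b = read k} (un read r) = ⊩⇒⟦⟧ e r

  -- Renaming closed terms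

  rename-rename : ∀ {l m n} {ρ : Fin m → Fin n} {ρ′ : Fin l → Fin m} {ρ″ : Fin l → Fin n} →
                  (∀ i → ρ (ρ′ i) ≡ ρ″ i) → ∀ M → rename ρ (rename ρ′ M) ≡ rename ρ″ M
  lift-lift : ∀ {l m n} {ρ : Fin m → Fin n} {ρ′ : Fin l → Fin m} {ρ″ : Fin l → Fin n} →
              (∀ i → ρ (ρ′ i) ≡ ρ″ i) → ∀ i → lift 1 ρ (lift 1 ρ′ i) ≡ lift 1 ρ″ i
  lift-lift e zero    = refl
  lift-lift e (suc i) = cong suc (e i)
  rename-rename e (num k) = refl
  rename-rename e (binop o M N) = cong₂ (binop o) (rename-rename e M) (rename-rename e N)
  rename-rename e skip = refl
  rename-rename e (seq M N) = cong₂ seq (rename-rename e M) (rename-rename e N)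
  rename-rename e (assign M N) = cong₂ assign (rename-rename e M) (rename-rename e N)
  rename-rename e (deref M) = cong deref (rename-rename e M)
  rename-rename e (while M N) = cong₂ while (rename-rename e M) (rename-rename e N)
  rename-rename e (ifzero M N P) =
    cong₂ (λ M (N , P) → ifzero M N P) (rename-rename e M)
      (cong₂ _,_ (rename-rename e N) (rename-rename e P))
  rename-rename e (` i) = cong `_ (e i)
  rename-rename e (ƛ A M) = cong (ƛ A) (rename-rename (lift-lift e) M)
  rename-rename e (M · N) = cong₂ _·_ (rename-rename e M) (rename-rename e N)
  rename-rename e (new M) = cong new (rename-rename (lift-lift e) M)
  rename-rename e (mkvar M N) = cong₂ mkvar (rename-rename e M) (rename-rename e N)

  rename-id : ∀ {n} {ρ : Fin n → Fin n} → (∀ i → ρ i ≡ i) → ∀ M → rename ρ M ≡ M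
  lift-id : ∀ {n} {ρ : Fin n → Fin n} → (∀ i → ρ i ≡ i) → ∀ i → lift 1 ρ i ≡ i
  lift-id e zero    = refl
  lift-id e (suc i) = cong suc (e i)
  rename-id e (num k) = refl
  rename-id e (binop o M N) = cong₂ (binop o) (rename-id e M) (rename-id e N)
  rename-id e skip = refl
  rename-id e (seq M N) = cong₂ seq (rename-id e M) (rename-id e N)
  rename-id e (assign M N) = cong₂ assign (rename-id e M) (rename-id e N)
  rename-id e (deref M) = cong deref (rename-id e M)
  rename-id e (while M N) = cong₂ while (rename-id e M) (rename-id e N)
  rename-id e (ifzero M N P) =
    cong₂ (λ M (N , P) → ifzero M N P) (rename-id e M) (cong₂ _,_ (rename-id e N) (rename-id e P))
  rename-id e (` i) = cong `_ (e i)
  rename-id e (ƛ A M) = cong (ƛ A) (rename-id (lift-id e) M)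
  rename-id e (M · N) = cong₂ _·_ (rename-id e M) (rename-id e N)
  rename-id e (new M) = cong new (rename-id (lift-id e) M)
  rename-id e (mkvar M N) = cong₂ mkvar (rename-id e M) (rename-id e N)

  wk : ∀ {n} → Tm 0 → Tm n
  wk {n} = rename (_↑ˡ n)

  rename-wk : ∀ {m n} (ρ : Fin m → Fin n) T → rename ρ (wk T) ≡ wk T
  rename-wk ρ T = rename-rename (λ ()) T

  -- Admissible typing rules

  num⊢ : ∀ {n} {Γ : Ctx n} k → Γ ⊢ num k ∶ nat
  num⊢ {zero}  k = num k
  num⊢ {suc n} k = weak (num⊢ k)

  skip⊢ : ∀ {n} {Γ : Ctx n} → Γ ⊢ skip ∶ comm
  skip⊢ {zero}  = skip
  skip⊢ {suc n} = weak skip⊢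

  -- Weakening inserts the new identifier at index 0, so a swap has to bring the variable back
  -- there.
  zero⊢ : ∀ {n} {Γ : Ctx (suc n)} → Γ ⊢ ` zero ∶ Γ zero
  zero⊢ {zero}  = id
  zero⊢ {suc n} = exch (Perm.swap Perm.id) (weak zero⊢)

  ClosedTyped : Tm 0 → Ty → Set
  ClosedTyped T A = ∀ {Γ : Ctx 0} → Γ ⊢ T ∶ A

  wk⊢ : ∀ {n} {Γ : Ctx n} {T A} → ClosedTyped T A → Γ ⊢ wk T ∶ A
  wk⊢ {zero}  {T = T} d = transport (_ ⊢_∶ _) (sym (rename-id (λ ()) T)) d
  wk⊢ {suc n} {T = T} d = transport (_ ⊢_∶ _) (rename-wk suc T) (weak (wk⊢ d))

  app⊢ : ∀ {n} {Γ : Ctx n} {T N A B} → ClosedTyped T (A ⊸ B) → Γ ⊢ N ∶ A → Γ ⊢ wk T · N ∶ B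
  app⊢ {T = T} {N} d e =
    transport (λ N → _ ⊢ wk T · N ∶ _) (rename-id (λ _ → refl) N) (app {0} d e)

  -- Test terms

  -- Divergence: a loop continues as long as its guard is 0.
  Ω : ∀ {n} → Tm n
  Ω = while (num 0) skip

  -- Truncated subtraction is a comparison that every choice of operations provides: `m ∸ k` is 0
  -- exactly when `m ≤ k`. Equality takes both directions, hence two reads.
  atMost atLeast equals : ∀ {n} → Fin n → ℕ → Tm n
  atMost c k  = ifzero (binop minus (deref (` c)) (num k)) skip Ω
  atLeast c k = ifzero (binop minus (num k) (deref (` c))) skip Ω
  equals c k  = seq (atMost c k) (atLeast c k)

  -- Each evaluation of the argument is a use of it, and the comparison needs the number twice.
  -- Copying it to a cell keeps the test at a single use.
  testNat : ℕ → Tm 0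
  testNat k = ƛ nat (new (seq (assign (` zero) (` suc zero)) (equals zero k)))

  -- Terms with a single point. At type `var` one action succeeds: reads yield `k` and writes
  -- diverge, or writes accept only `k` and reads diverge.
  answer-nat : ∀ {n} → α nat → Tm n
  answer-comm : ∀ {n} → α comm → Tm n
  answer-var : ∀ {n} → α var → Tm n
  answer-nat  k         = num k
  answer-comm tt        = skip
  answer-var  (read k)  = mkvar (ƛ nat Ω) (num k)
  answer-var  (write k) = mkvar (wk (testNat k)) (seq Ω (num 0))

  fail-nat fail-comm fail-var : ∀ {n} → Tm n
  fail-nat  = seq Ω (num 0)
  fail-comm = Ω
  fail-var  = mkvar (ƛ nat Ω) (seq Ω (num 0))

  each : ∀ {n} {X : Set} → (X → Tm 0) → List X → Tm (suc n)
  each T []      = skip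
  each T (a ∷ s) = seq (wk (T a) · (` zero)) (each T s)

  -- The cell c counts the uses; entry k of the list serves the use number i + k.

  chain : ∀ {n} {X : Set} → (X → Tm n) → Tm n → Fin n → ℕ → List (Tm n × X) → Tm n
  chain r f c i []            = f
  chain r f c i ((C , b) ∷ L) =
    ifzero (binop minus (deref (` c)) (num i))
      (seq (assign (` c) (num (suc i))) (seq C (r b)))
      (chain r f c (suc i) L)

  test : ∀ A → α A → Tm 0
  gen : ∀ A → List (α A) → Tm 0
  -- Conditionals are typed at base types only, so the choice of an entry waits until all arguments
  -- are bound. Meanwhile each entry collects in its command the tests of the arguments it expects.
  dispatch : ∀ A {n} → Fin n → ℕ → List (Tm n × α A) → Tm n
  extend-command : ∀ A {B n} → Tm n × α (A ⊸ B) → Tm (suc n) × α B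
  extend-command A (C , (s , b)) = seq (rename suc C) (each (test A) s) , b

  test nat     k         = testNat k
  test comm    _         = ƛ comm (` zero)
  test var     (read k)  = ƛ var (wk (testNat k) · deref (` zero))
  test var     (write k) = ƛ var (assign (` zero) (num k))
  -- The final count must be `length s`, since otherwise a function that consumes a proper prefix of
  -- `s` would pass as well.
  test (A ⊸ B) (s , b)   =
    ƛ (A ⊸ B) (new (seq (wk (test B b) · ((` suc zero) · (wk (gen A s) · (` zero))))
                        (equals zero (length s))))
  -- The counter is a parameter, which keeps the generator closed and lets the test inspect the
  -- count after the call.
  gen A s = ƛ var (dispatch A zero 0 (map (skip ,_) s))
  dispatch nat     c i L = chain answer-nat fail-nat c i L
  dispatch comm    c i L = chain answer-comm fail-comm c i L
  dispatch var     c i L = chain answer-var fail-var c i L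
  dispatch (A ⊸ B) c i L = ƛ A (dispatch B (suc c) i (map (extend-command A) L))

  Ω⊢ : ∀ {n} {Γ : Ctx n} → Γ ⊢ Ω ∶ comm
  Ω⊢ = while (num⊢ 0) skip⊢

  equals⊢ : ∀ {n} {Γ : Ctx n} {c} k → Γ ⊢ ` c ∶ var → Γ ⊢ equals c k ∶ comm
  equals⊢ k d = seq comm (ifzero comm (binop minus (deref d) (num⊢ k)) skip⊢ Ω⊢)
                         (ifzero comm (binop minus (num⊢ k) (deref d)) skip⊢ Ω⊢)

  testNat⊢ : ∀ k → ClosedTyped (testNat k) (nat ⊸ comm)
  testNat⊢ k = lam (new comm (seq comm (assign zero⊢ (weak zero⊢)) (equals⊢ k zero⊢)))

  answer-var⊢ : ∀ {n} {Γ : Ctx n} b → Γ ⊢ answer-var b ∶ var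
  answer-var⊢ (read k)  = mkvar (lam Ω⊢) (num⊢ k)
  answer-var⊢ (write k) = mkvar (wk⊢ (testNat⊢ k)) (seq nat Ω⊢ (num⊢ 0))

  each⊢ : ∀ {n} {Γ : Ctx n} {A} {X : Set} {T : X → Tm 0} → (∀ a → ClosedTyped (T a) (A ⊸ comm)) →
          ∀ s → A ◂ Γ ⊢ each T s ∶ comm
  each⊢ h []      = skip⊢
  each⊢ h (a ∷ s) = seq comm (app⊢ (h a) zero⊢) (each⊢ h s)

  CommandsTyped : ∀ {n} {X : Set} → Ctx n → List (Tm n × X) → Set
  CommandsTyped Γ = All (λ (C , _) → Γ ⊢ C ∶ comm)

  chain⊢ : ∀ {n} {X : Set} {Γ : Ctx n} {r : X → Tm n} {f c A} → Base A →
           (∀ b → Γ ⊢ r b ∶ A) → Γ ⊢ f ∶ A → Γ ⊢ ` c ∶ var →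
           ∀ i {L} → CommandsTyped Γ L → Γ ⊢ chain r f c i L ∶ A
  chain⊢ β hr hf hc i []      = hf
  chain⊢ β hr hf hc i (h ∷ τ) =
    ifzero β (binop minus (deref hc) (num⊢ i))
      (seq β (assign hc (num⊢ (suc i))) (seq β h (hr _)))
      (chain⊢ β hr hf hc (suc i) τ)

  test⊢ : ∀ A a → ClosedTyped (test A a) (A ⊸ comm)
  gen⊢ : ∀ A s → ClosedTyped (gen A s) (var ⊸ A)
  dispatch⊢ : ∀ A {n} {Γ : Ctx n} {c} i {L} → Γ ⊢ ` c ∶ var → CommandsTyped Γ L →
              Γ ⊢ dispatch A c i L ∶ A
  extend-command⊢ : ∀ A {B n} {Γ : Ctx n} (x : Tm n × α (A ⊸ B)) → Γ ⊢ proj₁ x ∶ comm →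
                    A ◂ Γ ⊢ proj₁ (extend-command A {B} x) ∶ comm
  extend-command⊢ A (C , (s , b)) d = seq comm (weak d) (each⊢ (test⊢ A) s)
  test⊢ nat     k         = testNat⊢ k
  test⊢ comm    _         = lam zero⊢
  test⊢ var     (read k)  = lam (app⊢ (testNat⊢ k) (deref zero⊢))
  test⊢ var     (write k) = lam (assign zero⊢ (num⊢ k))
  test⊢ (A ⊸ B) (s , b)   = lam (new comm (seq comm (app⊢ (test⊢ B b) use) (equals⊢ (length s) zero⊢)))
    where
    -- `app` puts the block of the function first, whereas the cell is bound last and has index 0.
    π = Perm.swap (Perm.id {0})
    use : ∀ {Γ : Ctx 0} → var ◂ ((A ⊸ B) ◂ Γ) ⊢ (` suc zero) · (wk (gen A s) · (` zero)) ∶ B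
    use {Γ} = transport (λ G → var ◂ ((A ⊸ B) ◂ Γ) ⊢ (` suc zero) · (G · (` zero)) ∶ B)
            (trans (cong (rename (π ⟨$⟩ʳ_)) (rename-wk _ (gen A s))) (rename-wk _ (gen A s)))
            (exch π (app {1} {1} id (app⊢ (gen⊢ A s) id)))
  gen⊢ A s = lam (dispatch⊢ A 0 zero⊢ (All.map⁺ (All.universal (λ _ → skip⊢) s)))
  dispatch⊢ nat     i hc τ = chain⊢ nat num⊢ (seq nat Ω⊢ (num⊢ 0)) hc i τ
  dispatch⊢ comm    i hc τ = chain⊢ comm (λ _ → skip⊢) Ω⊢ hc i τ
  dispatch⊢ var     i hc τ = chain⊢ var answer-var⊢ (mkvar (lam Ω⊢) (seq nat Ω⊢ (num⊢ 0))) hc i τ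
  dispatch⊢ (A ⊸ B) i hc τ =
    lam (dispatch⊢ B i (weak hc) (All.map⁺ (All.map (λ {x} → extend-command⊢ A {B} x) τ)))

  -- Points of the basic tests and answers

  only-resp : ∀ {n} {c : Fin n} {ps u v} → u ≋ v → Only c ps u → Only c ps v
  only-resp e (h , z) = trans (sym (e _)) h , λ j ne → trans (sym (e j)) (z j ne)

  only-∙ : ∀ {n} {c : Fin n} {ps qs u s t} → u ≋ s ∙ t → Only c ps s → Only c qs t → Only c (ps ++ qs) u
  only-∙ e (h , z) (h′ , z′) =
    trans (e _) (cong₂ _++_ h h′) , λ j ne → ++-nil (e j) (z j ne) (z′ j ne)

  only-≋ : ∀ {n} {c : Fin n} {ps u v} → Only c ps u → Only c ps v → u ≋ v
  only-≋ {c = c} (h , z) (h′ , z′) j with j ≟ c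
  ... | yes refl = trans h (sym h′)
  ... | no ne    = trans (z j ne) (sym (z′ j ne))

  single-++ : ∀ {n} (c : Fin n) ps qs → single c (ps ++ qs) ≋ single c ps ∙ single c qs
  single-++ c ps qs j with j ≟ c
  ... | yes _ = refl
  ... | no _  = refl

  only-nil : ∀ {n} {c : Fin n} {u} → Nil u → Only c [] u
  only-nil z = z _ , λ j _ → z j

  nil-only : ∀ {n} {c : Fin n} {u} → Only c [] u → Nil u
  nil-only o = only-≋ o (refl , λ _ _ → refl)

  Ω⁻ : ∀ {n k} {u : Env n} {p} → ¬ (u ⊩[ k ] Ω ∶ p)
  Ω⁻ (un while (const () _))
  Ω⁻ (bin while _ _ (bin seq _ _ d)) = Ω⁻ d

  wk⁻ : ∀ {n k} T {v : Env n} {p} → v ⊩[ k ] wk T ∶ p → Nil v × v ∘ (_↑ˡ n) ⊩[ k ] T ∶ p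
  wk⁻ T d = (λ i → support d (∉-rename⁺ T λ ())) , rename⁻ (λ {}) T d

  wk⁺ : ∀ {n k T u p} → u ⊩[ k ] T ∶ p → ε {n} ⊩[ k ] wk T ∶ p
  wk⁺ d = rename⁺ (λ {}) (λ j → inj₂ ((λ ()) , refl)) d

  -- Since `ps` must be a singleton, the argument is used exactly once, and an application of `T`
  -- has the same trace as its argument.
  record Tests (T : Tm 0) (q : Pt) : Set where
    constructor tests
    field
      {size}   : ℕ
      complete : ε ⊩[ size ] T ∶ (q ∷ []) ⇒ done
      unique   : ∀ {u k ps} → u ⊩[ k ] T ∶ ps ⇒ done → ps ≡ q ∷ []

  test-app⁻ : ∀ {n k T q N} {v : Env n} → Tests T q → v ⊩[ k ] wk T · N ∶ done →
              ∃ λ l → v ⊩[ l ] N ∶ q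
  test-app⁻ {T = T} (tests _ unique) (app v≋ d ds) with wk⁻ T d
  ... | z , d′ = _ , resp (≋-sym (nil-∙ˡ v≋ z)) (*-single ds (unique d′))

  test-app⁺ : ∀ {n k T q N} {v : Env n} → Tests T q → v ⊩[ k ] N ∶ q →
              ∃ λ l → v ⊩[ l ] wk T · N ∶ done
  test-app⁺ {v = v} (tests d _) e =
    _ , app {s = ε} {v} (λ _ → refl) (wk⁺ d)
          (_⟨_⟩∷_ {s = v} {ε} e (λ i → sym (++-identityʳ (v i))) ([] λ _ → refl))

  run-read⁻ : ∀ {j r s j′} → Run j (rd r ∷ s) j′ → j ≡ r × Run j s j′
  run-read⁻ (rd∷ r) = refl , r

  run-write⁻ : ∀ {j r s j′} → Run j (wr r ∷ s) j′ → Run r s j′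
  run-write⁻ (wr∷ _ r) = r

  at-point : ∀ {n k} {u : Env n} {M p q} → p ≡ q → u ⊩[ k ] M ∶ p → u ⊩[ k ] M ∶ q
  at-point refl d = d

  minus⁻ : ∀ {n k} {c : Fin n} {i u p} → u ⊩[ k ] binop minus (deref (` c)) (num i) ∶ p →
           ∃ λ r → p ≡ num (r ∸ i) × Only c (rd r ∷ []) u
  minus⁻ (bin binop u≋ (un deref (var h)) (const num z)) =
    _ , cong num (minus-is-∸ _ _) , only-resp (≋-sym (nil-∙ʳ u≋ z)) h

  minusʳ⁻ : ∀ {n k} {c : Fin n} {i u p} → u ⊩[ k ] binop minus (num i) (deref (` c)) ∶ p →
            ∃ λ r → p ≡ num (i ∸ r) × Only c (rd r ∷ []) u
  minusʳ⁻ (bin binop u≋ (const num z) (un deref (var h))) =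
    _ , cong num (minus-is-∸ _ _) , only-resp (≋-sym (nil-∙ˡ u≋ z)) h

  minus⁺ : ∀ {n} (c : Fin n) r i →
           ∃ λ k → single c (rd r ∷ []) ⊩[ k ] binop minus (deref (` c)) (num i) ∶ num (r ∸ i)
  minus⁺ c r i = _ , at-point (cong num (minus-is-∸ r i))
    (bin {s = single c (rd r ∷ [])} {ε} binop (λ j → sym (++-identityʳ _))
      (un deref (var (single-only c _))) (const num λ _ → refl))

  minusʳ⁺ : ∀ {n} (c : Fin n) r i →
            ∃ λ k → single c (rd r ∷ []) ⊩[ k ] binop minus (num i) (deref (` c)) ∶ num (i ∸ r)
  minusʳ⁺ c r i = _ , at-point (cong num (minus-is-∸ i r))
    (bin {s = ε} {single c (rd r ∷ [])} binop (λ j → refl)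
      (const num λ _ → refl) (un deref (var (single-only c _))))

  num-injective : ∀ {k l} → Pt.num k ≡ num l → k ≡ l
  num-injective refl = refl

  atMost⁻ : ∀ {n k} {c : Fin n} {i u p} → u ⊩[ k ] atMost c i ∶ p →
            ∃ λ r → r ≤ i × Only c (rd r ∷ []) u
  atMost⁻ (bin ifzero₊ _ _ d) = contradiction d Ω⁻
  atMost⁻ (bin ifzero₀ u≋ d (const skip z)) with minus⁻ d
  ... | r , e , h = r , m∸n≡0⇒m≤n (num-injective (sym e)) , only-resp (≋-sym (nil-∙ʳ u≋ z)) h

  atLeast⁻ : ∀ {n k} {c : Fin n} {i u p} → u ⊩[ k ] atLeast c i ∶ p →
             ∃ λ r → i ≤ r × Only c (rd r ∷ []) u
  atLeast⁻ (bin ifzero₊ _ _ d) = contradiction d Ω⁻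
  atLeast⁻ (bin ifzero₀ u≋ d (const skip z)) with minusʳ⁻ d
  ... | r , e , h = r , m∸n≡0⇒m≤n (num-injective (sym e)) , only-resp (≋-sym (nil-∙ʳ u≋ z)) h

  -- The derivation alone would let the two reads return different numbers; the run of the cell
  -- forces both to return its contents.
  equals⁻ : ∀ {n k} {c : Fin n} {i u p j j′} → u ⊩[ k ] equals c i ∶ p → Run j (u c) j′ →
            j ≡ i × (∀ x → x ≢ c → u x ≡ [])
  equals⁻ {c = c} {u = u} (bin seq u≋ d d′) r with atMost⁻ d | atLeast⁻ d′
  ... | k , k≤ , h | l , ≤l , h′ with only-∙ u≋ h h′
  ... | at , off with u c
  equals⁻ (bin seq u≋ d d′) (rd∷ (rd∷ [])) | _ , k≤ , _ | _ , ≤k , _ | refl , off | _ = ≤-antisym k≤ ≤k , off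

  equals⁺ : ∀ {n} (c : Fin n) i → ∃ λ k → single c (rd i ∷ rd i ∷ []) ⊩[ k ] equals c i ∶ done
  equals⁺ c i = _ ,
    bin seq (single-++ c (rd i ∷ []) (rd i ∷ []))
      (check (at-point (cong num (n∸n≡0 i)) (proj₂ (minus⁺ c i i))))
      (check (at-point (cong num (n∸n≡0 i)) (proj₂ (minusʳ⁺ c i i))))
    where
    a = single c (rd i ∷ [])
    check : ∀ {k M} → a ⊩[ k ] M ∶ num 0 → a ⊩[ _ ] ifzero M skip Ω ∶ done
    check d = bin {s = a} {ε} ifzero₀ (λ j → sym (++-identityʳ _)) d (const skip λ _ → refl)

  testNat-tests : ∀ k → Tests (testNat k) (num k)
  testNat-tests k = tests (lam (num ∷ []) (new (wr∷ k (rd∷ (rd∷ []))) (resp e d))) unique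
    where
    x : Env 2
    x = single (suc zero) (num k ∷ []) ∙ single zero (wr k ∷ [])
    d : x ∙ single zero (rd k ∷ rd k ∷ []) ⊩[ _ ] seq (assign (` zero) (` suc zero)) (equals zero k) ∶ done
    d = bin seq (λ _ → refl)
          (bin {s = single (suc zero) (num k ∷ [])} {single zero (wr k ∷ [])} assign (λ _ → refl)
            (var (single-only (suc zero) _)) (var (single-only zero _)))
          (proj₂ (equals⁺ zero k))
    e : x ∙ single zero (rd k ∷ rd k ∷ []) ≋ (wr k ∷ rd k ∷ rd k ∷ []) ◂ ((num k ∷ []) ◂ ε)
    e zero          = refl
    e (suc zero)    = refl
    e (suc (suc ()))
    unique : ∀ {u j ps p} → u ⊩[ j ] testNat k ∶ ps ⇒ p → ps ≡ num k ∷ []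
    unique (lam _ (new r (bin {t = t} seq u≋ (bin assign v≋ (var (h , z)) (var (h′ , z′))) d)))
      with equals⁻ d (run-write⁻ (transport (λ a → Run _ a _) (trans (u≋ zero)
             (cong (_++ t zero) (trans (v≋ zero) (cong₂ _++_ (z zero λ ()) h′)))) r))
    ... | refl , off = trans (u≋ (suc zero))
      (cong₂ _++_ (trans (v≋ (suc zero)) (cong₂ _++_ h (z′ (suc zero) λ ()))) (off (suc zero) λ ()))

  record Answers {n} {X : Set} (r : X → Tm n) (f : Tm n) (e : X → Pt) : Set where
    field
      produced : ∀ b → ∃ λ k → ε ⊩[ k ] r b ∶ e b
      only     : ∀ {u k p} b → u ⊩[ k ] r b ∶ p → Nil u × p ≡ e b
      failing  : ∀ {u k p} → ¬ (u ⊩[ k ] f ∶ p)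

  open Answers

  fail⁻ : ∀ {n k} {u : Env n} {N p} → ¬ (u ⊩[ k ] seq Ω N ∶ p)
  fail⁻ (bin seq _ d _) = Ω⁻ d

  nat-answers : ∀ {n} → Answers {n} answer-nat fail-nat (enc nat)
  nat-answers .produced k = _ , const num λ _ → refl
  nat-answers .only k (const num z) = z , refl
  nat-answers .failing = fail⁻

  comm-answers : ∀ {n} → Answers {n} answer-comm fail-comm (enc comm)
  comm-answers .produced _ = _ , const skip λ _ → refl
  comm-answers .only _ (const skip z) = z , refl
  comm-answers .failing = Ω⁻

  var-answers : ∀ {n} → Answers {n} answer-var fail-var (enc var)
  var-answers .produced (read k) = _ , un read (const num λ _ → refl)
  var-answers .produced (write k) =
    _ , un (write (refl ∷ [])) (wk⁺ (Tests.complete (testNat-tests k)))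
  var-answers .only (read k) (un read (const num z)) = z , refl
  var-answers .only (read k) (un (write _) (lam _ d)) = contradiction d Ω⁻
  var-answers .only (write k) (un read d) = contradiction d fail⁻
  var-answers .only (write k) (un (write a) d) with wk⁻ (testNat k) d
  ... | z , d′ with Tests.unique (testNat-tests k) d′
  var-answers .only (write k) (un (write (refl ∷ [])) d) | z , d′ | refl = z , refl
  var-answers .failing (un read d) = fail⁻ d
  var-answers .failing (un (write _) (lam _ d)) = Ω⁻ d

  -- Counting the uses

  -- At i L k x: x is the entry number k of L, whose first entry has number i.

  data At {X : Set} : ℕ → List X → ℕ → X → Set where
    here  : ∀ {i x L} → At i (x ∷ L) i x
    there : ∀ {i x y L k} → At (suc i) L k x → At i (y ∷ L) k x

  at-≤ : ∀ {X i k} {L : List X} {x} → At i L k x → i ≤ k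
  at-≤ here      = ≤-refl
  at-≤ (there a) = <⇒≤ (at-≤ a)

  at-map⁺ : ∀ {X Y i k} {f : X → Y} {L x} → At i L k x → At i (map f L) k (f x)
  at-map⁺ here      = here
  at-map⁺ (there a) = there (at-map⁺ a)

  at-map⁻ : ∀ {X Y i k} {f : X → Y} L {y} → At i (map f L) k y → ∃ λ x → At i L k x × y ≡ f x
  at-map⁻ (x ∷ L) here      = x , here , refl
  at-map⁻ (x ∷ L) (there a) with at-map⁻ L a
  ... | y , b , e = y , there b , e

  -- Commands must leave the counter alone, otherwise it would not count uses.
  Silent : ∀ {n} → Fin n → Tm n → Set
  Silent c C = ∀ {u k p} → u ⊩[ k ] C ∶ p → u c ≡ []

  AllSilent : ∀ {n} {X : Set} → Fin n → List (Tm n × X) → Set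
  AllSilent c = All (λ x → Silent c (proj₁ x))

  Off : ∀ {n} → Fin n → Env n → Env n → Set
  Off c u v = ∀ j → j ≢ c → u j ≡ v j

  -- One use seen from outside: the counter moves from `j` to `suc j`, entry `j` gives the answer,
  -- and off the counter only the command of that entry leaves a trace.
  record Served {n} {X : Set} (c : Fin n) (i : ℕ) (L : List (Tm n × X)) (e : X → Pt)
                (u : Env n) (p : Pt) (j j′ : ℕ) : Set where
    constructor served
    field
      {C}      : Tm n
      {b}      : X
      {v}      : Env n
      {size}   : ℕ
      entry    : At i L j (C , b)
      point    : p ≡ e b
      next     : j′ ≡ suc j
      executed : v ⊩[ size ] C ∶ done
      off      : Off c u v

  -- The invariant `i ≤ j` turns the truncated test `j ∸ i ≡ 0` into `j ≡ i`, and failure of the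
  -- test re-establishes it for `suc i`.
  chain⁻ : ∀ {n} {X : Set} {r : X → Tm n} {f e} (c : Fin n) i L {u k p j j′} → Answers r f e →
           AllSilent c L → u ⊩[ k ] chain r f c i L ∶ p → i ≤ j → Run j (u c) j′ →
           Served c i L e u p j j′
  chain⁻ c i [] R _ d _ _ = contradiction d (failing R)
  chain⁻ c i ((C , b) ∷ L) {u} R (σ ∷ _)
    (bin ifzero₀ u≋ g
      (bin seq t≋ (bin assign a≋ (const num z) (var (h , z′))) (bin {s = v} seq w≋ d d′)))
    i≤j run
    with minus⁻ g | only R b d′
  ... | r , eq , (g-at , g-off) | wz , refl
    with run-read⁻ (transport (λ a → Run _ a _) at-c run)
    where
    at-c : u c ≡ rd r ∷ wr (suc i) ∷ []
    at-c = trans (u≋ c) (cong₂ _++_ g-at (trans (t≋ c) (cong₂ _++_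
             (trans (nil-∙ˡ a≋ z c) h) (trans (w≋ c) (cong₂ _++_ (σ d) (wz c))))))
  ... | refl , run′ with ≤-antisym i≤j (m∸n≡0⇒m≤n (num-injective (sym eq))) | run-write⁻ run′
  ... | refl | [] = served here refl refl d off
    where
    off : Off c u v
    off x ne = trans (u≋ x) (trans (cong₂ _++_ (g-off x ne) (trans (t≋ x) (cong₂ _++_
      (trans (nil-∙ˡ a≋ z x) (z′ x ne)) (nil-∙ʳ w≋ wz x)))) refl)
  chain⁻ c i ((C , b) ∷ L) {u} R (_ ∷ σ) (bin {t = t} ifzero₊ u≋ g d) i≤j run with minus⁻ g
  ... | r , eq , (g-at , g-off)
    with run-read⁻ (transport (λ a → Run _ a _) (trans (u≋ c) (cong (_++ t c) g-at)) run)
  ... | refl , run′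
    with chain⁻ c (suc i) L R σ d
           (m∸n≢0⇒n<m λ e → contradiction (trans (num-injective eq) e) λ ()) run′
  ... | served a e nx x off = served (there a) e nx x λ y ne →
    trans (u≋ y) (trans (cong (_++ t y) (g-off y ne)) (off y ne))

  open Answers

  record Serves {n} {X : Set} (c : Fin n) (M : Tm n) (e : X → Pt) (v : Env n) (b : X) (j : ℕ) : Set where
    constructor serves
    field
      {u}    : Env n
      {size} : ℕ
      point  : u ⊩[ size ] M ∶ e b
      run    : Run j (u c) (suc j)
      off    : Off c u v

  single-at : ∀ {n} (c : Fin n) ps → single c ps c ≡ ps
  single-at c ps = proj₁ (single-only c ps)

  single-off : ∀ {n} {c : Fin n} {ps j} → j ≢ c → single c ps j ≡ []
  single-off ne = proj₂ (single-only _ _) _ ne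

  chain⁺ : ∀ {n} {X : Set} {r : X → Tm n} {f e} (c : Fin n) i L {v k j C b} → Answers r f e →
           AllSilent c L → At i L j (C , b) → v ⊩[ k ] C ∶ done → Serves c (chain r f c i L) e v b j
  chain⁺ c i (_ ∷ L) {v} R (σ ∷ _) here d = serves
    (bin {s = g} {(ε ∙ w) ∙ (v ∙ ε)} ifzero₀ (λ _ → refl)
      (at-point (cong num (n∸n≡0 i)) (proj₂ (minus⁺ c i i)))
      (bin {s = ε ∙ w} {v ∙ ε} seq (λ _ → refl)
        (bin {s = ε} {w} assign (λ _ → refl) (const num λ _ → refl) (var (single-only c _)))
        (bin {s = v} {ε} seq (λ _ → refl) d (proj₂ (produced R _)))))
    (transport (λ a → Run i a (suc i))
      (sym (cong₂ _++_ (single-at c _) (cong₂ _++_ (single-at c _) (cong (_++ []) (σ d)))))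
      (rd∷ (wr∷ (suc i) [])))
    (λ j ne → trans (cong₂ _++_ (single-off ne) (cong (_++ v j ++ []) (single-off ne)))
                    (++-identityʳ (v j)))
    where
    g w : Env _
    g = single c (rd i ∷ [])
    w = single c (wr (suc i) ∷ [])
  chain⁺ c i (_ ∷ L) {j = j} R (_ ∷ σ) (there a) d with chain⁺ c (suc i) L R σ a d
  ... | serves {u} p r off with j ∸ i in eq | minus⁺ c j i
  ... | zero  | _ = contradiction (m∸n≡0⇒m≤n eq) (<⇒≱ (at-≤ a))
  ... | suc m | _ , g = serves
    (bin {s = single c (rd j ∷ [])} {u} ifzero₊ (λ _ → refl) g p)
    (transport (λ a → Run j a (suc j)) (sym (cong (_++ u c) (single-at c _))) (rd∷ r))
    (λ x ne → trans (cong (_++ u x) (single-off ne)) (off x ne))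

  each⁻ : ∀ {n k} {X : Set} {T : X → Tm 0} {e} → (∀ a → Tests (T a) (e a)) → ∀ s {v : Env (suc n)} {p} →
          v ⊩[ k ] each T s ∶ p → Only zero (map e s) v
  each⁻ h []      (const skip z) = only-nil z
  each⁻ h (a ∷ s) (bin seq v≋ d d′) with test-app⁻ (h a) d
  ... | _ , var o = only-∙ v≋ o (each⁻ h s d′)

  each⁺ : ∀ {n} {X : Set} {T : X → Tm 0} {e} → (∀ a → Tests (T a) (e a)) → ∀ s →
          ∃ λ k → single {suc n} zero (map e s) ⊩[ k ] each T s ∶ done
  each⁺ h [] = _ , const skip (nil-only (single-only zero []))
  each⁺ {e = e} h (a ∷ s) = _ ,
    bin {s = x} {y} seq (single-++ zero (e a ∷ []) (map e s))
      (proj₂ (test-app⁺ (h a) (var (single-only zero _)))) (proj₂ (each⁺ h s))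
    where
    x y : Env _
    x = single zero (e a ∷ [])
    y = single zero (map e s)

  -- Generators and tests at all types

  -- Seg i L j as j′: the entries j, …, j′ - 1 of L, whose first entry has number i, are as.

  data Seg {X : Set} (i : ℕ) (L : List X) : ℕ → List X → ℕ → Set where
    []  : ∀ {j} → Seg i L j [] j
    _∷_ : ∀ {j a as j′} → At i L j a → Seg i L (suc j) as j′ → Seg i L j (a ∷ as) j′

  seg-there : ∀ {X i j j′} {x : X} {L as} → Seg (suc i) L j as j′ → Seg i (x ∷ L) j as j′
  seg-there []      = []
  seg-there (a ∷ s) = there a ∷ seg-there s

  seg-tail : ∀ {X i j j′} {x : X} {L as} → suc i ≤ j → Seg i (x ∷ L) j as j′ → Seg (suc i) L j as j′
  seg-tail le []            = []
  seg-tail le (here ∷ s)    = contradiction le (<-irrefl refl)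
  seg-tail le (there a ∷ s) = a ∷ seg-tail (≤-trans le (n≤1+n _)) s

  seg-all : ∀ {X} i (L : List X) → Seg i L i L (length L + i)
  seg-all i []      = []
  seg-all i (x ∷ L) = here ∷ seg-there 
    (transport (Seg (suc i) L (suc i) L) (+-suc (length L) i) (seg-all (suc i) L))

  seg-unique : ∀ {X i j} (L : List X) {as} → Seg i L i as j → j ≡ length L + i → as ≡ L
  seg-unique [] [] e = refl
  seg-unique (x ∷ L) [] e = contradiction e (m≢1+n+m _)
  seg-unique (x ∷ L) (here ∷ s) e =
    cong (x ∷_) (seg-unique L (seg-tail ≤-refl s) (trans e (sym (+-suc (length L) _))))
  seg-unique (x ∷ L) (there a ∷ s) e = contradiction (at-≤ a) (<-irrefl refl)

  -- General in the scope and in the commands, because at `A ⊸ B` the dispatch continues at `B`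
  -- under a binder with longer commands.
  record Spec (A : Ty) : Set where
    field
      serve⁻ : ∀ {n} (c : Fin n) i {L u k p j j′} → AllSilent c L → u ⊩[ k ] dispatch A c i L ∶ p →
               i ≤ j → Run j (u c) j′ → Served c i L (enc A) u p j j′
      serve⁺ : ∀ {n} (c : Fin n) i {L v k j C b} → AllSilent c L → At i L j (C , b) →
               v ⊩[ k ] C ∶ done → Serves c (dispatch A c i L) (enc A) v b j

  open Spec

  module Generate {A} (S : Spec A) (s : List (α A)) where

    skips : List (Tm 1 × α A)
    skips = map (skip ,_) s

    skips-silent : AllSilent zero skips
    skips-silent = All.map⁺ (All.universal (λ _ → λ { (const skip z) → z zero }) s)

    use⁻ : ∀ {n k} {c : Fin n} {v p j j′} → v ⊩[ k ] wk (gen A s) · (` c) ∶ p → Run j (v c) j′ →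
           ∃ λ a → At 0 s j a × p ≡ enc A a × j′ ≡ suc j × (∀ x → x ≢ c → v x ≡ [])
    use⁻ (app v≋ d ds) r with wk⁻ (gen A s) d
    ... | z , lam _ d′ with only-resp (≋-sym (nil-∙ˡ v≋ z)) (vars⁻ ds)
    ... | at-c , off
      with serve⁻ S zero 0 skips-silent d′ z≤n (transport (λ a → Run _ a _) at-c r)
    ... | served a refl refl _ _ with at-map⁻ s a
    ... | _ , a′ , refl = _ , a′ , refl , refl , off

    use⁺ : ∀ {n j a} (c : Fin n) → At 0 s j a →
           ∃₂ λ τ k → single c τ ⊩[ k ] wk (gen A s) · (` c) ∶ enc A a × Run j τ (suc j)
    use⁺ c a with serve⁺ S zero 0 skips-silent (at-map⁺ a) (const {u = ε} skip λ _ → refl)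
    ... | serves {u} d r _ =
      u zero , _ ,
      app {s = ε} {single c (u zero)} (λ _ → refl)
        (wk⁺ {u = u ∘ suc} (lam (run-typed r) (resp (◂-η u) d)))
        (vars⁺ (u zero) (single-only c _)) , r

    -- Each use starts at the count where the previous one stopped, so the points served in
    -- succession are consecutive entries of `s`.
    uses⁻ : ∀ {n k} {c : Fin n} {v ps j j′} → v ⊩*[ k ] wk (gen A s) · (` c) ∶ ps → Run j (v c) j′ →
            ∃ λ as → Seg 0 s j as j′ × ps ≡ map (enc A) as × (∀ x → x ≢ c → v x ≡ [])
    uses⁻ {c = c} ([] z) r with refl ← run-nil r (z c) = [] , [] , refl , λ x _ → z x
    uses⁻ {c = c} (_⟨_⟩∷_ {s = s′} d v≋ ds) r with run-split (s′ c) (transport (λ a → Run _ a _) (v≋ c) r)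
    ... | _ , r₁ , r₂ with use⁻ d r₁
    ... | a , a∈ , refl , refl , off with uses⁻ ds r₂
    ... | as , seg , refl , off′ = a ∷ as , a∈ ∷ seg , refl , λ x ne → ++-nil (v≋ x) (off x ne) (off′ x ne)

    uses⁺ : ∀ {n j j′ as} (c : Fin n) → Seg 0 s j as j′ →
            ∃₂ λ τ k → single c τ ⊩*[ k ] wk (gen A s) · (` c) ∶ map (enc A) as × Run j τ j′
    uses⁺ c [] = [] , _ , [] (nil-only (single-only c [])) , []
    uses⁺ c (a ∷ seg) with use⁺ c a | uses⁺ c seg
    ... | τ , _ , d , r | τ′ , _ , ds , r′ = τ ++ τ′ , _ ,
      d ⟨ single-++ c τ τ′ ⟩∷ ds ,
      run-++ r r′

  sole : ∀ ps {u : Env 0} → Only zero ps (ps ◂ u)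
  sole ps = refl , λ { zero ne → contradiction refl ne }

  -- The two inductions need each other: testing a function generates its arguments, and generating
  -- a function tests the arguments it receives.
  test-tests : ∀ A a → Tests (test A a) (enc A a)
  dispatch-spec : ∀ A → Spec A

  module Arrow (A B : Ty) {n} (c : Fin n) where

    silent : ∀ {L} → AllSilent c L → AllSilent (suc c) (map (extend-command A {B}) L)
    silent []      = []
    silent {L = (C , _) ∷ _} (σ ∷ σs) =
      (λ { (bin seq u≋ d d′) → ++-nil (u≋ _) (σ (rename⁻ suc-injective C d))
             (proj₂ (each⁻ (test-tests A) _ d′) _ λ ()) })
      ∷ silent σs

  dispatch-spec nat .serve⁻ c i = chain⁻ c i _ nat-answers
  dispatch-spec nat .serve⁺ c i = chain⁺ c i _ nat-answers
  dispatch-spec comm .serve⁻ c i = chain⁻ c i _ comm-answers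
  dispatch-spec comm .serve⁺ c i = chain⁺ c i _ comm-answers
  dispatch-spec var .serve⁻ c i = chain⁻ c i _ var-answers
  dispatch-spec var .serve⁺ c i = chain⁺ c i _ var-answers
  dispatch-spec (A ⊸ B) .serve⁻ c i {L} {u} σ (lam {ps = ps} _ d) le r
    with serve⁻ (dispatch-spec B) (suc c) i (Arrow.silent A B c σ) d le r
  ... | served {v = v} a refl refl e off with at-map⁻ L a
  ... | (C , s , b) , a′ , refl with e
  ... | bin {s = v₁} {v₂} seq v≋ d₁ d₂ with each⁻ (test-tests A) s d₂
  ... | at-0 , off₀ = served a′ (cong (Pt._⇒ _) ps≡) refl (rename⁻ suc-injective C d₁)
    λ j ne → trans (off (suc j) (ne ∘ suc-injective)) 
      (trans (v≋ (suc j)) (trans (cong (v₁ (suc j) ++_) (off₀ (suc j) λ ())) (++-identityʳ _)))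
    where
    -- The earlier command is weakened and never touches the new argument, so its points are just
    -- those consumed by `each`.
    ps≡ : ps ≡ map (enc A) s
    ps≡ = trans (off zero λ ()) (trans (v≋ zero) (cong₂ _++_ (support d₁ (0∉-weaken C)) at-0))
  dispatch-spec (A ⊸ B) .serve⁺ c i {v = v} {b = s , b} σ a d
    with serve⁺ (dispatch-spec B) (suc c) i (Arrow.silent A B c σ) (at-map⁺ a)
      (bin {s = [] ◂ v} {single zero (map (enc A) s)} seq (λ _ → refl)
        (rename⁺ suc-injective (push-suc v) d) (proj₂ (each⁺ (test-tests A) s)))
  ... | serves {u} p r off = serves {u = u ∘ suc}
    (lam (encs-typed A s) (resp (λ { zero → off zero λ () ; (suc j) → refl }) p)) r
    λ j ne → trans (off (suc j) (ne ∘ suc-injective)) (++-identityʳ (v j))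

  test-tests nat k = testNat-tests k
  test-tests comm _ = tests
    (lam (done ∷ []) (var (sole _)))
    λ { (lam _ (var (h , _))) → h }
  test-tests var (read k) = tests
    (lam {u = ε} (rd ∷ []) (proj₂ (test-app⁺ (testNat-tests k) (un deref (var (sole _))))))
    λ { (lam _ d) → unique (test-app⁻ (testNat-tests k) d) }
    where
    unique : ∀ {ps} {u : Env 0} → (∃ λ l → ps ◂ u ⊩[ l ] deref (` zero) ∶ num k) → ps ≡ rd k ∷ []
    unique (_ , un deref (var (h , _))) = h
  test-tests var (write k) = tests
    (lam {u = ε} (wr ∷ [])
      (bin {s = ε} assign (λ _ → refl) (const num λ _ → refl) (var (sole _))))
    λ { (lam _ (bin assign u≋ (const num z) (var (h , _)))) → trans (nil-∙ˡ u≋ z zero) h }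
  test-tests (A ⊸ B) (s , b) = tests (proj₂ complete) unique
    where
    open Generate (dispatch-spec A) s
    fun : Pt
    fun = map (enc A) s ⇒ enc B b
    unique : ∀ {u k ps p} → u ⊩[ k ] test (A ⊸ B) (s , b) ∶ ps ⇒ p → ps ≡ fun ∷ []
    unique (lam _ (new run (bin {s = s₁} seq u≋ d d′))) with test-app⁻ (test-tests B b) d
    ... | _ , app {s = x} {t} s≋ (var (h , z)) ds
      with run-split (s₁ zero) (transport (λ a → Run _ a _) (u≋ zero) run)
    ... | _ , r₁ , r₂
      with uses⁻ ds (transport (λ a → Run _ a _) (trans (s≋ zero) (cong (_++ t zero) (z zero λ ()))) r₁)
         | equals⁻ d′ r₂
    ... | as , seg , refl , off | len , off′
      -- The checked count leaves no room for a proper prefix: the segment that was served is all of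
      -- `s`.
      with refl ← seg-unique s seg (trans len (sym (+-identityʳ (length s)))) =
      trans (u≋ (suc zero)) (cong₂ _++_ (trans (s≋ (suc zero)) (cong₂ _++_ h (off (suc zero) λ ())))
                                     (off′ (suc zero) λ ()))
    complete : ∃ λ k → ε ⊩[ k ] test (A ⊸ B) (s , b) ∶ (fun ∷ []) ⇒ done
    complete with uses⁺ {2} zero (seg-all 0 s)
    ... | τ , _ , ds , r
      with test-app⁺ (test-tests B b) (app {s = single (suc zero) (fun ∷ [])} {single zero τ} (λ _ → refl)
             (var (single-only (suc zero) _)) ds)
    ... | _ , d = _ , lam (enc-typed (A ⊸ B) (s , b) ∷ [])
      (new (run-++ (transport (Run 0 τ) (+-identityʳ (length s)) r) (rd∷ (rd∷ [])))
        (resp e (bin seq (λ _ → refl) d (proj₂ (equals⁺ zero (length s))))))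
      where
      e : (single (suc zero) (fun ∷ []) ∙ single zero τ) ∙ single zero (rd (length s) ∷ rd (length s) ∷ []) ≋
          (τ ++ rd (length s) ∷ rd (length s) ∷ []) ◂ ((fun ∷ []) ◂ ε)
      e zero           = refl
      e (suc zero)     = refl
      e (suc (suc ()))

  -- Closing open terms

  lift-≗ : ∀ {n} {Γ Δ : Ctx n} {A} → (∀ i → Γ i ≡ Δ i) → ∀ i → (A ◂ Γ) i ≡ (A ◂ Δ) i
  lift-≗ e zero    = refl
  lift-≗ e (suc i) = e i

  ⊢-resp : ∀ {n} {Γ Δ : Ctx n} {M A} → (∀ i → Γ i ≡ Δ i) → Γ ⊢ M ∶ A → Δ ⊢ M ∶ A
  ⊢-resp {Δ = Δ} e id = transport (λ A → Δ ⊢ ` zero ∶ A) (sym (e zero)) id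
  ⊢-resp e (lam d) = lam (⊢-resp (lift-≗ e) d)
  ⊢-resp e (app {m} {n} d d′) = app (⊢-resp (e ∘ (_↑ˡ n)) d) (⊢-resp (e ∘ (m ↑ʳ_)) d′)
  ⊢-resp e (weak d) = weak (⊢-resp (e ∘ suc) d)
  ⊢-resp e (exch π d) = exch π (⊢-resp (e ∘ (π ⟨$⟩ʳ_)) d)
  ⊢-resp e (num k) = num k
  ⊢-resp e skip = skip
  ⊢-resp e (binop o d d′) = binop o (⊢-resp e d) (⊢-resp e d′)
  ⊢-resp e (seq β d d′) = seq β (⊢-resp e d) (⊢-resp e d′)
  ⊢-resp e (assign d d′) = assign (⊢-resp e d) (⊢-resp e d′)
  ⊢-resp e (deref d) = deref (⊢-resp e d)
  ⊢-resp e (while d d′) = while (⊢-resp e d) (⊢-resp e d′)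
  ⊢-resp e (ifzero β d d′ d″) = ifzero β (⊢-resp e d) (⊢-resp e d′) (⊢-resp e d″)
  ⊢-resp e (new β d) = new β (⊢-resp (lift-≗ e) d)
  ⊢-resp e (mkvar d d′) = mkvar (⊢-resp e d) (⊢-resp e d′)

  -- Without function extensionality a context need not equal the one that the
  -- binders of its closure build up.

  rebuild : ∀ {n} → Ctx n → Ctx n
  rebuild {zero}  Γ = ∅
  rebuild {suc n} Γ = Γ zero ◂ rebuild (Γ ∘ suc)

  rebuild-≗ : ∀ {n} (Γ : Ctx n) i → rebuild Γ i ≡ Γ i
  rebuild-≗ Γ zero    = refl
  rebuild-≗ Γ (suc i) = rebuild-≗ (Γ ∘ suc) i

  closureTy : ∀ {n} → Ctx n → Ty → Ty
  closureTy {zero}  Γ A = A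
  closureTy {suc n} Γ A = closureTy (Γ ∘ suc) (Γ zero ⊸ A)

  closure : ∀ {n} → Ctx n → Tm n → Tm 0
  closure {zero}  Γ M = M
  closure {suc n} Γ M = closure (Γ ∘ suc) (ƛ (Γ zero) M)

  closureCxt : ∀ {m n} {Γ₀ : Ctx m} (Γ : Ctx n) → Cxt Γ₀ (rebuild Γ) → Cxt Γ₀ ∅
  closureCxt {n = zero}  Γ C = C
  closureCxt {n = suc n} Γ C = closureCxt (Γ ∘ suc) (ƛ (Γ zero) C)

  closureCxt-⟪⟫ : ∀ {m n} {Γ₀ : Ctx m} (Γ : Ctx n) (C : Cxt Γ₀ (rebuild Γ)) M →
                  closureCxt Γ C ⟪ M ⟫ ≡ closure Γ (C ⟪ M ⟫)
  closureCxt-⟪⟫ {n = zero}  Γ C M = refl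
  closureCxt-⟪⟫ {n = suc n} Γ C M = closureCxt-⟪⟫ (Γ ∘ suc) (ƛ (Γ zero) C) M

  closure⊢ : ∀ {n} (Γ : Ctx n) {M A} → rebuild Γ ⊢ M ∶ A → ∅ ⊢ closure Γ M ∶ closureTy Γ A
  closure⊢ {zero}  Γ d = d
  closure⊢ {suc n} Γ d = closure⊢ (Γ ∘ suc) (lam d)

  curryᵗ : ∀ {n} (Γ : Ctx n) A → Trace Γ → α A → α (closureTy Γ A)
  curryᵗ {zero}  Γ A u b = b
  curryᵗ {suc n} Γ A u b = curryᵗ (Γ ∘ suc) (Γ zero ⊸ A) (λ i → u (suc i)) (u zero , b)

  closure⁺ : ∀ {n} (Γ : Ctx n) A {M k} {u : Trace Γ} {b} → ⌜ u ⌝ ⊩[ k ] M ∶ enc A b →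
             ∃ λ l → ε ⊩[ l ] closure Γ M ∶ enc (closureTy Γ A) (curryᵗ Γ A u b)
  closure⁺ {zero}  Γ A d = _ , resp (λ ()) d
  closure⁺ {suc n} Γ A {u = u} d =
    closure⁺ (Γ ∘ suc) (Γ zero ⊸ A) (lam (encs-typed (Γ zero) (u zero)) (resp (◂-η ⌜ u ⌝) d))

  closure⁻ : ∀ {n} (Γ : Ctx n) A {M k w} {u : Trace Γ} {b} →
             w ⊩[ k ] closure Γ M ∶ enc (closureTy Γ A) (curryᵗ Γ A u b) → ∃ λ l → ⌜ u ⌝ ⊩[ l ] M ∶ enc A b
  closure⁻ {zero}  Γ A d = _ , resp (λ ()) d
  closure⁻ {suc n} Γ A {u = u} d with closure⁻ (Γ ∘ suc) (Γ zero ⊸ A) {u = λ i → u (suc i)} d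
  ... | _ , lam _ d′ = _ , resp (≋-sym (◂-η ⌜ u ⌝)) d′

  -- Closing by λ turns the traces of the free identifiers into argument sequences, so the pair `u`,
  -- `b` becomes a single element of `closureTy Γ A`, to which a closed test applies.
  module Recognise {n} (Γ : Ctx n) (A : Ty) (u : Trace Γ) (b : α A) where

    T : Tm 0
    T = test (closureTy Γ A) (curryᵗ Γ A u b)

    C : Cxt Γ ∅
    C = app₂ (wk T) (closureCxt Γ (hole (↣-id _) (rebuild-≗ Γ)))

    C-⟪⟫ : ∀ M → C ⟪ M ⟫ ≡ wk T · closure Γ M
    C-⟪⟫ M = cong (wk T ·_) (trans (closureCxt-⟪⟫ Γ _ M) (cong (closure Γ) (rename-id (λ _ → refl) M)))

    C⊢ : ∀ {M} → Γ ⊢ M ∶ A → ∅ ⊢ C ⟪ M ⟫ ∶ comm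
    C⊢ {M} d = transport (∅ ⊢_∶ comm) (sym (C-⟪⟫ M))
      (app⊢ (test⊢ (closureTy Γ A) _) (closure⊢ Γ (⊢-resp (λ i → sym (rebuild-≗ Γ i)) d)))

    recognise⁺ : ∀ {M k} → ⌜ u ⌝ ⊩[ k ] M ∶ enc A b → ⊩ C ⟪ M ⟫ ∶ done
    recognise⁺ {M} d = transport (⊩_∶ done) (sym (C-⟪⟫ M))
      (_ , test-app⁺ (test-tests (closureTy Γ A) _) (proj₂ (closure⁺ Γ A d)))

    recognise⁻ : ∀ {M} → ⊩ C ⟪ M ⟫ ∶ done → ∃ λ k → ⌜ u ⌝ ⊩[ k ] M ∶ enc A b
    recognise⁻ {M} r with transport (⊩_∶ done) (C-⟪⟫ M) r
    ... | _ , _ , d = closure⁻ Γ A (proj₂ (test-app⁻ (test-tests (closureTy Γ A) _) d))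

  -- From elements to morphisms and contextual equivalence

  ext-map : ∀ {X P} {R S : _ → X → Set} → (∀ {p x} → R p x → S p x) → ∀ {p xs} → Ext P R p xs → Ext P S p xs
  ext-map f ([] e)      = [] e
  ext-map f (add r s e) = add (f r) (ext-map f s) e

  ⌜⌝-cong : ∀ {n} {Γ : Ctx n} {u v : Trace Γ} → u ≋ v → ⌜ u ⌝ ≋ ⌜ v ⌝
  ⌜⌝-cong {Γ = Γ} e i = cong (map (enc (Γ i))) (e i)

  ⟦⟧-singleton : ∀ {n} {Γ : Ctx n} {M A} (d : Γ ⊢ M ∶ A) {u b} →
                 Ext (Traces Γ) ⟦ d ⟧₁ u (b ∷ []) ⇔ ⟦ d ⟧₁ u b
  ⟦⟧-singleton d = mk⇔
    -- Invariance of `⟦ d ⟧₁` under `≋` is obtained by passing through `⊩`, where it is `resp`.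
    (λ { (add {p} r ([] z) e) → ⊩⇒⟦⟧ d (resp
           (⌜⌝-cong λ i → sym (trans (e i) (trans (cong (p i ++_) (z i)) (++-identityʳ (p i)))))
           (proj₂ (⟦⟧⇒⊩ d r))) })
    (λ r → add r ([] λ _ → refl) λ _ → sym (++-identityʳ _))

  module _ {n} {Γ : Ctx n} {A : Ty} {M N : Tm n} (d : Γ ⊢ M ∶ A) (e : Γ ⊢ N ∶ A) where

    -- Every well-typed trace is, up to `≋`, an encoding, so an inclusion between denotations says
    -- all that `Refines` asks for.
    ⟦⟧⊆⇒refines : (∀ {u b} → ⟦ d ⟧₁ u b → ⟦ e ⟧₁ u b) → Refines Γ M N
    ⟦⟧⊆⇒refines f {u} τ r with decode (point-typed (⊢⇒⊢ᵃ d) τ r)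
    ... | b , refl = _ , resp u≋ (proj₂ (⟦⟧⇒⊩ e (f (⊩⇒⟦⟧ d (resp (≋-sym u≋) r)))))
      where
      u≋ : ⌜ (λ i → proj₁ (decodes (τ i))) ⌝ ≋ u
      u≋ i = proj₂ (decodes (τ i))

    refines⇒⇓ : Refines Γ M N → (C : Cxt Γ ∅) {B : Ty} → Observable B → ∅ ⊢ C ⟪ M ⟫ ∶ B →
                ∅ ⊢ C ⟪ N ⟫ ∶ B → ∀ {V} → Value V → ∅ ⊢ V ∶ B → C ⟪ M ⟫ ⇓ V → C ⟪ N ⟫ ⇓ V
    refines⇒⇓ f C o dC eC V dV c with answer o V (⊢⇒⊢ᵃ dV)
    ... | _ , a with ⇓⇒⊩ (⊢⇒⊢ᵃ dC) a c
    ... | u , _ , r = ⊩⇒⇓ (⊢⇒⊢ᵃ eC) a (u , Congruence.cong-⟪⟫ f C (λ ()) r)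

    ≅⇒⟦⟧⊆ : (∀ C → ∅ ⊢ C ⟪ M ⟫ ∶ comm → ∅ ⊢ C ⟪ N ⟫ ∶ comm → C ⟪ M ⟫ ⇓ skip → C ⟪ N ⟫ ⇓ skip) →
             ∀ {u b} → ⟦ d ⟧₁ u b → ⟦ e ⟧₁ u b
    ≅⇒⟦⟧⊆ f {u} {b} r = ⊩⇒⟦⟧ e (proj₂ (recognise⁻ (⇓⇒⊩ (⊢⇒⊢ᵃ (C⊢ e)) skip
      (f C (C⊢ d) (C⊢ e) (⊩⇒⇓ (⊢⇒⊢ᵃ (C⊢ d)) skip (recognise⁺ (proj₂ (⟦⟧⇒⊩ d r))))))))
      where open Recognise Γ A u b

  full-abstraction : ∀ {n} {Γ : Ctx n} {A M N} (d : Γ ⊢ M ∶ A) (e : Γ ⊢ N ∶ A) →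
                     (⟦ d ⟧ ≈ᴿ ⟦ e ⟧) ⇔ (Γ ⊢ M ≅ N)
  full-abstraction {Γ = Γ} d e = mk⇔
    (λ eq C {B} o dC eC V v dV →
      mk⇔ (refines⇒⇓ d e
             (⟦⟧⊆⇒refines d e λ r → to (⟦⟧-singleton e) (to (eq _ _) (from (⟦⟧-singleton d) r)))
             C o dC eC v dV)
          (refines⇒⇓ e d
             (⟦⟧⊆⇒refines e d λ r → to (⟦⟧-singleton d) (from (eq _ _) (from (⟦⟧-singleton e) r)))
             C o eC dC v dV))
    (λ eq u bs →
      mk⇔ (ext-map {P = Traces Γ} (≅⇒⟦⟧⊆ d e λ C dC eC → to (eq C comm dC eC skip skip skip)))
          (ext-map {P = Traces Γ} (≅⇒⟦⟧⊆ e d λ C eC dC → from (eq C comm dC eC skip skip skip))))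
    where open Equivalence using (to; from)

corollary9p3 : (𝓐 : Arithmetic) → let open SCImk 𝓐 in
    {n : ℕ} (Γ : Ctx n) (A : Ty) (M N : Tm n)
    (d : Γ ⊢ M ∶ A) (e : Γ ⊢ N ∶ A) →
    (⟦ d ⟧ ≈ᴿ ⟦ e ⟧) ⇔ (Γ ⊢ M ≅ N)
corollary9p3 𝓐 Γ A M N d e = FullAbstraction.full-abstraction 𝓐 d e
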